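{- Let $m \neq \pm 1$ be a square-free rational integer, let $f(x) = x^{12} - m \in \mathbb{Z}[x]$, let $\alpha$ be a complex root of $f(x)$, and let $K = \mathbb{Q}(\alpha)$. If $m \equiv 1 \pmod 4$ or $m \equiv \pm 1 \pmod 9$, then $K$ is not monogenic, i.e. there is no $\theta \in \mathbb{Z}_K$ with $\mathbb{Z}_K = \mathbb{Z}[\theta]$.
   Context: $\mathbb{Z}_K$ denotes the ring of integers of $K$. A number field $K$ is monogenic if $\mathbb{Z}_K = \mathbb{Z}[\theta]$ for some $\theta \in \mathbb{Z}_K$, equivalently $\mathbb{Z}_K$ has a power integral basis $(1,\theta,\dots,\theta^{n-1})$. -}

module Defs where

open import Data.Nat as ℕ using (ℕ)
open import Data.Integer as ℤ using (ℤ; +_; -[1+_]; ∣_∣)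
open import Data.Integer.Divisibility as ℤD using ()
open import Data.Nat.Divisibility as ℕD using ()
open import Data.Rational as ℚ using (ℚ; 0ℚ; 1ℚ; _/_)
open import Data.Vec using (Vec; []; _∷_; replicate; zipWith; map; init; last; toList)
open import Data.List using (List; []; _∷_; _++_; [_])
open import Data.Product using (Σ; ∃; ∃-syntax; _×_)
open import Relation.Binary.PropositionalEquality using (_≡_)

-- The number field K = ℚ(α), α^12 = m, modelled concretely as
-- ℚ[x]/(x^12 - m): an element is its coordinate vector
-- (c₀, …, c₁₁) w.r.t. the basis 1, α, …, α^11 (lowest degree first).
K : Set
K = Vec ℚ 12

ℤ→ℚ : ℤ → ℚ
ℤ→ℚ z = z / 1

0K : K
0K = replicate 12 0ℚ

embed : ℚ → K
embed c = c ∷ replicate 11 0ℚ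

addK : K → K → K
addK = zipWith ℚ._+_

scaleK : ℚ → K → K
scaleK c = map (c ℚ.*_)

mulα : ℤ → K → K
mulα m v = (ℤ→ℚ m ℚ.* last v) ∷ init v

hornerMul : ℤ → List ℚ → K → K
hornerMul m []       b = 0K
hornerMul m (c ∷ cs) b = addK (scaleK c b) (mulα m (hornerMul m cs b))

mulK : ℤ → K → K → K
mulK m a b = hornerMul m (toList a) b

evalℤ : ℤ → List ℤ → K → K
evalℤ m []       θ = 0K
evalℤ m (c ∷ cs) θ = addK (embed (ℤ→ℚ c)) (mulK m θ (evalℤ m cs θ))

InZK : ℤ → K → Set
InZK m θ = ∃[ cs ] evalℤ m (cs ++ [ + 1 ]) θ ≡ 0K

InZθ : ℤ → K → K → Set
InZθ m θ β = ∃[ p ] evalℤ m p θ ≡ β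

-- K is monogenic: ℤ_K = ℤ[θ] for some θ ∈ ℤ_K
-- (ℤ[θ] ⊆ ℤ_K holds automatically since ℤ_K is a ring containing θ)
Monogenic : ℤ → Set
Monogenic m = ∃[ θ ] InZK m θ × (∀ β → InZK m β → InZθ m θ β)

-- square-free: no square of an integer d > 1 divides m (excludes m = 0)
SquareFree : ℤ → Set
SquareFree m = ∀ (d : ℕ) → (d ℕ.* d) ℕD.∣ ∣ m ∣ → d ≡ 1

-- Let p = 2 if m ≡ 1 modulo 4, and p = 3 if m ≡ ±1 modulo 9. K is
-- mapped to a tower T of free ℚ-algebras, with a ℤ₍ₚ₎-order Λ and an ideal J ⊇ p Λ of Λ such that
-- x^(p²) ≡ x modulo J on Λ, and such that Λ and J are the closed and the open unit ball of a
-- power-multiplicative norm. So Λ contains every integral element, and if ℤ_K = ℤ[θ] then the image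
-- of ℤ_K in Λ/J, a product of fields 𝔽_p and 𝔽_{p²}, is generated by the class of θ. But there are
-- not enough monic irreducible polynomials of degree 1 and 2 over 𝔽_p for this:
-- * for p = 2, the image contains the order of ℚ(α²) generated by α² and (1 + α⁶)/2, whose reduction
--   has dimension 6 over 𝔽₂, whereas x⁴ - x only has degree 4;
-- * for p = 3 and m ≡ 1, the algebra Λ/J has a factor 𝔽₃⁴, whereas x³ - x only has degree 3;
-- * for p = 3 and m ≡ -1, we have Λ/J = 𝔽₉⁴, of dimension 8, and the class of θ has no component in
--   𝔽₃, so that it is a root of (x⁹ - x)/(x³ - x), of degree 6.

module Submission where

open import Defs
open import Algebra.Bundles using (CommutativeRing)
import Algebra.Consequences.Propositional as Consequences
import Algebra.Properties.CommutativeSemiring.Exp as Exp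
import Algebra.Solver.Ring as RingSolver
open import Algebra.Solver.Ring.AlmostCommutativeRing using (AlmostCommutativeRing; fromCommutativeRing; _-Raw-AlmostCommutative⟶_)
open import Algebra.Structures using (IsCommutativeRing)
open import Data.Empty using (⊥)
open import Data.Fin as Fin using (Fin; zero; suc; toℕ; fromℕ<; finToFun; funToFin; combine; _↑ˡ_; _↑ʳ_; splitAt; join; #_)
import Data.Fin.Properties as FinP
open import Data.Integer as ℤ using (ℤ; +_; -[1+_])
open import Data.Integer.DivMod using (_%ℕ_; _/ℕ_; n%ℕd<d; a≡a%ℕn+[a/ℕn]*n)
import Data.Integer.Divisibility.Signed as ℤ∣
import Data.Integer.Properties as ℤP
import Data.Integer.Solver as ℤSolver
open import Data.List as List using (List; []; _∷_; _++_; [_]; length)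
open import Data.Maybe using (Maybe; just; nothing)
open import Data.Nat as ℕ using (ℕ; zero; suc; z≤n; s≤s)
import Data.Nat.DivMod as ℕD
import Data.Nat.Divisibility as ℕ∣
open import Data.Nat.Induction using (<-rec)
import Data.Nat.Properties as ℕP
open import Data.Product using (∃; ∃₂; _×_; _,_; proj₁; proj₂)
open import Data.Rational as ℚ using (ℚ; 0ℚ; 1ℚ; ½)
open import Data.Rational.Properties using (+-*-commutativeRing; +-*-isCommutativeRing)
import Data.Rational.Properties as ℚP
open import Data.Rational.Unnormalised as ℚᵘ using (mkℚᵘ; *≡*)
import Data.Rational.Unnormalised.Properties as ℚᵘP
open import Data.Sum using (_⊎_; inj₁; inj₂)
open import Data.Vec as Vec using (Vec; []; _∷_; toList; init; last; replicate)
open import Function using (_∘_; id)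
open import Relation.Nullary using (¬_; yes; no)
open import Relation.Nullary.Decidable using (_→-dec_; from-yes)
open import Relation.Binary.PropositionalEquality using (_≡_; _≢_; refl; sym; trans; cong; cong₂; subst; isEquivalence; module ≡-Reasoning)

-- How `p` decomposes in `K` depends on finer congruences, for `p = 2` on `m` modulo 8. No case is
-- split off and nothing is factorised: membership in `Λ` and `J` is a condition on the divisibility
-- of coordinates, which describes the unit balls on all factors at once. Norms with half-integral
-- exponents occur because the last step of the tower may be ramified on some factors: there
-- `1 + α³` has norm 2^(-1/2), respectively `σ α⁴ - 1` has norm 3^(-1/2). This is why membership in
-- `p⁻¹ Λ` is tested on `x` and on `x² / p`. Dimensions over 𝔽_p are compared by counting: if θ
-- satisfies a monic relation of degree `d` modulo an ideal, then ℤ[θ] has at most `p^d` classes,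
-- and `p^n` incongruent elements with `n > d` are exhibited. These are combinations of monomials in
-- few explicit integral elements. `K` is linked to the tower by a single compatibility: an element
-- α with `α¹² = m` is constructed there as a quotient, and integer polynomials evaluated in `K` go
-- to their values in the tower.

record ℚAlgebra : Set₁ where
  infixl 6 _+_ _-_
  infixl 7 _*_
  infix  8 -_
  field
    Carrier : Set
    _+_ _*_ : Carrier → Carrier → Carrier
    -_      : Carrier → Carrier
    ι       : ℚ → Carrier
    isCommutativeRing : IsCommutativeRing _≡_ _+_ _*_ -_ (ι 0ℚ) (ι 1ℚ)
    ι-+   : ∀ p q → ι (p ℚ.+ q) ≡ ι p + ι q
    ι-*   : ∀ p q → ι (p ℚ.* q) ≡ ι p * ι q
    ι-neg : ∀ p → ι (ℚ.- p) ≡ - ι p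

  _-_ : Carrier → Carrier → Carrier
  x - y = x + - y

  commutativeRing : CommutativeRing _ _
  commutativeRing = record { isCommutativeRing = isCommutativeRing }

  open Exp (CommutativeRing.commutativeSemiring commutativeRing) public
    using (_^_; ^-distrib-*; ^-homo-*; ^-assocʳ)

  almostCommutativeRing : AlmostCommutativeRing _ _
  almostCommutativeRing = fromCommutativeRing commutativeRing

  -- With rational coefficients the ring solver also decides identities that involve ½ and ⅓.
  ι-morphism : CommutativeRing.rawRing +-*-commutativeRing
                 -Raw-AlmostCommutative⟶ almostCommutativeRing
  ι-morphism = record
    { ⟦_⟧    = ι
    ; +-homo = ι-+
    ; *-homo = ι-*
    ; -‿homo = ι-neg
    ; 0-homo = refl
    ; 1-homo = refl
    }

  private
    ι-≟ : ∀ p q → Maybe (ι p ≡ ι q)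
    ι-≟ p q with p ℚP.≟ q
    ... | yes p≡q = just (cong ι p≡q)
    ... | no _    = nothing

  module Solver where
    open RingSolver (CommutativeRing.rawRing +-*-commutativeRing)
                    almostCommutativeRing ι-morphism ι-≟ public

    :ℕ : ∀ {n} → ℕ → Polynomial n
    :ℕ k = con (ℤ→ℚ (+ k))

-- Quadratic and cubic extensions of an algebra

mkIsCommutativeRing :
  {A : Set} {_+_ _*_ : A → A → A} { -_ : A → A} {0# 1# : A} →
  (∀ x y z → (x + y) + z ≡ x + (y + z)) → (∀ x y → x + y ≡ y + x) →
  (∀ x → 0# + x ≡ x) → (∀ x → (- x) + x ≡ 0#) →
  (∀ x y z → (x * y) * z ≡ x * (y * z)) → (∀ x y → x * y ≡ y * x) →
  (∀ x → 1# * x ≡ x) → (∀ x y z → x * (y + z) ≡ (x * y) + (x * z)) →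
  IsCommutativeRing _≡_ _+_ _*_ -_ 0# 1#
mkIsCommutativeRing {_+_ = _+_} {_*_} { -_} +-assoc +-comm +-idˡ +-invˡ *-assoc *-comm *-idˡ distribˡ = record
  { isRing = record
    { +-isAbelianGroup = record
      { isGroup = record
        { isMonoid = record
          { isSemigroup = record
            { isMagma = record { isEquivalence = isEquivalence ; ∙-cong = cong₂ _+_ }
            ; assoc = +-assoc
            }
          ; identity = Consequences.comm∧idˡ⇒id +-comm +-idˡ
          }
        ; inverse = Consequences.comm∧invˡ⇒inv +-comm +-invˡ
        ; ⁻¹-cong = cong (-_)
        }
      ; comm = +-comm
      }
    ; *-cong = cong₂ _*_
    ; *-assoc = *-assoc
    ; *-identity = Consequences.comm∧idˡ⇒id *-comm *-idˡ
    ; distrib = distribˡ , Consequences.comm∧distrˡ⇒distrʳ *-comm distribˡ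
    }
  ; *-comm = *-comm
  }

-- Abstracting the operations allows the same formula to be read on ring elements and on polynomials
-- of the solver, which then proves the ring laws coordinatewise.
module QuadraticFormula {X : Set} (_+_ _*_ : X → X → X) (a b : X) where
  mul : X × X → X × X → X × X
  mul (x , y) (x' , y') = (x * x') + (b * (y * y')) , ((x * y') + (y * x')) + (a * (y * y'))

-- R[g]/(g² - a g - b), on the basis 1, g.
module Quadratic (R : ℚAlgebra) (a b : ℚAlgebra.Carrier R) where
  open ℚAlgebra R
  open Solver

  private
    Q = Carrier × Carrier
    0# = ι 0ℚ

    _⊕_ : Q → Q → Q
    (x , y) ⊕ (x' , y') = x + x' , y + y'

    open QuadraticFormula _+_ _*_ a b renaming (mul to _⊗_)

    module Laws (u v w : Q) where
      ρ : Env 8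
      ρ = proj₁ u ∷ proj₂ u ∷ proj₁ v ∷ proj₂ v ∷ proj₁ w ∷ proj₂ w ∷ a ∷ b ∷ []

      U V W V+W : Polynomial 8 × Polynomial 8
      U = var (# 0) , var (# 1)
      V = var (# 2) , var (# 3)
      W = var (# 4) , var (# 5)
      V+W = proj₁ V :+ proj₁ W , proj₂ V :+ proj₂ W

      open QuadraticFormula {Polynomial 8} _:+_ _:*_ (var (# 6)) (var (# 7))

      assoc : (u ⊗ v) ⊗ w ≡ u ⊗ (v ⊗ w)
      assoc = let L = mul (mul U V) W ; R = mul U (mul V W) in
        cong₂ _,_ (prove ρ (proj₁ L) (proj₁ R) refl) (prove ρ (proj₂ L) (proj₂ R) refl)

      comm : u ⊗ v ≡ v ⊗ u
      comm = let L = mul U V ; R = mul V U in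
        cong₂ _,_ (prove ρ (proj₁ L) (proj₁ R) refl) (prove ρ (proj₂ L) (proj₂ R) refl)

      distribˡ : u ⊗ (v ⊕ w) ≡ (u ⊗ v) ⊕ (u ⊗ w)
      distribˡ = let L = mul U V+W ; R = mul U V ; R' = mul U W in
        cong₂ _,_ (prove ρ (proj₁ L) (proj₁ R :+ proj₁ R') refl) (prove ρ (proj₂ L) (proj₂ R :+ proj₂ R') refl)

    ⊗-scale : ∀ r x y → (r , 0#) ⊗ (x , y) ≡ (r * x , r * y)
    ⊗-scale r x y = cong₂ _,_
      (solve 5 (λ r x y a b → let open QuadraticFormula _:+_ _:*_ a b in
        proj₁ (mul (r , con 0ℚ) (x , y)) := r :* x) refl r x y a b)
      (solve 5 (λ r x y a b → let open QuadraticFormula _:+_ _:*_ a b in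
        proj₂ (mul (r , con 0ℚ) (x , y)) := r :* y) refl r x y a b)

    +-assoc' = solve 3 (λ x y z → (x :+ y) :+ z := x :+ (y :+ z)) refl

  algebra : ℚAlgebra
  algebra = record
    { Carrier = Q
    ; _+_ = _⊕_
    ; _*_ = _⊗_
    ; -_ = λ (x , y) → - x , - y
    ; ι = λ q → ι q , 0#
    ; isCommutativeRing = mkIsCommutativeRing
        (λ (x , y) (x' , y') (x'' , y'') → cong₂ _,_ (+-assoc' x x' x'') (+-assoc' y y' y''))
        (λ (x , y) (x' , y') → cong₂ _,_ (comm x x') (comm y y'))
        (λ (x , y) → cong₂ _,_ (idˡ x) (idˡ y))
        (λ (x , y) → cong₂ _,_ (invˡ x) (invˡ y))
        Laws.assoc (λ u v → Laws.comm u v u)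
        (λ (x , y) → trans (⊗-scale (ι 1ℚ) x y) (cong₂ _,_ (1* x) (1* y)))
        Laws.distribˡ
    ; ι-+ = λ p q → cong₂ _,_ (ι-+ p q) (sym (idˡ 0#))
    ; ι-* = λ p q → trans (cong₂ _,_ (ι-* p q) (solve 1 (λ x → con 0ℚ := x :* con 0ℚ) refl (ι p))) (sym (⊗-scale (ι p) (ι q) 0#))
    ; ι-neg = λ p → cong₂ _,_ (ι-neg p) (solve 0 (con 0ℚ := :- con 0ℚ) refl)
    }
    where
    comm = solve 2 (λ x y → x :+ y := y :+ x) refl
    idˡ = solve 1 (λ x → con 0ℚ :+ x := x) refl
    invˡ = solve 1 (λ x → :- x :+ x := con 0ℚ) refl
    1* = solve 1 (λ x → con 1ℚ :* x := x) refl

  incl : Carrier → ℚAlgebra.Carrier algebra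
  incl x = x , 0#

  incl-+ : ∀ x y → incl (x + y) ≡ ℚAlgebra._+_ algebra (incl x) (incl y)
  incl-+ x y = cong (x + y ,_) (solve 0 (con 0ℚ := con 0ℚ :+ con 0ℚ) refl)

  incl-* : ∀ x y → incl (x * y) ≡ ℚAlgebra._*_ algebra (incl x) (incl y)
  incl-* x y = trans (cong (x * y ,_) (solve 1 (λ x → con 0ℚ := x :* con 0ℚ) refl x)) (sym (⊗-scale x y 0#))

  incl-neg : ∀ x → incl (- x) ≡ ℚAlgebra.-_ algebra (incl x)
  incl-neg x = cong (- x ,_) (solve 0 (con 0ℚ := :- con 0ℚ) refl)

  incl-*ˡ : ∀ r x y → ℚAlgebra._*_ algebra (incl r) (x , y) ≡ (r * x , r * y)
  incl-*ˡ = ⊗-scale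

  gen : ℚAlgebra.Carrier algebra
  gen = 0# , ι 1ℚ

  gen² : let open ℚAlgebra algebra using () renaming (_*_ to _⊛_; _+_ to _⊞_) in
         gen ⊛ gen ≡ incl a ⊛ gen ⊞ incl b
  gen² = cong₂ _,_
    (solve 2 (λ a b → let open QuadraticFormula _:+_ _:*_ a b in
      proj₁ (mul (con 0ℚ , con 1ℚ) (con 0ℚ , con 1ℚ)) := proj₁ (mul (a , con 0ℚ) (con 0ℚ , con 1ℚ)) :+ b) refl a b)
    (solve 2 (λ a b → let open QuadraticFormula _:+_ _:*_ a b in
      proj₂ (mul (con 0ℚ , con 1ℚ) (con 0ℚ , con 1ℚ)) := proj₂ (mul (a , con 0ℚ) (con 0ℚ , con 1ℚ)) :+ con 0ℚ) refl a b)

  decompose : let open ℚAlgebra algebra using () renaming (_*_ to _⊛_; _+_ to _⊞_) in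
              ∀ x y → incl x ⊞ incl y ⊛ gen ≡ (x , y)
  decompose x y = trans (cong (incl x ⊕_) (⊗-scale y 0# (ι 1ℚ))) (cong₂ _,_
    (solve 2 (λ x y → x :+ y :* con 0ℚ := x) refl x y)
    (solve 1 (λ y → con 0ℚ :+ y :* con 1ℚ := y) refl y))

module CubicFormula {X : Set} (_+_ _*_ : X → X → X) (-_ : X → X) (a b c d : X) where
  mul : X × X × X → X × X × X → X × X × X
  mul (x , y , z) (x' , y' , z') =
      (x * x') + (- (((a * c) * (y * y')) + (((a * d) * ((y * z') + (z * y'))) + ((b * d) * (z * z')))))
    , ((x * y') + (y * x')) + ((b * (y * y')) + (d * (z * z')))
    , ((x * z') + (z * x')) + (- ((a * (y * y')) + (c * (z * z'))))

-- The cubic ring of the binary cubic form (a, b, c, d) (Delone–Faddeev), on a basis 1, ω, θ with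
-- ω θ = - a d,  ω² = - a c + b ω - a θ,  θ² = - b d + d ω - c θ.
module Cubic (R : ℚAlgebra) (a b c d : ℚAlgebra.Carrier R) where
  open ℚAlgebra R
  open Solver

  private
    C = Carrier × Carrier × Carrier
    0# = ι 0ℚ

    ≡³ : ∀ {x x' y y' z z' : Carrier} → x ≡ x' → y ≡ y' → z ≡ z' → (x , y , z) ≡ (x' , y' , z')
    ≡³ refl refl refl = refl

    _⊕_ : C → C → C
    (x , y , z) ⊕ (x' , y' , z') = x + x' , y + y' , z + z'

    open CubicFormula _+_ _*_ -_ a b c d renaming (mul to _⊗_)

    π₁ π₂ π₃ : {X : Set} → X × X × X → X
    π₁ (x , _ , _) = x
    π₂ (_ , y , _) = y
    π₃ (_ , _ , z) = z

    module Laws (u v w : C) where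
      ρ : Env 13
      ρ = π₁ u ∷ π₂ u ∷ π₃ u ∷ π₁ v ∷ π₂ v ∷ π₃ v ∷ π₁ w ∷ π₂ w ∷ π₃ w ∷ a ∷ b ∷ c ∷ d ∷ []

      U V W V+W : Polynomial 13 × Polynomial 13 × Polynomial 13
      U = var (# 0) , var (# 1) , var (# 2)
      V = var (# 3) , var (# 4) , var (# 5)
      W = var (# 6) , var (# 7) , var (# 8)
      V+W = π₁ V :+ π₁ W , π₂ V :+ π₂ W , π₃ V :+ π₃ W

      open CubicFormula {Polynomial 13} _:+_ _:*_ :-_ (var (# 9)) (var (# 10)) (var (# 11)) (var (# 12))

      assoc : (u ⊗ v) ⊗ w ≡ u ⊗ (v ⊗ w)
      assoc = let L = mul (mul U V) W ; R = mul U (mul V W) in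
        ≡³ (prove ρ (π₁ L) (π₁ R) refl) (prove ρ (π₂ L) (π₂ R) refl) (prove ρ (π₃ L) (π₃ R) refl)

      comm : u ⊗ v ≡ v ⊗ u
      comm = let L = mul U V ; R = mul V U in
        ≡³ (prove ρ (π₁ L) (π₁ R) refl) (prove ρ (π₂ L) (π₂ R) refl) (prove ρ (π₃ L) (π₃ R) refl)

      distribˡ : u ⊗ (v ⊕ w) ≡ (u ⊗ v) ⊕ (u ⊗ w)
      distribˡ = let L = mul U V+W ; R = mul U V ; R' = mul U W in
        ≡³ (prove ρ (π₁ L) (π₁ R :+ π₁ R') refl) (prove ρ (π₂ L) (π₂ R :+ π₂ R') refl) (prove ρ (π₃ L) (π₃ R :+ π₃ R') refl)

    ⊗-scale : ∀ r x y z → (r , 0# , 0#) ⊗ (x , y , z) ≡ (r * x , r * y , r * z)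
    ⊗-scale r x y z = ≡³
      (solve 8 (λ r x y z a b c d → let open CubicFormula _:+_ _:*_ :-_ a b c d in
        π₁ (mul (r , con 0ℚ , con 0ℚ) (x , y , z)) := r :* x) refl r x y z a b c d)
      (solve 8 (λ r x y z a b c d → let open CubicFormula _:+_ _:*_ :-_ a b c d in
        π₂ (mul (r , con 0ℚ , con 0ℚ) (x , y , z)) := r :* y) refl r x y z a b c d)
      (solve 8 (λ r x y z a b c d → let open CubicFormula _:+_ _:*_ :-_ a b c d in
        π₃ (mul (r , con 0ℚ , con 0ℚ) (x , y , z)) := r :* z) refl r x y z a b c d)

    +-assoc' = solve 3 (λ x y z → (x :+ y) :+ z := x :+ (y :+ z)) refl
    +-comm' = solve 2 (λ x y → x :+ y := y :+ x) refl
    +-idˡ = solve 1 (λ x → con 0ℚ :+ x := x) refl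
    +-invˡ = solve 1 (λ x → :- x :+ x := con 0ℚ) refl
    *-idˡ = solve 1 (λ x → con 1ℚ :* x := x) refl

  algebra : ℚAlgebra
  algebra = record
    { Carrier = C
    ; _+_ = _⊕_
    ; _*_ = _⊗_
    ; -_ = λ (x , y , z) → - x , - y , - z
    ; ι = λ q → ι q , 0# , 0#
    ; isCommutativeRing = mkIsCommutativeRing
        (λ (x , y , z) (x' , y' , z') (x'' , y'' , z'') → ≡³ (+-assoc' x x' x'') (+-assoc' y y' y'') (+-assoc' z z' z''))
        (λ (x , y , z) (x' , y' , z') → ≡³ (+-comm' x x') (+-comm' y y') (+-comm' z z'))
        (λ (x , y , z) → ≡³ (+-idˡ x) (+-idˡ y) (+-idˡ z))
        (λ (x , y , z) → ≡³ (+-invˡ x) (+-invˡ y) (+-invˡ z))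
        Laws.assoc (λ u v → Laws.comm u v u)
        (λ (x , y , z) → trans (⊗-scale (ι 1ℚ) x y z) (≡³ (*-idˡ x) (*-idˡ y) (*-idˡ z)))
        Laws.distribˡ
    ; ι-+ = λ p q → ≡³ (ι-+ p q) (sym (+-idˡ 0#)) (sym (+-idˡ 0#))
    ; ι-* = λ p q → trans (≡³ (ι-* p q) (*-0 (ι p)) (*-0 (ι p))) (sym (⊗-scale (ι p) (ι q) 0# 0#))
    ; ι-neg = λ p → ≡³ (ι-neg p) neg-0 neg-0
    }
    where
    *-0 = solve 1 (λ x → con 0ℚ := x :* con 0ℚ) refl
    neg-0 = solve 0 (con 0ℚ := :- con 0ℚ) refl

  incl : Carrier → ℚAlgebra.Carrier algebra
  incl x = x , 0# , 0#

  incl-+ : ∀ x y → incl (x + y) ≡ ℚAlgebra._+_ algebra (incl x) (incl y)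
  incl-+ x y = ≡³ refl (sym (+-idˡ 0#)) (sym (+-idˡ 0#))

  incl-* : ∀ x y → incl (x * y) ≡ ℚAlgebra._*_ algebra (incl x) (incl y)
  incl-* x y = trans (≡³ refl x*0 x*0) (sym (⊗-scale x y 0# 0#))
    where x*0 = solve 1 (λ x → con 0ℚ := x :* con 0ℚ) refl x

  incl-neg : ∀ x → incl (- x) ≡ ℚAlgebra.-_ algebra (incl x)
  incl-neg x = ≡³ refl neg-0 neg-0
    where neg-0 = solve 0 (con 0ℚ := :- con 0ℚ) refl

  incl-*ˡ : ∀ r x y z → ℚAlgebra._*_ algebra (incl r) (x , y , z) ≡ (r * x , r * y , r * z)
  incl-*ˡ = ⊗-scale

  gen₁ gen₂ : ℚAlgebra.Carrier algebra
  gen₁ = 0# , ι 1ℚ , 0#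
  gen₂ = 0# , 0# , ι 1ℚ

  decompose : let open ℚAlgebra algebra using () renaming (_*_ to _⊛_; _+_ to _⊞_) in
              ∀ x y z → incl x ⊞ incl y ⊛ gen₁ ⊞ incl z ⊛ gen₂ ≡ (x , y , z)
  decompose x y z = trans
    (cong₂ (λ u v → (incl x ⊕ u) ⊕ v) (⊗-scale y 0# (ι 1ℚ) 0#) (⊗-scale z 0# 0# (ι 1ℚ)))
    (≡³ (solve 3 (λ x y z → x :+ y :* con 0ℚ :+ z :* con 0ℚ := x) refl x y z)
        (solve 2 (λ y z → con 0ℚ :+ y :* con 1ℚ :+ z :* con 0ℚ := y) refl y z)
        (solve 2 (λ y z → con 0ℚ :+ y :* con 0ℚ :+ z :* con 1ℚ := z) refl y z))

  private
    module Gens where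
      ρ : Env 4
      ρ = a ∷ b ∷ c ∷ d ∷ []

      :a :b :c :d :0 : Polynomial 4
      :a = var (# 0)
      :b = var (# 1)
      :c = var (# 2)
      :d = var (# 3)
      :0 = con 0ℚ

      G₁ G₂ : Polynomial 4 × Polynomial 4 × Polynomial 4
      G₁ = :0 , con 1ℚ , :0
      G₂ = :0 , :0 , con 1ℚ

      open CubicFormula {Polynomial 4} _:+_ _:*_ :-_ :a :b :c :d public
    open Gens

  gen₁² : let open ℚAlgebra algebra using () renaming (_*_ to _⊛_) in
          gen₁ ⊛ gen₁ ≡ (- (a * c) , b , - a)
  gen₁² = let p = mul G₁ G₁ in
    ≡³ (prove ρ (π₁ p) (:- (:a :* :c)) refl) (prove ρ (π₂ p) :b refl) (prove ρ (π₃ p) (:- :a) refl)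

  gen₁gen₂ : let open ℚAlgebra algebra using () renaming (_*_ to _⊛_) in
          gen₁ ⊛ gen₂ ≡ incl (- (a * d))
  gen₁gen₂ = let p = mul G₁ G₂ in
    ≡³ (prove ρ (π₁ p) (:- (:a :* :d)) refl) (prove ρ (π₂ p) :0 refl) (prove ρ (π₃ p) :0 refl)

  gen₂² : let open ℚAlgebra algebra using () renaming (_*_ to _⊛_) in
          gen₂ ⊛ gen₂ ≡ (- (b * d) , d , - c)
  gen₂² = let p = mul G₂ G₂ in
    ≡³ (prove ρ (π₁ p) (:- (:b :* :d)) refl) (prove ρ (π₂ p) :d refl) (prove ρ (π₃ p) (:- :c) refl)

-- The integers inside a ℚ-algebra

private
  toℚᵘ-ℤ→ℚ : ∀ a → ℚ.toℚᵘ (ℤ→ℚ a) ℚᵘ.≃ mkℚᵘ a 0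
  toℚᵘ-ℤ→ℚ a = ℚP.toℚᵘ-fromℚᵘ (mkℚᵘ a 0)

ℤ→ℚ-injective : ∀ {a b} → ℤ→ℚ a ≡ ℤ→ℚ b → a ≡ b
ℤ→ℚ-injective {a} {b} eq with ℚP./-injective-≃ (mkℚᵘ a 0) (mkℚᵘ b 0) eq
... | *≡* a1≡b1 = ℤP.*-cancelʳ-≡ a b (+ 1) a1≡b1

ℤ→ℚ-+ : ∀ a b → ℤ→ℚ (a ℤ.+ b) ≡ ℤ→ℚ a ℚ.+ ℤ→ℚ b
ℤ→ℚ-+ a b = ℚP.toℚᵘ-injective (begin
  ℚ.toℚᵘ (ℤ→ℚ (a ℤ.+ b)) ≈⟨ toℚᵘ-ℤ→ℚ (a ℤ.+ b) ⟩
  mkℚᵘ (a ℤ.+ b) 0 ≡⟨ cong₂ (λ u v → mkℚᵘ (u ℤ.+ v) 0) (ℤP.*-identityʳ a) (ℤP.*-identityʳ b) ⟨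
  mkℚᵘ a 0 ℚᵘ.+ mkℚᵘ b 0 ≈⟨ ℚᵘP.+-cong (toℚᵘ-ℤ→ℚ a) (toℚᵘ-ℤ→ℚ b) ⟨
  ℚ.toℚᵘ (ℤ→ℚ a) ℚᵘ.+ ℚ.toℚᵘ (ℤ→ℚ b) ≈⟨ ℚP.toℚᵘ-homo-+ (ℤ→ℚ a) (ℤ→ℚ b) ⟨
  ℚ.toℚᵘ (ℤ→ℚ a ℚ.+ ℤ→ℚ b) ∎)
  where open ℚᵘP.≃-Reasoning

ℤ→ℚ-* : ∀ a b → ℤ→ℚ (a ℤ.* b) ≡ ℤ→ℚ a ℚ.* ℤ→ℚ b
ℤ→ℚ-* a b = ℚP.toℚᵘ-injective (begin
  ℚ.toℚᵘ (ℤ→ℚ (a ℤ.* b)) ≈⟨ toℚᵘ-ℤ→ℚ (a ℤ.* b) ⟩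
  mkℚᵘ a 0 ℚᵘ.* mkℚᵘ b 0 ≈⟨ ℚᵘP.*-cong (toℚᵘ-ℤ→ℚ a) (toℚᵘ-ℤ→ℚ b) ⟨
  ℚ.toℚᵘ (ℤ→ℚ a) ℚᵘ.* ℚ.toℚᵘ (ℤ→ℚ b) ≈⟨ ℚP.toℚᵘ-homo-* (ℤ→ℚ a) (ℤ→ℚ b) ⟨
  ℚ.toℚᵘ (ℤ→ℚ a ℚ.* ℤ→ℚ b) ∎)
  where open ℚᵘP.≃-Reasoning

ℤ→ℚ-neg : ∀ a → ℤ→ℚ (ℤ.- a) ≡ ℚ.- ℤ→ℚ a
ℤ→ℚ-neg a = ℚP.toℚᵘ-injective (begin
  ℚ.toℚᵘ (ℤ→ℚ (ℤ.- a)) ≈⟨ toℚᵘ-ℤ→ℚ (ℤ.- a) ⟩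
  ℚᵘ.- mkℚᵘ a 0 ≈⟨ ℚᵘP.-‿cong (toℚᵘ-ℤ→ℚ a) ⟨
  ℚᵘ.- ℚ.toℚᵘ (ℤ→ℚ a) ≈⟨ ℚP.toℚᵘ-homo‿- (ℤ→ℚ a) ⟨
  ℚ.toℚᵘ (ℚ.- ℤ→ℚ a) ∎)
  where open ℚᵘP.≃-Reasoning

rationals : ℚAlgebra
rationals = record
  { Carrier = ℚ ; _+_ = ℚ._+_ ; _*_ = ℚ._*_ ; -_ = ℚ.-_ ; ι = id
  ; isCommutativeRing = +-*-isCommutativeRing
  ; ι-+ = λ _ _ → refl ; ι-* = λ _ _ → refl ; ι-neg = λ _ → refl }

ι-1+n*k : ∀ (R : ℚAlgebra) (let open ℚAlgebra R) n k →
  ι (ℤ→ℚ (+ 1 ℤ.+ + n ℤ.* k)) ≡ ι 1ℚ + ι (ℤ→ℚ (+ n)) * ι (ℤ→ℚ k)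
ι-1+n*k R n k = trans (cong ι (trans (ℤ→ℚ-+ (+ 1) (+ n ℤ.* k)) (cong (1ℚ ℚ.+_) (ℤ→ℚ-* (+ n) k))))
                  (trans (ι-+ _ _) (cong (λ z → ι 1ℚ + z) (ι-* _ _)))
  where open ℚAlgebra R

-- Subrings, ideals and the Frobenius

module Subsets (R : ℚAlgebra) where
  open ℚAlgebra R
  open Solver

  record Subring (P : Carrier → Set) : Set where
    field
      +-closed : ∀ {x y} → P x → P y → P (x + y)
      *-closed : ∀ {x y} → P x → P y → P (x * y)
      int      : ∀ n → P (ι (ℤ→ℚ n))

    neg-closed : ∀ {x} → P x → P (- x)
    neg-closed {x} Px = subst P (solve 1 (λ x → con (ℤ→ℚ -[1+ 0 ]) :* x := :- x) refl x)
                          (*-closed (int -[1+ 0 ]) Px)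

    minus-closed : ∀ {x y} → P x → P y → P (x - y)
    minus-closed Px Py = +-closed Px (neg-closed Py)

    ^-closed : ∀ {x} → P x → ∀ n → P (x ^ n)
    ^-closed Px zero    = int (+ 1)
    ^-closed Px (suc n) = *-closed Px (^-closed Px n)

  record Ideal (P I : Carrier → Set) : Set where
    field
      subring  : Subring P
      +-ideal  : ∀ {x y} → I x → I y → I (x + y)
      *-ideal  : ∀ {x y} → P x → I y → I (x * y)

    open Subring subring public

    neg-ideal : ∀ {x} → I x → I (- x)
    neg-ideal {x} Ix = subst I (solve 1 (λ x → con (ℤ→ℚ -[1+ 0 ]) :* x := :- x) refl x)
                         (*-ideal (int -[1+ 0 ]) Ix)

    minus-ideal : ∀ {x y} → I x → I y → I (x - y)
    minus-ideal Ix Iy = +-ideal Ix (neg-ideal Iy)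

    *-idealʳ : ∀ {x y} → I x → P y → I (x * y)
    *-idealʳ {x} {y} Ix Py = subst I (solve 2 (λ x y → y :* x := x :* y) refl x y) (*-ideal Py Ix)

    ≈-sym : ∀ {x y} → I (x - y) → I (y - x)
    ≈-sym {x} {y} p = subst I (solve 2 (λ x y → :- (x :- y) := y :- x) refl x y) (neg-ideal p)

    ≈-trans : ∀ {x y z} → I (x - y) → I (y - z) → I (x - z)
    ≈-trans {x} {y} {z} p q = subst I (solve 3 (λ x y z → (x :- y) :+ (y :- z) := x :- z) refl x y z) (+-ideal p q)

    ≈-+ : ∀ {x x' y y'} → I (x - x') → I (y - y') → I ((x + y) - (x' + y'))
    ≈-+ {x} {x'} {y} {y'} p q = subst I
      (solve 4 (λ x x' y y' → (x :- x') :+ (y :- y') := (x :+ y) :- (x' :+ y')) refl x x' y y') (+-ideal p q)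

    ≈-* : ∀ {x x' y y'} → P x → P y' → I (x - x') → I (y - y') → I ((x * y) - (x' * y'))
    ≈-* {x} {x'} {y} {y'} Px Py' p q = subst I
      (solve 4 (λ x x' y y' → x :* (y :- y') :+ (x :- x') :* y' := (x :* y) :- (x' :* y')) refl x x' y y')
      (+-ideal (*-ideal Px q) (*-idealʳ p Py'))

    ≈-^ : ∀ {x y} → P x → P y → I (x - y) → ∀ n → I (x ^ suc n - y ^ suc n)
    ≈-^ {x} {y} Px Py p zero = subst I (solve 2 (λ x y → x :- y := x :^ 1 :- y :^ 1) refl x y) p
    ≈-^ Px Py p (suc n) = ≈-* Px (^-closed Py (suc n)) p (≈-^ Px Py p n)

-- For each of the two primes, the identities between powers with exponents such as `p` and `p * p`
-- are concrete, so the solver can check them.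
data SmallPrime : ℕ → Set where
  two   : SmallPrime 2
  three : SmallPrime 3

⅓ : ℚ
⅓ = + 1 ℚ./ 3

recip : ∀ {p} → SmallPrime p → ℚ
recip two   = ½
recip three = ⅓

module _ (R : ℚAlgebra) where
  open ℚAlgebra R
  open Solver
  open Subsets R

  binomial-theorem : ∀ {p P} → SmallPrime p → Subring P → ∀ {x y} → P x → P y →
    ∃ λ b → P b × (x + y) ^ p - (x ^ p + y ^ p) ≡ ι (ℤ→ℚ (+ p)) * b
  binomial-theorem two S {x} {y} Px Py = x * y , Subring.*-closed S Px Py ,
    solve 2 (λ x y → (x :+ y) :^ 2 :- (x :^ 2 :+ y :^ 2) := :ℕ 2 :* (x :* y)) refl x y
  binomial-theorem three S {x} {y} Px Py = x * y * (x + y) ,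
    Subring.*-closed S (Subring.*-closed S Px Py) (Subring.+-closed S Px Py) ,
    solve 2 (λ x y → (x :+ y) :^ 3 :- (x :^ 3 :+ y :^ 3) := :ℕ 3 :* (x :* y :* (x :+ y))) refl x y

  module Frobenius {p} (sp : SmallPrime p) {P I} (ideal : Ideal P I)
                   (p-ideal : ∀ {x} → P x → I (ι (ℤ→ℚ (+ p)) * x)) where
    open Ideal ideal

    -- A ring endomorphism of `P` modulo `I`. Multiplicativity is an exact equation because the maps
    -- concerned are power maps.
    record IsEndo (g : Carrier → Carrier) : Set where
      field
        g-closed : ∀ {x} → P x → P (g x)
        g-cong   : ∀ {x y} → P x → P y → I (x - y) → I (g x - g y)
        g-+      : ∀ {x y} → P x → P y → I (g (x + y) - (g x + g y))
        g-*      : ∀ {x y} → g (x * y) ≡ g x * g y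

    open IsEndo

    private
      ≈-^-prime : ∀ {q} → SmallPrime q → ∀ {x y} → P x → P y → I (x - y) → I (x ^ q - y ^ q)
      ≈-^-prime two   Px Py x≈y = ≈-^ Px Py x≈y 1
      ≈-^-prime three Px Py x≈y = ≈-^ Px Py x≈y 2

    frobenius : IsEndo (_^ p)
    frobenius .g-closed Px = ^-closed Px p
    frobenius .g-cong Px Py x≈y = ≈-^-prime sp Px Py x≈y
    frobenius .g-+ Px Py with binomial-theorem sp subring Px Py
    ... | b , Pb , eq = subst I (sym eq) (p-ideal Pb)
    frobenius .g-* = ^-distrib-* _ _ p

    endo-∘ : ∀ {g h} → IsEndo g → IsEndo h → IsEndo (g ∘ h)
    endo-∘ G H .g-closed = g-closed G ∘ g-closed H
    endo-∘ G H .g-cong Px Py x≈y = g-cong G (g-closed H Px) (g-closed H Py) (g-cong H Px Py x≈y)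
    endo-∘ G H .g-+ Px Py = ≈-trans
      (g-cong G (g-closed H (+-closed Px Py)) (+-closed (g-closed H Px) (g-closed H Py)) (g-+ H Px Py))
      (g-+ G (g-closed H Px) (g-closed H Py))
    endo-∘ {g} G H .g-* = trans (cong g (g-* H)) (g-* G)

    frobenius² : IsEndo (λ x → (x ^ p) ^ p)
    frobenius² = endo-∘ frobenius frobenius

    -- Fixed points of an endomorphism are closed under sums and products, so a congruence like
    -- `x^(p²) ≡ x` on a whole order follows from its generators.
    record Fixed (g : Carrier → Carrier) (x : Carrier) : Set where
      constructor fix
      field
        member : P x
        fixed  : I (g x - x)

    fixed-+ : ∀ {g} → IsEndo g → ∀ {x y} → Fixed g x → Fixed g y → Fixed g (x + y)
    fixed-+ G (fix Px x≈) (fix Py y≈) = fix (+-closed Px Py) (≈-trans (g-+ G Px Py) (≈-+ x≈ y≈))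

    fixed-* : ∀ {g} → IsEndo g → ∀ {x y} → Fixed g x → Fixed g y → Fixed g (x * y)
    fixed-* G {x} {y} (fix Px x≈) (fix Py y≈) = fix (*-closed Px Py)
      (subst (λ z → I (z - x * y)) (sym (g-* G)) (≈-* (g-closed G Px) Py x≈ y≈))

-- Integral elements lie in the unit ball

module Evaluation (R : ℚAlgebra) where
  open ℚAlgebra R
  open Solver

  horner : {A : Set} → (A → Carrier) → List A → Carrier → Carrier
  horner f []       x = ι 0ℚ
  horner f (c ∷ cs) x = f c + x * horner f cs x

  horner-init-last : ∀ {A : Set} (f : A → Carrier) x {n} (v : Vec A (suc n)) →
    horner f (toList v) x ≡ horner f (toList (init v)) x + x ^ n * f (last v)
  horner-init-last f x (c ∷ [])     = solve 2 (λ c x → c :+ x :* con 0ℚ := con 0ℚ :+ con 1ℚ :* c) refl (f c) x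
  horner-init-last f x {suc n} (c ∷ v@(_ ∷ _)) rewrite horner-init-last f x v =
    solve 5 (λ c x h b l → c :+ x :* (h :+ b :* l) := c :+ x :* h :+ x :* b :* l) refl
      (f c) x (horner f (toList (init v)) x) (x ^ n) (f (last v))

  eval : List ℤ → Carrier → Carrier
  eval = horner (λ c → ι (ℤ→ℚ c))

  eval-monic : ∀ cs x → eval (cs ++ [ + 1 ]) x ≡ eval cs x + x ^ length cs
  eval-monic []       x = solve 1 (λ x → con 1ℚ :+ x :* con 0ℚ := con 0ℚ :+ con 1ℚ) refl x
  eval-monic (c ∷ cs) x rewrite eval-monic cs x =
    solve 4 (λ c x e y → c :+ x :* (e :+ y) := c :+ x :* e :+ x :* y) refl (ι (ℤ→ℚ c)) x (eval cs x) (x ^ length cs)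

  Integral : Carrier → Set
  Integral x = ∃ λ cs → eval (cs ++ [ + 1 ]) x ≡ ι 0ℚ

module Integrality (R : ℚAlgebra) {p : ℕ} (sp : SmallPrime p) where
  open ℚAlgebra R
  open Solver
  open Evaluation R
  open Subsets R

  π π⁻¹ : Carrier
  π   = ι (ℤ→ℚ (+ p))
  π⁻¹ = ι (recip sp)

  ππ⁻¹ : π * π⁻¹ ≡ ι 1ℚ
  ππ⁻¹ = trans (sym (ι-* _ _)) (cong ι (lemma sp))
    where
    lemma : ∀ {p} (sp : SmallPrime p) → ℤ→ℚ (+ p) ℚ.* recip sp ≡ 1ℚ
    lemma two   = refl
    lemma three = refl

  cancel : ∀ x → π⁻¹ * (π * x) ≡ x
  cancel x = begin
    π⁻¹ * (π * x) ≡⟨ solve 3 (λ p q x → q :* (p :* x) := p :* q :* x) refl π π⁻¹ x ⟩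
    π * π⁻¹ * x ≡⟨ cong (_* x) ππ⁻¹ ⟩
    ι 1ℚ * x ≡⟨ solve 1 (λ x → con 1ℚ :* x := x) refl x ⟩
    x ∎
    where open ≡-Reasoning

  -- The axioms make Λ the unit ball, and J the open unit ball, of a power-multiplicative norm whose
  -- values are half-integral powers of p; hence Λ contains all integral elements.
  record IsUnitBall (Λ J : Carrier → Set) : Set where
    field
      ideal        : Ideal Λ J
      π-ideal      : ∀ {x} → Λ x → J (π * x)
      reduced      : ∀ {x} → Λ x → J ((x ^ p) ^ p - x)
      square       : ∀ {x} → J x → Λ (π⁻¹ * (x * x))
      ramified     : ∀ {x} → J x → J (π⁻¹ * (x * x)) → Λ (π⁻¹ * x)
      denominators : ∀ x → ∃ λ k → Λ (π ^ k * x)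

    open Ideal ideal

    -- `reduced` makes `Λ/J` a reduced ring: multiplying `x^(n+2)` by `x^(p²-2)` gives `x^(n+p²)`,
    -- which is congruent to `x^(n+1)`, so the exponent can be lowered.
    root : ∀ {x} → Λ x → ∀ n → J (x ^ suc n) → J x
    root {x} Λx zero    Jx = subst J (solve 1 (λ x → x :^ 1 := x) refl x) Jx
    root {x} Λx (suc n) Jx = root Λx n (subst J (eq sp) (minus-ideal
        (*-idealʳ Jx (^-closed Λx (p ℕ.* p ℕ.∸ 2))) (*-ideal (^-closed Λx n) (reduced Λx))))
      where
      eq : ∀ {p} → SmallPrime p → x ^ suc (suc n) * x ^ (p ℕ.* p ℕ.∸ 2) - x ^ n * ((x ^ p) ^ p - x) ≡ x ^ suc n
      eq two   = solve 2 (λ x y → x :* (x :* y) :* x :^ 2 :- y :* ((x :^ 2) :^ 2 :- x) := x :* y) refl x (x ^ n)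
      eq three = solve 2 (λ x y → x :* (x :* y) :* x :^ 7 :- y :* ((x :^ 3) :^ 3 :- x) := x :* y) refl x (x ^ n)

    private
      Bounded : ℕ → Carrier → Set
      Bounded e x = Λ (π ^ e * x)

      Λπ^ : ∀ k → Λ (π ^ k)
      Λπ^ k = ^-closed (int (+ p)) k

      bounded-mono : ∀ {e x} k → Bounded e x → Bounded (k ℕ.+ e) x
      bounded-mono {e} {x} k b = subst Λ
        (trans (solve 3 (λ a b x → a :* (b :* x) := a :* b :* x) refl (π ^ k) (π ^ e) x) (cong (_* x) (sym (^-homo-* π k e))))
        (*-closed (Λπ^ k) b)

      -- A common bound `p^e` for the denominators of all powers of θ forces the (e+1)-st powers of
      -- `y` and of `z = y² / p` into `J`. By `root` both `y` and `z` are in `J`, and this is what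
      -- `ramified` needs to divide `y` by `p`.
      descend : ∀ {θ e} → (∀ j → Bounded e (θ ^ j)) → ∀ k → Bounded (suc k) θ → Bounded k θ
      descend {θ} {e} bnd k Λy = subst Λ eq (ramified Jy Jz)
        where
        open ≡-Reasoning
        y = π ^ suc k * θ
        z = π⁻¹ * (y * y)

        -- y^(e+1) and z^(e+1) are p times a power of p times pᵉθʲ for some j.
        power : ∀ a x → (∀ j → Bounded e (x ^ j)) → J ((π ^ suc a * x) ^ suc e)
        power a x b = subst J (begin
          π * ((π ^ a) ^ suc e * (π ^ e * x ^ suc e)) ≡⟨ solve 4 (λ p u v w → p :* (u :* (v :* w)) := u :* (p :* v :* w)) refl π ((π ^ a) ^ suc e) (π ^ e) (x ^ suc e) ⟩
          (π ^ a) ^ suc e * (π ^ suc e * x ^ suc e) ≡⟨ cong ((π ^ a) ^ suc e *_) (sym (^-distrib-* π x (suc e))) ⟩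
          (π ^ a) ^ suc e * (π * x) ^ suc e ≡⟨ sym (^-distrib-* (π ^ a) (π * x) (suc e)) ⟩
          (π ^ a * (π * x)) ^ suc e ≡⟨ cong (_^ suc e) (solve 3 (λ p u x → u :* (p :* x) := p :* u :* x) refl π (π ^ a) x) ⟩
          (π ^ suc a * x) ^ suc e ∎)
          (π-ideal (*-closed (^-closed (Λπ^ a) (suc e)) (b (suc e))))

        Jy : J y
        Jy = root Λy e (power k θ bnd)

        z≡ : z ≡ π ^ suc (k ℕ.+ k) * (θ * θ)
        z≡ = begin
          π⁻¹ * (y * y) ≡⟨ cong (π⁻¹ *_) (solve 3 (λ p u t → p :* u :* t :* (p :* u :* t) := p :* (p :* (u :* u) :* (t :* t))) refl π (π ^ k) θ) ⟩
          π⁻¹ * (π * (π * (π ^ k * π ^ k) * (θ * θ))) ≡⟨ cancel _ ⟩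
          π * (π ^ k * π ^ k) * (θ * θ) ≡⟨ cong (λ u → π * u * (θ * θ)) (sym (^-homo-* π k k)) ⟩
          π ^ suc (k ℕ.+ k) * (θ * θ) ∎

        Jz : J z
        Jz = root (square Jy) e (subst (λ z → J (z ^ suc e)) (sym z≡)
          (power (k ℕ.+ k) (θ * θ) (λ j → subst (Bounded e)
            (trans (^-homo-* θ j j) (sym (^-distrib-* θ θ j))) (bnd (j ℕ.+ j)))))

        eq : π⁻¹ * y ≡ π ^ k * θ
        eq = trans (cong (π⁻¹ *_) (solve 3 (λ p u t → p :* u :* t := p :* (u :* t)) refl π (π ^ k) θ)) (cancel _)

      descend-all : ∀ {θ e} → (∀ j → Bounded e (θ ^ j)) → ∀ k → Bounded k θ → Λ θ
      descend-all {θ} bnd zero    b = subst Λ (solve 1 (λ x → con 1ℚ :* x := x) refl θ) b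
      descend-all {e = e} bnd (suc k) b = descend-all {e = e} bnd k (descend {e = e} bnd k b)

      bound-below : ∀ θ N → ∃ λ e → ∀ j → j ℕ.< N → Bounded e (θ ^ j)
      bound-below θ zero    = 0 , λ _ ()
      bound-below θ (suc N) with bound-below θ N | denominators (θ ^ N)
      ... | e , b | k , b' = k ℕ.+ e , below
        where
        below : ∀ j → j ℕ.< suc N → Bounded (k ℕ.+ e) (θ ^ j)
        below j (s≤s j≤N) with ℕP.m≤n⇒m<n∨m≡n j≤N
        ... | inj₁ j<N  = bounded-mono {e} k (b j j<N)
        ... | inj₂ refl = subst (λ l → Bounded l (θ ^ N)) (ℕP.+-comm e k) (bounded-mono {k} e b')

      bound-eval : ∀ {θ e} cs j → (∀ i → i ℕ.< length cs → Bounded e (θ ^ (i ℕ.+ j))) →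
                   Bounded e (eval cs θ * θ ^ j)
      bound-eval {θ} {e} [] j b = subst Λ (solve 2 (λ u v → con 0ℚ := u :* (con 0ℚ :* v)) refl (π ^ e) (θ ^ j)) (int (+ 0))
      bound-eval {θ} {e} (c ∷ cs) j b = subst Λ
        (solve 5 (λ c t h u v → c :* (u :* v) :+ u :* (h :* (t :* v)) := u :* ((c :+ t :* h) :* v)) refl
          (ι (ℤ→ℚ c)) θ (eval cs θ) (π ^ e) (θ ^ j))
        (+-closed (*-closed (int c) (b 0 (s≤s z≤n)))
          (bound-eval {θ} {e} cs (suc j) (λ i i< → subst (λ l → Bounded e (θ ^ l)) (sym (ℕP.+-suc i j)) (b (suc i) (s≤s i<)))))

      -- Induction on the start `j` of a window of `length cs` consecutive powers. The monic
      -- equation writes the next power as an integral combination of the window, so the exponent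
      -- `e` never grows.
      bound-all : ∀ {θ e} cs → eval (cs ++ [ + 1 ]) θ ≡ ι 0ℚ →
        (∀ i → i ℕ.< length cs → Bounded e (θ ^ i)) → ∀ j i → i ℕ.< length cs → Bounded e (θ ^ (i ℕ.+ j))
      bound-all {θ} {e} cs root b zero i i< = subst (λ l → Bounded e (θ ^ l)) (sym (ℕP.+-identityʳ i)) (b i i<)
      bound-all {θ} {e} cs root b (suc j) i i< rewrite ℕP.+-suc i j with ℕP.m≤n⇒m<n∨m≡n i<
      ... | inj₁ si< = bound-all {θ} {e} cs root b j (suc i) si<
      ... | inj₂ si≡N = subst Λ (begin
          - (π ^ e * (eval cs θ * θ ^ j)) ≡⟨ solve 4 (λ u h v w → :- (u :* (h :* v)) := u :* (w :* v) :- u :* ((h :+ w) :* v)) refl (π ^ e) (eval cs θ) (θ ^ j) (θ ^ N) ⟩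
          π ^ e * (θ ^ N * θ ^ j) - π ^ e * ((eval cs θ + θ ^ N) * θ ^ j) ≡⟨ cong (λ z → π ^ e * (θ ^ N * θ ^ j) - π ^ e * (z * θ ^ j)) (trans (sym (eval-monic cs θ)) root) ⟩
          π ^ e * (θ ^ N * θ ^ j) - π ^ e * (ι 0ℚ * θ ^ j) ≡⟨ solve 3 (λ u v w → u :* (w :* v) :- u :* (con 0ℚ :* v) := u :* (w :* v)) refl (π ^ e) (θ ^ j) (θ ^ N) ⟩
          π ^ e * (θ ^ N * θ ^ j) ≡⟨ cong (π ^ e *_) (sym (^-homo-* θ N j)) ⟩
          π ^ e * θ ^ (N ℕ.+ j) ≡⟨ cong (λ l → π ^ e * θ ^ (l ℕ.+ j)) (sym si≡N) ⟩
          π ^ e * θ ^ suc (i ℕ.+ j) ∎)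
          (neg-closed (bound-eval {θ} {e} cs j (bound-all {θ} {e} cs root b j)))
        where
        open ≡-Reasoning
        N = length cs

    integral⇒Λ : ∀ {θ} → Integral θ → Λ θ
    integral⇒Λ {θ} (cs , root) with bound-below θ (length cs) | denominators θ
    ... | e , b | k , bk = descend-all {e = e} (λ j → everywhere cs root b j) k bk
      where
      everywhere : ∀ cs → eval (cs ++ [ + 1 ]) θ ≡ ι 0ℚ →
        (∀ i → i ℕ.< length cs → Bounded e (θ ^ i)) → ∀ j → Bounded e (θ ^ j)
      -- The constant polynomial 1 has a root only if 1 = 0, and then every element is 0.
      everywhere [] 1≡0 _ j = subst Λ (begin
        ι 0ℚ ≡⟨ solve 1 (λ x → con 0ℚ := con 0ℚ :* x) refl (π ^ e * θ ^ j) ⟩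
        ι 0ℚ * (π ^ e * θ ^ j) ≡⟨ cong (_* (π ^ e * θ ^ j)) (sym 1≡0) ⟩
        (ι 1ℚ + θ * ι 0ℚ) * (π ^ e * θ ^ j) ≡⟨ solve 2 (λ t x → (con 1ℚ :+ t :* con 0ℚ) :* x := x) refl θ (π ^ e * θ ^ j) ⟩
        π ^ e * θ ^ j ∎) (int (+ 0))
        where open ≡-Reasoning
      everywhere (c ∷ cs) root b j = bound-all {θ} {e} (c ∷ cs) root b j 0 (s≤s z≤n)

-- The ring ℤ[θ] and the number of its residue classes

module PolynomialValues (R : ℚAlgebra) (θ : ℚAlgebra.Carrier R) where
  open ℚAlgebra R
  open Solver
  open Evaluation R
  open Subsets R

  ℤ[θ] : Carrier → Set
  ℤ[θ] x = ∃ λ cs → eval cs θ ≡ x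

  private
    add : ∀ cs ds → ℤ[θ] (eval cs θ + eval ds θ)
    add []       ds       = ds , solve 1 (λ d → d := con 0ℚ :+ d) refl (eval ds θ)
    add cs@(_ ∷ _) []     = cs , solve 1 (λ c → c := c :+ con 0ℚ) refl (eval cs θ)
    add (c ∷ cs) (d ∷ ds) with add cs ds
    ... | es , eq = c ℤ.+ d ∷ es , trans
      (cong₂ (λ u v → u + θ * v) (trans (cong ι (ℤ→ℚ-+ c d)) (ι-+ _ _)) eq)
      (solve 5 (λ c d t u v → c :+ d :+ t :* (u :+ v) := c :+ t :* u :+ (d :+ t :* v)) refl
        (ι (ℤ→ℚ c)) (ι (ℤ→ℚ d)) θ (eval cs θ) (eval ds θ))

    scale : ∀ c ds → ℤ[θ] (ι (ℤ→ℚ c) * eval ds θ)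
    scale c []       = [] , solve 1 (λ c → con 0ℚ := c :* con 0ℚ) refl (ι (ℤ→ℚ c))
    scale c (d ∷ ds) with scale c ds
    ... | es , eq = c ℤ.* d ∷ es , trans
      (cong₂ (λ u v → u + θ * v) (trans (cong ι (ℤ→ℚ-* c d)) (ι-* _ _)) eq)
      (solve 4 (λ c d t v → c :* d :+ t :* (c :* v) := c :* (d :+ t :* v)) refl
        (ι (ℤ→ℚ c)) (ι (ℤ→ℚ d)) θ (eval ds θ))

    +-values : ∀ {x y} → ℤ[θ] x → ℤ[θ] y → ℤ[θ] (x + y)
    +-values (cs , refl) (ds , refl) = add cs ds

    mul : ∀ cs ds → ℤ[θ] (eval cs θ * eval ds θ)
    mul []       ds = [] , solve 1 (λ d → con 0ℚ := con 0ℚ :* d) refl (eval ds θ)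
    mul (c ∷ cs) ds with mul cs ds
    ... | es , eq = subst ℤ[θ]
      (trans (cong (λ v → ι (ℤ→ℚ c) * eval ds θ + (con0 + θ * v)) eq)
        (solve 4 (λ c d t v → c :* d :+ (con 0ℚ :+ t :* (v :* d)) := (c :+ t :* v) :* d) refl
          (ι (ℤ→ℚ c)) (eval ds θ) θ (eval cs θ)))
      (+-values (scale c ds) (+ 0 ∷ es , refl))
      where con0 = ι 0ℚ

  values-subring : Subring ℤ[θ]
  values-subring = record
    { +-closed = +-values
    ; *-closed = λ { (cs , refl) (ds , refl) → mul cs ds }
    ; int      = λ n → n ∷ [] , solve 2 (λ n t → n :+ t :* con 0ℚ := n) refl (ι (ℤ→ℚ n)) θ
    }

funToFin-cong : ∀ {m n} {f g : Fin m → Fin n} → (∀ i → f i ≡ g i) → funToFin f ≡ funToFin g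
funToFin-cong {zero}  eq = refl
funToFin-cong {suc m} eq = cong₂ combine (eq zero) (funToFin-cong (eq ∘ suc))

module _ {p : ℕ} .{{_ : ℕ.NonZero p}} where

  residue : ℤ → Fin p
  residue a = fromℕ< (n%ℕd<d a p)

  residue-≡ : ∀ a b → residue a ≡ residue b → ∃ λ k → a ≡ b ℤ.+ (+ p) ℤ.* k
  residue-≡ a b eq = a /ℕ p ℤ.- b /ℕ p , (begin
    a ≡⟨ a≡a%ℕn+[a/ℕn]*n a p ⟩
    + (a %ℕ p) ℤ.+ a /ℕ p ℤ.* + p ≡⟨ cong (λ r → + r ℤ.+ a /ℕ p ℤ.* + p) (FinP.fromℕ<-injective _ _ (n%ℕd<d a p) (n%ℕd<d b p) eq) ⟩
    + (b %ℕ p) ℤ.+ a /ℕ p ℤ.* + p ≡⟨ solve 4 (λ r q q' p → r :+ q :* p := r :+ q' :* p :+ p :* (q :- q')) refl (+ (b %ℕ p)) (a /ℕ p) (b /ℕ p) (+ p) ⟩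
    + (b %ℕ p) ℤ.+ b /ℕ p ℤ.* + p ℤ.+ + p ℤ.* (a /ℕ p ℤ.- b /ℕ p) ≡⟨ cong (ℤ._+ + p ℤ.* (a /ℕ p ℤ.- b /ℕ p)) (sym (a≡a%ℕn+[a/ℕn]*n b p)) ⟩
    b ℤ.+ + p ℤ.* (a /ℕ p ℤ.- b /ℕ p) ∎)
    where
    open ≡-Reasoning
    open ℤSolver.+-*-Solver

module Pigeonhole (R : ℚAlgebra) {p : ℕ} (sp : SmallPrime p) where
  open ℚAlgebra R
  open Solver
  open Evaluation R
  open Subsets R
  open Integrality R sp using (π)

  instance
    p-nonZero : ∀ {p} {{sp : SmallPrime p}} → ℕ.NonZero p
    p-nonZero {{two}}   = _
    p-nonZero {{three}} = _

  private
    instance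
      _ = sp

    1<p : ∀ {p} → SmallPrime p → 1 ℕ.< p
    1<p two   = s≤s (s≤s z≤n)
    1<p three = s≤s (s≤s z≤n)

  -- If θ is a root of a monic polynomial of degree d modulo I, then ℤ[θ] has at most p^d classes
  -- modulo I.
  module _ {Λ I} (ideal : Ideal Λ I) (π-ideal : ∀ {x} → Λ x → I (π * x))
           {θ} (Λθ : Λ θ) {d} (rel : Vec ℤ (suc d))
           (relation : I (θ ^ suc d - eval (toList rel) θ)) where
    open Ideal ideal
    open PolynomialValues R θ

    private
      I0 : I (ι 0ℚ)
      I0 = subst I (solve 1 (λ x → x :* con 0ℚ := con 0ℚ) refl π) (π-ideal (int (+ 0)))

      I-refl : ∀ {x y} → x ≡ y → I (x - y)
      I-refl {x} refl = subst I (solve 1 (λ x → con 0ℚ := x :- x) refl x) I0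

      eval-closed : ∀ cs → Λ (eval cs θ)
      eval-closed []       = int (+ 0)
      eval-closed (c ∷ cs) = +-closed (int c) (*-closed Λθ (eval-closed cs))

      add-multiple : ∀ {n} l (u v : Vec ℤ n) →
        eval (toList u) θ + ι (ℤ→ℚ l) * eval (toList v) θ ≡ eval (toList (Vec.zipWith (λ a b → a ℤ.+ l ℤ.* b) u v)) θ
      add-multiple l []      []      = solve 1 (λ l → con 0ℚ :+ l :* con 0ℚ := con 0ℚ) refl (ι (ℤ→ℚ l))
      add-multiple l (a ∷ u) (b ∷ v) = trans
        (solve 6 (λ a b l t u v → a :+ t :* u :+ l :* (b :+ t :* v) := a :+ l :* b :+ t :* (u :+ l :* v)) refl
          (ι (ℤ→ℚ a)) (ι (ℤ→ℚ b)) (ι (ℤ→ℚ l)) θ (eval (toList u) θ) (eval (toList v) θ))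
        (cong₂ (λ x y → x + θ * y)
          (sym (trans (cong ι (trans (ℤ→ℚ-+ a (l ℤ.* b)) (cong (ℤ→ℚ a ℚ.+_) (ℤ→ℚ-* l b))))
                      (trans (ι-+ _ _) (cong (λ z → ι (ℤ→ℚ a) + z) (ι-* _ _)))))
          (add-multiple l u v))

      eval-zeros : ∀ n → eval (toList (replicate n (+ 0))) θ ≡ ι 0ℚ
      eval-zeros zero    = refl
      eval-zeros (suc n) rewrite eval-zeros n = solve 1 (λ t → con 0ℚ :+ t :* con 0ℚ := con 0ℚ) refl θ

      -- Division by the monic relation along Horner's scheme: multiplying a remainder by θ creates
      -- a single overflowing term `l θ^(d+1)`, which is replaced by `l` times `rel`.
      reduce : ∀ cs → ∃ λ (r : Vec ℤ (suc d)) → I (eval cs θ - eval (toList r) θ)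
      reduce []       = replicate (suc d) (+ 0) , I-refl (sym (eval-zeros (suc d)))
      reduce (c ∷ cs) with reduce cs
      ... | r , cs≈r = r' , ≈-trans
        (subst I (solve 4 (λ c t u v → t :* (u :- v) := (c :+ t :* u) :- (c :+ t :* v)) refl C θ (eval cs θ) (eval (toList r) θ))
          (*-ideal Λθ cs≈r))
        (subst I (begin
          L * (θ * θ ^ d - E) ≡⟨ solve 6 (λ c t u w l e → l :* (t :* w :- e) := (c :+ t :* (u :+ w :* l)) :- (c :+ t :* u :+ l :* e)) refl C θ N (θ ^ d) L E ⟩
          (C + θ * (N + θ ^ d * L)) - (C + θ * N + L * E) ≡⟨ cong₂ (λ u v → (C + θ * u) - v) (sym (horner-init-last (λ c → ι (ℤ→ℚ c)) θ r)) (add-multiple l (c ∷ init r) rel) ⟩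
          (C + θ * eval (toList r) θ) - eval (toList r') θ ∎)
          (*-ideal (int l) relation))
        where
        open ≡-Reasoning
        l = last r
        r' = Vec.zipWith (λ a b → a ℤ.+ l ℤ.* b) (c ∷ init r) rel
        L = ι (ℤ→ℚ l)
        C = ι (ℤ→ℚ c)
        E = eval (toList rel) θ
        N = eval (toList (init r)) θ

      residues≡⇒≈ : ∀ {n} (u v : Vec ℤ n) → (∀ i → residue {p} (Vec.lookup u i) ≡ residue (Vec.lookup v i)) →
                    I (eval (toList u) θ - eval (toList v) θ)
      residues≡⇒≈ []      []      _  = I-refl refl
      residues≡⇒≈ (a ∷ u) (b ∷ v) eq with residue-≡ a b (eq zero)
      ... | k , refl = subst I (trans
        (solve 6 (λ b q k t u v → q :* k :+ t :* (u :- v) := (b :+ q :* k :+ t :* u) :- (b :+ t :* v)) refl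
          (ι (ℤ→ℚ b)) π (ι (ℤ→ℚ k)) θ (eval (toList u) θ) (eval (toList v) θ))
        (cong (λ z → (z + θ * eval (toList u) θ) - eval (toList (b ∷ v)) θ)
          (sym (trans (cong ι (trans (ℤ→ℚ-+ b (+ p ℤ.* k)) (cong (ℤ→ℚ b ℚ.+_) (ℤ→ℚ-* (+ p) k))))
                      (trans (ι-+ _ _) (cong (λ z → ι (ℤ→ℚ b) + z) (ι-* _ _)))))))
        (+-ideal (π-ideal (int k)) (*-ideal Λθ (residues≡⇒≈ u v (eq ∘ suc))))

    -- The `p^n` elements `w ε` are sent to the residues modulo `p` of their remainders, of which
    -- there are only `p^(d+1)`. Choices ε and residue vectors are both coded as numbers, so that
    -- the finite pigeonhole principle applies.
    no-independent-values : ∀ {n} → suc d ℕ.< n → (w : (Fin n → Fin p) → Carrier) →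
      (∀ ε → ℤ[θ] (w ε)) → (∀ ε ε' → I (w ε - w ε') → ∀ i → ε i ≡ ε' i) → ⊥
    no-independent-values {n} d<n w w∈ℤ[θ] w-injective =
      let i , j , i<j , eq = FinP.pigeonhole (ℕP.^-monoʳ-< p (1<p sp) d<n) (funToFin ∘ digits)
          digits≡ = λ k → trans (sym (FinP.finToFun-funToFin (digits i) k))
                            (trans (cong (λ c → finToFun c k) eq) (FinP.finToFun-funToFin (digits j) k))
          close = ≈-trans (near i) (≈-trans (residues≡⇒≈ (coefficients i) (coefficients j) digits≡) (≈-sym (near j)))
      in FinP.<⇒≢ i<j (begin
        i                         ≡⟨ FinP.funToFin-finToFin {n} i ⟨
        funToFin {n} (finToFun i) ≡⟨ funToFin-cong (w-injective (finToFun i) (finToFun j) close) ⟩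
        funToFin {n} (finToFun j) ≡⟨ FinP.funToFin-finToFin {n} j ⟩
        j                         ∎)
      where
      open ≡-Reasoning
      coefficients : Fin (p ℕ.^ n) → Vec ℤ (suc d)
      coefficients i = proj₁ (reduce (proj₁ (w∈ℤ[θ] (finToFun i))))
      near : ∀ i → I (w (finToFun i) - eval (toList (coefficients i)) θ)
      near i = subst (λ z → I (z - eval (toList (coefficients i)) θ)) (proj₂ (w∈ℤ[θ] (finToFun i)))
                 (proj₂ (reduce (proj₁ (w∈ℤ[θ] (finToFun i)))))
      digits : Fin (p ℕ.^ n) → Fin (suc d) → Fin p
      digits i j = residue (Vec.lookup (coefficients i) j)

-- The map from K to an algebra with a twelfth root of m

module Realisation (R : ℚAlgebra) (m : ℤ) (α : ℚAlgebra.Carrier R)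
                   (α¹² : ℚAlgebra._^_ R α 12 ≡ ℚAlgebra.ι R (ℤ→ℚ m)) where
  open ℚAlgebra R
  open Solver
  open Evaluation R

  φ : K → Carrier
  φ v = horner ι (toList v) α

  private
    horner-zeros : ∀ n → horner ι (toList (replicate n 0ℚ)) α ≡ ι 0ℚ
    horner-zeros zero    = refl
    horner-zeros (suc n) rewrite horner-zeros n = solve 1 (λ a → con 0ℚ :+ a :* con 0ℚ := con 0ℚ) refl α

    φ-add : ∀ {n} (u v : Vec ℚ n) →
      horner ι (toList (Vec.zipWith ℚ._+_ u v)) α ≡ horner ι (toList u) α + horner ι (toList v) α
    φ-add []      []      = solve 0 (con 0ℚ := con 0ℚ :+ con 0ℚ) refl
    φ-add (x ∷ u) (y ∷ v) rewrite φ-add u v | ι-+ x y =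
      solve 5 (λ x y a u v → x :+ y :+ a :* (u :+ v) := x :+ a :* u :+ (y :+ a :* v)) refl
        (ι x) (ι y) α (horner ι (toList u) α) (horner ι (toList v) α)

    φ-scale : ∀ {n} c (v : Vec ℚ n) → horner ι (toList (Vec.map (c ℚ.*_) v)) α ≡ ι c * horner ι (toList v) α
    φ-scale c []      = solve 1 (λ c → con 0ℚ := c :* con 0ℚ) refl (ι c)
    φ-scale c (x ∷ v) rewrite φ-scale c v | ι-* c x =
      solve 4 (λ c x a v → c :* x :+ a :* (c :* v) := c :* (x :+ a :* v)) refl (ι c) (ι x) α (horner ι (toList v) α)

    -- Multiplication by α raises every exponent by one, and the top term wraps around to the
    -- constant coordinate with factor `c`; this is the shape of `mulα`.
    horner-rotate : ∀ c {n} (v : Vec ℚ (suc n)) → α ^ suc n ≡ ι c →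
      horner ι (toList ((c ℚ.* last v) ∷ init v)) α ≡ α * horner ι (toList v) α
    horner-rotate c {n} v αⁿ = begin
      ι (c ℚ.* last v) + α * i ≡⟨ cong (_+ α * i) (ι-* c (last v)) ⟩
      ι c * l + α * i ≡⟨ cong (λ y → y * l + α * i) (sym αⁿ) ⟩
      α * α ^ n * l + α * i ≡⟨ solve 4 (λ a b l i → a :* b :* l :+ a :* i := a :* (i :+ b :* l)) refl α (α ^ n) l i ⟩
      α * (i + α ^ n * l) ≡⟨ cong (α *_) (sym (horner-init-last ι α v)) ⟩
      α * horner ι (toList v) α ∎
      where
      open ≡-Reasoning
      i = horner ι (toList (init v)) α
      l = ι (last v)

    φ-hornerMul : ∀ cs b → φ (hornerMul m cs b) ≡ horner ι cs α * φ b
    φ-hornerMul []       b = trans (horner-zeros 12) (solve 1 (λ b → con 0ℚ := con 0ℚ :* b) refl (φ b))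
    φ-hornerMul (c ∷ cs) b = begin
      φ (addK (scaleK c b) (mulα m h)) ≡⟨ φ-add (scaleK c b) (mulα m h) ⟩
      φ (scaleK c b) + φ (mulα m h) ≡⟨ cong₂ _+_ (φ-scale c b) (horner-rotate (ℤ→ℚ m) h α¹²) ⟩
      ι c * φ b + α * φ h ≡⟨ cong (λ z → ι c * φ b + α * z) (φ-hornerMul cs b) ⟩
      ι c * φ b + α * (horner ι cs α * φ b) ≡⟨ solve 4 (λ c b a h → c :* b :+ a :* (h :* b) := (c :+ a :* h) :* b) refl (ι c) (φ b) α (horner ι cs α) ⟩
      (ι c + α * horner ι cs α) * φ b ∎
      where
      open ≡-Reasoning
      h = hornerMul m cs b

    φ-embed : ∀ c → φ (embed c) ≡ ι c
    φ-embed c = trans (cong (λ z → ι c + α * z) (horner-zeros 11))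
                      (solve 2 (λ c a → c :+ a :* con 0ℚ := c) refl (ι c) α)

  -- Horner's scheme on coordinate vectors is followed step by step in the algebra, where ring laws
  -- are at hand. Equations in `K` thus become equations in the tower.
  φ-evalℤ : ∀ cs θ → φ (evalℤ m cs θ) ≡ eval cs (φ θ)
  φ-evalℤ []       θ = horner-zeros 12
  φ-evalℤ (c ∷ cs) θ = begin
    φ (addK (embed (ℤ→ℚ c)) (mulK m θ (evalℤ m cs θ))) ≡⟨ φ-add (embed (ℤ→ℚ c)) (mulK m θ (evalℤ m cs θ)) ⟩
    φ (embed (ℤ→ℚ c)) + φ (mulK m θ (evalℤ m cs θ)) ≡⟨ cong₂ _+_ (φ-embed (ℤ→ℚ c)) (φ-hornerMul (toList θ) (evalℤ m cs θ)) ⟩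
    ι (ℤ→ℚ c) + φ θ * φ (evalℤ m cs θ) ≡⟨ cong (λ z → ι (ℤ→ℚ c) + φ θ * z) (φ-evalℤ cs θ) ⟩
    ι (ℤ→ℚ c) + φ θ * eval cs (φ θ) ∎
    where open ≡-Reasoning

  φ-integral : ∀ θ → InZK m θ → Integral (φ θ)
  φ-integral θ (cs , eq) = cs , trans (sym (φ-evalℤ (cs ++ [ + 1 ]) θ)) (trans (cong φ eq) (horner-zeros 12))

  φ-value : ∀ θ β {x} → φ β ≡ x → InZθ m θ β → PolynomialValues.ℤ[θ] R (φ θ) x
  φ-value θ β φβ≡x (P , eq) = P , trans (sym (φ-evalℤ P θ)) (trans (cong φ eq) φβ≡x)

-- Homomorphisms, and orders in quadratic and cubic extensions

record _⟶_ (R T : ℚAlgebra) : Set where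
  private
    module R = ℚAlgebra R
    module T = ℚAlgebra T
  field
    ⟦_⟧    : R.Carrier → T.Carrier
    +-homo : ∀ x y → ⟦ x R.+ y ⟧ ≡ ⟦ x ⟧ T.+ ⟦ y ⟧
    *-homo : ∀ x y → ⟦ x R.* y ⟧ ≡ ⟦ x ⟧ T.* ⟦ y ⟧
    neg-homo : ∀ x → ⟦ R.- x ⟧ ≡ T.- ⟦ x ⟧
    ι-homo : ∀ q → ⟦ R.ι q ⟧ ≡ T.ι q

  ^-homo : ∀ x n → ⟦ x R.^ n ⟧ ≡ ⟦ x ⟧ T.^ n
  ^-homo x zero    = ι-homo 1ℚ
  ^-homo x (suc n) = trans (*-homo x (x R.^ n)) (cong (⟦ x ⟧ T.*_) (^-homo x n))

-- A subring at the top of the tower, typically ℤ[θ], is restricted to a lower stage, so that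
-- elements built there from generators are seen to belong to it.
module Pullback {R T : ℚAlgebra} (f : R ⟶ T) {S : ℚAlgebra.Carrier T → Set} (S-subring : Subsets.Subring T S) where
  private
    module R = ℚAlgebra R
    module T = ℚAlgebra T
    open _⟶_ f
    open Subsets.Subring S-subring

  pullback-+ : ∀ {x y} → S ⟦ x ⟧ → S ⟦ y ⟧ → S ⟦ x R.+ y ⟧
  pullback-+ {x} {y} Sx Sy = subst S (sym (+-homo x y)) (+-closed Sx Sy)

  pullback-* : ∀ {x y} → S ⟦ x ⟧ → S ⟦ y ⟧ → S ⟦ x R.* y ⟧
  pullback-* {x} {y} Sx Sy = subst S (sym (*-homo x y)) (*-closed Sx Sy)

  pullback : Subsets.Subring R (S ∘ ⟦_⟧)
  pullback = record
    { +-closed = pullback-+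
    ; *-closed = pullback-*
    ; int      = λ n → subst S (sym (ι-homo (ℤ→ℚ n))) (int n)
    }

quadratic-incl : ∀ R a b → R ⟶ Quadratic.algebra R a b
quadratic-incl R a b = record
  { ⟦_⟧ = incl ; +-homo = incl-+ ; *-homo = incl-* ; neg-homo = incl-neg ; ι-homo = λ _ → refl }
  where open Quadratic R a b

cubic-incl : ∀ R a b c d → R ⟶ Cubic.algebra R a b c d
cubic-incl R a b c d = record
  { ⟦_⟧ = incl ; +-homo = incl-+ ; *-homo = incl-* ; neg-homo = incl-neg ; ι-homo = λ _ → refl }
  where open Cubic R a b c d

module QuadraticOrder (R : ℚAlgebra) (a b : ℚAlgebra.Carrier R) where
  open ℚAlgebra R
  open Subsets R
  private
    module Q = Quadratic R a b
    module A = ℚAlgebra Q.algebra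

  _² : (Carrier → Set) → A.Carrier → Set
  (P ²) (x , y) = P x × P y

  ²-subring : ∀ {P} → Subring P → P a → P b → Subsets.Subring Q.algebra (P ²)
  ²-subring S Pa Pb = record
    { +-closed = λ (x , y) (x' , y') → +-closed x x' , +-closed y y'
    ; *-closed = λ (x , y) (x' , y') →
        +-closed (*-closed x x') (*-closed Pb (*-closed y y'))
      , +-closed (+-closed (*-closed x y') (*-closed y x')) (*-closed Pa (*-closed y y'))
    ; int      = λ n → int n , int (+ 0)
    }
    where open Subring S

  ²-scale : ∀ {P} q {x y} → (P ²) (A.ι q A.* (x , y)) → P (ι q * x) × P (ι q * y)
  ²-scale {P} q {x} {y} = subst (P ²) (Q.incl-*ˡ (ι q) x y)

  -- Closure under sums and products is asked of `S` separately, so that `S` may be the set of fixed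
  -- points of a Frobenius as well as a subring.
  ²-generated : {P : Carrier → Set} {S : A.Carrier → Set} → (∀ {x y} → S x → S y → S (x A.+ y)) → (∀ {x y} → S x → S y → S (x A.* y)) →
                (∀ {x} → P x → S (Q.incl x)) → S Q.gen → ∀ {x} → (P ²) x → S x
  ²-generated {S = S} S-+ S-* S-incl S-gen {x , y} (Px , Py) =
    subst S (Q.decompose x y) (S-+ (S-incl Px) (S-* (S-incl Py) S-gen))

module CubicOrder (R : ℚAlgebra) (a b c d : ℚAlgebra.Carrier R) where
  open ℚAlgebra R
  open Subsets R
  private
    module C = Cubic R a b c d
    module A = ℚAlgebra C.algebra

  _³ : (Carrier → Set) → A.Carrier → Set
  (P ³) (x , y , z) = P x × P y × P z

  ³-subring : ∀ {P} → Subring P → P a → P b → P c → P d → Subsets.Subring C.algebra (P ³)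
  ³-subring S Pa Pb Pc Pd = record
    { +-closed = λ (x , y , z) (x' , y' , z') → +-closed x x' , +-closed y y' , +-closed z z'
    ; *-closed = λ (x , y , z) (x' , y' , z') →
        minus-closed (*-closed x x') (+-closed (*-closed (*-closed Pa Pc) (*-closed y y'))
          (+-closed (*-closed (*-closed Pa Pd) (+-closed (*-closed y z') (*-closed z y')))
                    (*-closed (*-closed Pb Pd) (*-closed z z'))))
      , +-closed (+-closed (*-closed x y') (*-closed y x')) (+-closed (*-closed Pb (*-closed y y')) (*-closed Pd (*-closed z z')))
      , minus-closed (+-closed (*-closed x z') (*-closed z x')) (+-closed (*-closed Pa (*-closed y y')) (*-closed Pc (*-closed z z')))
    ; int      = λ n → int n , int (+ 0) , int (+ 0)
    }
    where open Subring S

  ³-scale : ∀ {P} q {x y z} → (P ³) (A.ι q A.* (x , y , z)) → P (ι q * x) × P (ι q * y) × P (ι q * z)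
  ³-scale {P} q {x} {y} {z} = subst (P ³) (C.incl-*ˡ (ι q) x y z)

  ³-generated : {P : Carrier → Set} {S : A.Carrier → Set} → (∀ {x y} → S x → S y → S (x A.+ y)) → (∀ {x y} → S x → S y → S (x A.* y)) →
                (∀ {x} → P x → S (C.incl x)) → S C.gen₁ → S C.gen₂ → ∀ {x} → (P ³) x → S x
  ³-generated {S = S} S-+ S-* S-incl S-gen₁ S-gen₂ {x , y , z} (Px , Py , Pz) =
    subst S (C.decompose x y z) (S-+ (S-+ (S-incl Px) (S-* (S-incl Py) S-gen₁)) (S-* (S-incl Pz) S-gen₂))

-- Étale orders

module _ {p : ℕ} (sp : SmallPrime p) where

  module PrimeIdeal (R : ℚAlgebra) {P} (S : Subsets.Subring R P) where
    open ℚAlgebra R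
    open Solver
    open Subsets R
    open Integrality R sp
    open Subring S

    π∣ : Carrier → Set
    π∣ x = P (π⁻¹ * x)

    ideal : Ideal P π∣
    ideal = record
      { subring = S
      ; +-ideal = λ {x} {y} p q → subst P (solve 3 (λ r x y → r :* x :+ r :* y := r :* (x :+ y)) refl π⁻¹ x y) (+-closed p q)
      ; *-ideal = λ {x} {y} p q → subst P (solve 3 (λ r x y → x :* (r :* y) := r :* (x :* y)) refl π⁻¹ x y) (*-closed p q)
      }

    π-ideal : ∀ {x} → P x → π∣ (π * x)
    π-ideal {x} Px = subst P (sym (cancel x)) Px

    open Frobenius R sp ideal π-ideal public

    Étale : Carrier → Set
    Étale = Fixed (λ x → (x ^ p) ^ p)

  -- P is an order over ℤ₍ₚ₎ whose reduction modulo p is a product of fields contained in 𝔽_{p²}.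
  record ÉtaleOrder (R : ℚAlgebra) (P : ℚAlgebra.Carrier R → Set) : Set where
    open ℚAlgebra R
    open Integrality R sp using (π; π⁻¹)
    field
      subring      : Subsets.Subring R P
      denominators : ∀ x → ∃ λ k → P (π ^ k * x)
      étale        : ∀ {x} → P x → P (π⁻¹ * ((x ^ p) ^ p - x))

    open Subsets.Subring subring

    denominators-+ : ∀ {x} k l → P (π ^ k * x) → P (π ^ (l ℕ.+ k) * x)
    denominators-+ {x} k l Px = subst P
      (trans (solve 3 (λ u v x → u :* (v :* x) := u :* v :* x) refl (π ^ l) (π ^ k) x) (cong (_* x) (sym (^-homo-* π l k))))
      (*-closed (^-closed (int (+ p)) l) Px)
      where open Solver

    -- If `p` divides `x²`, it divides `x^(p²-2) x² = x^(p²)`, which is congruent to `x` modulo `p`.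
    reduced : ∀ {x} → P x → P (π⁻¹ * (x * x)) → P (π⁻¹ * x)
    reduced {x} Px Px² = subst P (eq sp)
      (minus-closed (*-closed (^-closed Px (p ℕ.* p ℕ.∸ 2)) Px²) (étale Px))
      where
      open Solver
      eq : ∀ {p} → SmallPrime p → x ^ (p ℕ.* p ℕ.∸ 2) * (π⁻¹ * (x * x)) - π⁻¹ * ((x ^ p) ^ p - x) ≡ π⁻¹ * x
      eq two   = solve 2 (λ x r → x :^ 2 :* (r :* (x :* x)) :- r :* ((x :^ 2) :^ 2 :- x) := r :* x) refl x π⁻¹
      eq three = solve 2 (λ x r → x :^ 7 :* (r :* (x :* x)) :- r :* ((x :^ 3) :^ 3 :- x) := r :* x) refl x π⁻¹

    denominators-+ʳ : ∀ {x} k l → P (π ^ k * x) → P (π ^ (k ℕ.+ l) * x)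
    denominators-+ʳ {x} k l Px = subst (λ n → P (π ^ n * x)) (ℕP.+-comm l k) (denominators-+ k l Px)

  module _ {R T : ℚAlgebra} (f : R ⟶ T) where
    private
      module R = ℚAlgebra R
      module T = ℚAlgebra T
      module IR = Integrality R sp
      module IT = Integrality T sp
      open _⟶_ f

    incl-frobenius : ∀ x → IT.π⁻¹ T.* ((⟦ x ⟧ T.^ p) T.^ p T.- ⟦ x ⟧) ≡ ⟦ IR.π⁻¹ R.* ((x R.^ p) R.^ p R.- x) ⟧
    incl-frobenius x = sym (trans (*-homo _ _) (cong₂ T._*_ (ι-homo _)
      (trans (+-homo _ _) (cong₂ T._+_ (trans (^-homo (x R.^ p) p) (cong (T._^ p) (^-homo x p))) (neg-homo x)))))

  module QuadraticÉtale {R : ℚAlgebra} {P} (O : ÉtaleOrder R P) {a b : ℚAlgebra.Carrier R} (Pa : P a) (Pb : P b) where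
    open ÉtaleOrder O
    open QuadraticOrder R a b
    open Quadratic R a b using (gen; incl; incl-*ˡ)
    private
      T = Quadratic.algebra R a b
      module R = ℚAlgebra R
      module T = ℚAlgebra T
      open Integrality T sp using (π; π⁻¹)
      open Subsets.Subring subring
      π^-incl : ∀ k x y → π T.^ k T.* (x , y) ≡ (Integrality.π R sp R.^ k R.* x , Integrality.π R sp R.^ k R.* y)
      π^-incl k x y = trans (cong (T._* (x , y)) (sym (_⟶_.^-homo (quadratic-incl R a b) _ k))) (incl-*ˡ _ x y)

    ²-order-subring : Subsets.Subring T (P ²)
    ²-order-subring = ²-subring subring Pa Pb

    private
      module I = PrimeIdeal T ²-order-subring

    -- The elements with `x^(p²) ≡ x` modulo `p` are closed under sums and products and contain `P`,
    -- so the new generator alone has to be tested.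
    order : I.Étale gen → ÉtaleOrder T (P ²)
    order gen-étale = record
      { subring = ²-order-subring
      ; denominators = λ (x , y) → let k , Px = denominators x ; l , Py = denominators y in
          k ℕ.+ l , subst (P ²) (sym (π^-incl (k ℕ.+ l) x y)) (denominators-+ʳ k l Px , denominators-+ l k Py)
      ; étale = λ Px → I.Fixed.fixed (²-generated {P} {I.Étale} (I.fixed-+ I.frobenius²) (I.fixed-* I.frobenius²)
          (λ {x} Px → I.fix (Px , int (+ 0)) (subst (P ²) (sym (incl-frobenius (quadratic-incl R a b) x)) (étale Px , int (+ 0))))
          gen-étale Px)
      }

  module CubicÉtale {R : ℚAlgebra} {P} (O : ÉtaleOrder R P) {a b c d : ℚAlgebra.Carrier R}
                    (Pa : P a) (Pb : P b) (Pc : P c) (Pd : P d) where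
    open ÉtaleOrder O
    open CubicOrder R a b c d
    open Cubic R a b c d using (gen₁; gen₂; incl; incl-*ˡ)
    private
      T = Cubic.algebra R a b c d
      module R = ℚAlgebra R
      module T = ℚAlgebra T
      open Integrality T sp using (π; π⁻¹)
      open Subsets.Subring subring

    ³-order-subring : Subsets.Subring T (P ³)
    ³-order-subring = ³-subring subring Pa Pb Pc Pd

    private
      module I = PrimeIdeal T ³-order-subring

      π^-incl : ∀ k x y z → let π = Integrality.π R sp in
        Integrality.π T sp T.^ k T.* (x , y , z) ≡ (π R.^ k R.* x , π R.^ k R.* y , π R.^ k R.* z)
      π^-incl k x y z = trans (cong (T._* (x , y , z)) (sym (_⟶_.^-homo (cubic-incl R a b c d) _ k))) (incl-*ˡ _ x y z)

    ³-denominators : ∀ x → ∃ λ k → (P ³) (π T.^ k T.* x)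
    ³-denominators (x , y , z) =
      let k , Px = denominators x ; l , Py = denominators y ; n , Pz = denominators z in
      k ℕ.+ l ℕ.+ n , subst (P ³) (sym (π^-incl (k ℕ.+ l ℕ.+ n) x y z))
        ( denominators-+ʳ (k ℕ.+ l) n (denominators-+ʳ k l Px)
        , denominators-+ʳ (k ℕ.+ l) n (denominators-+ l k Py)
        , denominators-+ n (k ℕ.+ l) Pz)

    order : I.Étale gen₁ → I.Étale gen₂ → ÉtaleOrder T (P ³)
    order gen₁-étale gen₂-étale = record
      { subring = ³-order-subring
      ; denominators = ³-denominators
      ; étale = λ Px → I.Fixed.fixed (³-generated {P} {I.Étale} (I.fixed-+ I.frobenius²) (I.fixed-* I.frobenius²)
          (λ {x} Px → I.fix (Px , int (+ 0) , int (+ 0)) (subst (P ³) (sym (incl-frobenius (cubic-incl R a b c d) x)) (étale Px , int (+ 0) , int (+ 0))))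
          gen₁-étale gen₂-étale Px)
      }

-- Fermat's congruence and the localisation of ℤ at p

private
  module ℤR = ℤSolver.+-*-Solver

fermatℤ : ∀ {p} → SmallPrime p → ∀ n → ∃ λ k → n ℤ.^ p ℤ.- n ≡ + p ℤ.* k
fermatℤ two n with n %ℕ 2 | n%ℕd<d n 2 | a≡a%ℕn+[a/ℕn]*n n 2
... | 0 | _ | eq = let q = n /ℕ 2 in _ , trans (cong (λ n → n ℤ.^ 2 ℤ.- n) eq)
  (ℤR.solve 1 (λ q → let n = ℤR.con (+ 0) ℤR.:+ q ℤR.:* ℤR.con (+ 2) in
    n ℤR.:^ 2 ℤR.:- n ℤR.:= ℤR.con (+ 2) ℤR.:* (ℤR.con (+ 2) ℤR.:* q ℤR.:* q ℤR.:- q)) refl q)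
... | 1 | _ | eq = let q = n /ℕ 2 in _ , trans (cong (λ n → n ℤ.^ 2 ℤ.- n) eq)
  (ℤR.solve 1 (λ q → let n = ℤR.con (+ 1) ℤR.:+ q ℤR.:* ℤR.con (+ 2) in
    n ℤR.:^ 2 ℤR.:- n ℤR.:= ℤR.con (+ 2) ℤR.:* (ℤR.con (+ 2) ℤR.:* q ℤR.:* q ℤR.:+ q)) refl q)
... | suc (suc _) | s≤s (s≤s ()) | _
fermatℤ three n with n %ℕ 3 | n%ℕd<d n 3 | a≡a%ℕn+[a/ℕn]*n n 3
... | 0 | _ | eq = let q = n /ℕ 3 in _ , trans (cong (λ n → n ℤ.^ 3 ℤ.- n) eq)
  (ℤR.solve 1 (λ q → let n = ℤR.con (+ 0) ℤR.:+ q ℤR.:* ℤR.con (+ 3) in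
    n ℤR.:^ 3 ℤR.:- n ℤR.:= ℤR.con (+ 3) ℤR.:* (ℤR.con (+ 9) ℤR.:* q ℤR.:^ 3 ℤR.:- q)) refl q)
... | 1 | _ | eq = let q = n /ℕ 3 in _ , trans (cong (λ n → n ℤ.^ 3 ℤ.- n) eq)
  (ℤR.solve 1 (λ q → let n = ℤR.con (+ 1) ℤR.:+ q ℤR.:* ℤR.con (+ 3) in
    n ℤR.:^ 3 ℤR.:- n ℤR.:= ℤR.con (+ 3) ℤR.:* (ℤR.con (+ 9) ℤR.:* q ℤR.:^ 3 ℤR.:+ ℤR.con (+ 9) ℤR.:* q ℤR.:^ 2 ℤR.:+ ℤR.con (+ 2) ℤR.:* q)) refl q)
... | 2 | _ | eq = let q = n /ℕ 3 in _ , trans (cong (λ n → n ℤ.^ 3 ℤ.- n) eq)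
  (ℤR.solve 1 (λ q → let n = ℤR.con (+ 2) ℤR.:+ q ℤR.:* ℤR.con (+ 3) in
    n ℤR.:^ 3 ℤR.:- n ℤR.:= ℤR.con (+ 3) ℤR.:* (ℤR.con (+ 9) ℤR.:* q ℤR.:^ 3 ℤR.:+ ℤR.con (+ 18) ℤR.:* q ℤR.:^ 2 ℤR.:+ ℤR.con (+ 11) ℤR.:* q ℤR.:+ ℤR.con (+ 2))) refl q)
... | suc (suc (suc _)) | s≤s (s≤s (s≤s ())) | _

module Localisation {p : ℕ} (sp : SmallPrime p) where
  open ℚAlgebra rationals
  open Solver
  open Subsets rationals
  open Integrality rationals sp using (π; π⁻¹; ππ⁻¹; cancel)

  private
    module ℤS = ℤSolver.+-*-Solver

    π-int : ∀ k → ℤ→ℚ (+ p ℤ.* k) ≡ π * ℤ→ℚ k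
    π-int = ℤ→ℚ-* (+ p)

    cancel' : ∀ x → π * (π⁻¹ * x) ≡ x
    cancel' x = trans (solve 3 (λ p r x → p :* (r :* x) := r :* (p :* x)) refl π π⁻¹ x) (cancel x)

  One : ℤ → Set
  One s = ∃ λ t → s ≡ + 1 ℤ.+ + p ℤ.* t

  one-* : ∀ {s s'} → One s → One s' → One (s ℤ.* s')
  one-* (t , refl) (t' , refl) = t ℤ.+ t' ℤ.+ + p ℤ.* (t ℤ.* t') ,
    ℤS.solve 3 (λ p t t' → (ℤS.con (+ 1) ℤS.:+ p ℤS.:* t) ℤS.:* (ℤS.con (+ 1) ℤS.:+ p ℤS.:* t') ℤS.:=
      ℤS.con (+ 1) ℤS.:+ p ℤS.:* (t ℤS.:+ t' ℤS.:+ p ℤS.:* (t ℤS.:* t'))) refl (+ p) t t'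

  -- The localisation of ℤ at p; denominators are normalised to be congruent to 1 modulo p.
  Loc : ℚ → Set
  Loc q = ∃₂ λ s n → One s × ℤ→ℚ s * q ≡ ℤ→ℚ n

  loc-int : ∀ n → Loc (ℤ→ℚ n)
  loc-int n = + 1 , n , (+ 0 , sym (trans (cong (ℤ._+_ (+ 1)) (ℤP.*-zeroʳ (+ p))) refl)) ,
    solve 1 (λ n → con 1ℚ :* n := n) refl (ℤ→ℚ n)

  loc-subring : Subring Loc
  loc-subring = record
    { +-closed = λ { {x} {y} (s , n , s1 , sx) (s' , n' , s'1 , s'y) →
        s ℤ.* s' , s' ℤ.* n ℤ.+ s ℤ.* n' , one-* s1 s'1 , (begin
          ℤ→ℚ (s ℤ.* s') * (x + y) ≡⟨ cong (_* (x + y)) (ℤ→ℚ-* s s') ⟩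
          ℤ→ℚ s * ℤ→ℚ s' * (x + y) ≡⟨ solve 4 (λ s t x y → s :* t :* (x :+ y) := t :* (s :* x) :+ s :* (t :* y)) refl (ℤ→ℚ s) (ℤ→ℚ s') x y ⟩
          ℤ→ℚ s' * (ℤ→ℚ s * x) + ℤ→ℚ s * (ℤ→ℚ s' * y) ≡⟨ cong₂ (λ u v → ℤ→ℚ s' * u + ℤ→ℚ s * v) sx s'y ⟩
          ℤ→ℚ s' * ℤ→ℚ n + ℤ→ℚ s * ℤ→ℚ n' ≡⟨ cong₂ _+_ (ℤ→ℚ-* s' n) (ℤ→ℚ-* s n') ⟨
          ℤ→ℚ (s' ℤ.* n) + ℤ→ℚ (s ℤ.* n') ≡⟨ ℤ→ℚ-+ (s' ℤ.* n) (s ℤ.* n') ⟨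
          ℤ→ℚ (s' ℤ.* n ℤ.+ s ℤ.* n') ∎) }
    ; *-closed = λ { {x} {y} (s , n , s1 , sx) (s' , n' , s'1 , s'y) →
        s ℤ.* s' , n ℤ.* n' , one-* s1 s'1 , (begin
          ℤ→ℚ (s ℤ.* s') * (x * y) ≡⟨ cong (_* (x * y)) (ℤ→ℚ-* s s') ⟩
          ℤ→ℚ s * ℤ→ℚ s' * (x * y) ≡⟨ solve 4 (λ s t x y → s :* t :* (x :* y) := s :* x :* (t :* y)) refl (ℤ→ℚ s) (ℤ→ℚ s') x y ⟩
          ℤ→ℚ s * x * (ℤ→ℚ s' * y) ≡⟨ cong₂ _*_ sx s'y ⟩
          ℤ→ℚ n * ℤ→ℚ n' ≡⟨ ℤ→ℚ-* n n' ⟨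
          ℤ→ℚ (n ℤ.* n') ∎) }
    ; int = loc-int
    }
    where open ≡-Reasoning

  loc-multiple : ∀ {a} → Loc (π⁻¹ * ℤ→ℚ a) → ∃ λ k → a ≡ + p ℤ.* k
  -- Clearing the denominator `s = 1 + p t` gives `s a = p n`, that is `a = p n - p t a`.
  loc-multiple {a} (s , n , (t , refl) , eq) = n ℤ.- t ℤ.* a , (begin
      a ≡⟨ ℤS.solve 3 (λ p t a → a ℤS.:= (ℤS.con (+ 1) ℤS.:+ p ℤS.:* t) ℤS.:* a ℤS.:- p ℤS.:* (t ℤS.:* a)) refl (+ p) t a ⟩
      (+ 1 ℤ.+ + p ℤ.* t) ℤ.* a ℤ.- + p ℤ.* (t ℤ.* a) ≡⟨ cong (ℤ._- + p ℤ.* (t ℤ.* a)) sa≡pn ⟩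
      + p ℤ.* n ℤ.- + p ℤ.* (t ℤ.* a) ≡⟨ ℤS.solve 3 (λ p n b → p ℤS.:* n ℤS.:- p ℤS.:* b ℤS.:= p ℤS.:* (n ℤS.:- b)) refl (+ p) n (t ℤ.* a) ⟩
      + p ℤ.* (n ℤ.- t ℤ.* a) ∎)
    where
    open ≡-Reasoning
    sa≡pn : (+ 1 ℤ.+ + p ℤ.* t) ℤ.* a ≡ + p ℤ.* n
    sa≡pn = ℤ→ℚ-injective (begin
      ℤ→ℚ (s ℤ.* a) ≡⟨ ℤ→ℚ-* s a ⟩
      ℤ→ℚ s * ℤ→ℚ a ≡⟨ cong (ℤ→ℚ s *_) (cancel' (ℤ→ℚ a)) ⟨
      ℤ→ℚ s * (π * (π⁻¹ * ℤ→ℚ a)) ≡⟨ solve 3 (λ s p x → s :* (p :* x) := p :* (s :* x)) refl (ℤ→ℚ s) π (π⁻¹ * ℤ→ℚ a) ⟩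
      π * (ℤ→ℚ s * (π⁻¹ * ℤ→ℚ a)) ≡⟨ cong (π *_) eq ⟩
      π * ℤ→ℚ n ≡⟨ ℤ→ℚ-* (+ p) n ⟨
      ℤ→ℚ (+ p ℤ.* n) ∎)

  private
    ^-pred : ∀ {p} → SmallPrime p → ∀ x → x ^ p ≡ x * x ^ (p ℕ.∸ 1)
    ^-pred two   x = refl
    ^-pred three x = refl

    ℤ^-pred : ∀ {p} → SmallPrime p → ∀ x → x ℤ.^ p ≡ x ℤ.* x ℤ.^ (p ℕ.∸ 1)
    ℤ^-pred two   x = refl
    ℤ^-pred three x = refl

    ℤ→ℚ-^ : ∀ a n → ℤ→ℚ (a ℤ.^ n) ≡ ℤ→ℚ a ^ n
    ℤ→ℚ-^ a zero    = refl
    ℤ→ℚ-^ a (suc n) = trans (ℤ→ℚ-* a (a ℤ.^ n)) (cong (ℤ→ℚ a *_) (ℤ→ℚ-^ a n))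

    one-^ : ∀ {s} → One s → ∀ n → One (s ℤ.^ n)
    one-^ s1 zero    = + 0 , sym (cong (ℤ._+_ (+ 1)) (ℤP.*-zeroʳ (+ p)))
    one-^ s1 (suc n) = one-* s1 (one-^ s1 n)

  -- Multiplied by `s^p`, the difference `q^p - q` becomes `n^p - s^(p-1) n`. As `s` is 1 modulo
  -- `p`, this is congruent to `n^p - n`, and Fermat's congruence for integers applies.
  fermat : ∀ {q} → Loc q → Loc (π⁻¹ * (q ^ p - q))
  fermat {q} (s , n , s1 , sq) with one-^ s1 (p ℕ.∸ 1) | fermatℤ sp n
  ... | t , s'≡ | k , n^p-n≡ = s ℤ.* s' , k ℤ.- t ℤ.* n , one-* s1 (one-^ s1 (p ℕ.∸ 1)) , (begin
      ℤ→ℚ (s ℤ.* s') * (π⁻¹ * (q ^ p - q)) ≡⟨ cong₂ (λ u v → u * (π⁻¹ * (v - q))) (ℤ→ℚ-* s s') (^-pred sp q) ⟩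
      S * S' * (π⁻¹ * (q * Q' - q)) ≡⟨ solve 5 (λ s s' r q q' → s :* s' :* (r :* (q :* q' :- q)) := r :* (s :* q :* (s' :* q') :- s' :* (s :* q))) refl S S' π⁻¹ q Q' ⟩
      π⁻¹ * (S * q * (S' * Q') - S' * (S * q)) ≡⟨ cong (λ z → π⁻¹ * (S * q * z - S' * (S * q))) (trans (cong (_* Q') (ℤ→ℚ-^ s p')) (sym (^-distrib-* S q p'))) ⟩
      π⁻¹ * (S * q * (S * q) ^ p' - S' * (S * q)) ≡⟨ cong (λ z → π⁻¹ * (z * z ^ p' - S' * z)) sq ⟩
      π⁻¹ * (N * N ^ p' - S' * N) ≡⟨ cong (λ z → π⁻¹ * (z - S' * N)) (trans (sym (^-pred sp N)) (sym (ℤ→ℚ-^ n p))) ⟩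
      π⁻¹ * (ℤ→ℚ (n ℤ.^ p) - S' * N) ≡⟨ cong (λ z → π⁻¹ * (ℤ→ℚ (n ℤ.^ p) + z)) (trans (cong (-_) (sym (ℤ→ℚ-* s' n))) (sym (ℤ→ℚ-neg (s' ℤ.* n)))) ⟩
      π⁻¹ * (ℤ→ℚ (n ℤ.^ p) + ℤ→ℚ (ℤ.- (s' ℤ.* n))) ≡⟨ cong (π⁻¹ *_) (sym (ℤ→ℚ-+ (n ℤ.^ p) (ℤ.- (s' ℤ.* n)))) ⟩
      π⁻¹ * ℤ→ℚ (n ℤ.^ p ℤ.- s' ℤ.* n) ≡⟨ cong (λ z → π⁻¹ * ℤ→ℚ z) numerator ⟩
      π⁻¹ * ℤ→ℚ (+ p ℤ.* (k ℤ.- t ℤ.* n)) ≡⟨ trans (cong (π⁻¹ *_) (π-int (k ℤ.- t ℤ.* n))) (cancel _) ⟩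
      ℤ→ℚ (k ℤ.- t ℤ.* n) ∎)
    where
    open ≡-Reasoning
    p' = p ℕ.∸ 1
    s' = s ℤ.^ p'
    S = ℤ→ℚ s
    S' = ℤ→ℚ s'
    N = ℤ→ℚ n
    Q' = q ^ p'
    numerator : n ℤ.^ p ℤ.- s' ℤ.* n ≡ + p ℤ.* (k ℤ.- t ℤ.* n)
    numerator = begin
      n ℤ.^ p ℤ.- s' ℤ.* n ≡⟨ cong (λ z → n ℤ.^ p ℤ.- z ℤ.* n) s'≡ ⟩
      n ℤ.^ p ℤ.- (+ 1 ℤ.+ + p ℤ.* t) ℤ.* n ≡⟨ ℤS.solve 4 (λ x p t n → x ℤS.:- (ℤS.con (+ 1) ℤS.:+ p ℤS.:* t) ℤS.:* n ℤS.:= (x ℤS.:- n) ℤS.:- p ℤS.:* (t ℤS.:* n)) refl (n ℤ.^ p) (+ p) t n ⟩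
      n ℤ.^ p ℤ.- n ℤ.- + p ℤ.* (t ℤ.* n) ≡⟨ cong (ℤ._- + p ℤ.* (t ℤ.* n)) n^p-n≡ ⟩
      + p ℤ.* k ℤ.- + p ℤ.* (t ℤ.* n) ≡⟨ ℤS.solve 3 (λ p k x → p ℤS.:* k ℤS.:- p ℤS.:* x ℤS.:= p ℤS.:* (k ℤS.:- x)) refl (+ p) k (t ℤ.* n) ⟩
      + p ℤ.* (k ℤ.- t ℤ.* n) ∎

  private
    Cleared : ℕ → Set
    Cleared d = ∃₂ λ k s → ∃ λ c → One s × s ℤ.* (+ p) ℤ.^ k ≡ + d ℤ.* c

    clear-one : ∀ d → One (+ d) → Cleared d
    clear-one d d1 = 0 , + d , + 1 , d1 , refl

    clear-minus-one : ∀ d → One (ℤ.- + d) → Cleared d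
    clear-minus-one d d1 = 0 , ℤ.- + d , -[1+ 0 ] , d1 ,
      ℤS.solve 1 (λ d → ℤS.:- d ℤS.:* ℤS.con (+ 1) ℤS.:= d ℤS.:* ℤS.con (-[1+ 0 ])) refl (+ d)

    instance
      p≢0 : ℕ.NonZero p
      p≢0 = nonZero sp
        where
        nonZero : ∀ {p} → SmallPrime p → ℕ.NonZero p
        nonZero two   = _
        nonZero three = _

    split : ∀ d {r} → d ℕ.% p ≡ r → + d ≡ + r ℤ.+ + (d ℕ./ p) ℤ.* + p
    split d refl = trans (cong +_ (ℕD.m≡m%n+[m/n]*n d p))
      (trans (ℤP.pos-+ (d ℕ.% p) _) (cong (λ z → + (d ℕ.% p) ℤ.+ z) (ℤP.pos-* (d ℕ./ p) p)))

    ±one : ∀ {p} → SmallPrime p → ∀ {r e d} → suc r ℕ.< p → d ≡ + suc r ℤ.+ e ℤ.* + p →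
           (∃ λ t → d ≡ + 1 ℤ.+ + p ℤ.* t) ⊎ (∃ λ t → ℤ.- d ≡ + 1 ℤ.+ + p ℤ.* t)
    ±one two   {zero} {e} _ d≡ = inj₁ (e , trans d≡ (cong (ℤ._+_ (+ 1)) (ℤP.*-comm e (+ 2))))
    ±one two   {suc _} (s≤s (s≤s ())) _
    ±one three {zero} {e} _ d≡ = inj₁ (e , trans d≡ (cong (ℤ._+_ (+ 1)) (ℤP.*-comm e (+ 3))))
    ±one three {suc zero} {e} _ d≡ = inj₂ (ℤ.- e ℤ.- + 1 , trans (cong ℤ.-_ d≡)
      (ℤS.solve 1 (λ e → ℤS.:- (ℤS.con (+ 2) ℤS.:+ e ℤS.:* ℤS.con (+ 3)) ℤS.:=
        ℤS.con (+ 1) ℤS.:+ ℤS.con (+ 3) ℤS.:* (ℤS.:- e ℤS.:- ℤS.con (+ 1))) refl e))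
    ±one three {suc (suc _)} (s≤s (s≤s (s≤s ()))) _

    clear-unit : ∀ d r → suc r ℕ.< p → d ℕ.% p ≡ suc r → Cleared d
    clear-unit d r r<p d%p≡r with ±one sp {e = + (d ℕ./ p)} r<p (split d d%p≡r)
    ... | inj₁ d1 = clear-one d d1
    ... | inj₂ d1 = clear-minus-one d d1

    -- Factors `p` of `d` are split off by strong induction. What remains is prime to `p`, hence ±1
    -- modulo `p` because `p` is at most 3, and `d` or `-d` itself serves as the denominator `s`.
    clear : ∀ d → d ≢ 0 → Cleared d
    clear = <-rec _ step
      where
      1<p : ∀ {p} → SmallPrime p → 1 ℕ.< p
      1<p two   = s≤s (s≤s z≤n)
      1<p three = s≤s (s≤s z≤n)
      step : ∀ d → (∀ {e} → e ℕ.< d → e ≢ 0 → Cleared e) → d ≢ 0 → Cleared d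
      step d rec d≢0 with d ℕ.% p in d%p
      ... | suc r = clear-unit d r (subst (ℕ._< p) d%p (ℕD.m%n<n d p)) d%p
      ... | zero with rec (ℕD.m/n<m d p {{ℕ.≢-nonZero d≢0}} (1<p sp)) e≢0
        where
        e≢0 : d ℕ./ p ≢ 0
        e≢0 e≡0 = d≢0 (ℤP.+-injective (trans (split d d%p) (cong (λ e → + 0 ℤ.+ + e ℤ.* + p) e≡0)))
      ... | k , s , c , s1 , eq = suc k , s , c , s1 , (begin
        s ℤ.* (+ p ℤ.* (+ p) ℤ.^ k) ≡⟨ ℤS.solve 3 (λ s p q → s ℤS.:* (p ℤS.:* q) ℤS.:= p ℤS.:* (s ℤS.:* q)) refl s (+ p) ((+ p) ℤ.^ k) ⟩
        + p ℤ.* (s ℤ.* (+ p) ℤ.^ k) ≡⟨ cong (+ p ℤ.*_) eq ⟩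
        + p ℤ.* (+ (d ℕ./ p) ℤ.* c) ≡⟨ ℤS.solve 3 (λ p e c → p ℤS.:* (e ℤS.:* c) ℤS.:= (ℤS.con (+ 0) ℤS.:+ e ℤS.:* p) ℤS.:* c) refl (+ p) (+ (d ℕ./ p)) c ⟩
        (+ 0 ℤ.+ + (d ℕ./ p) ℤ.* + p) ℤ.* c ≡⟨ cong (ℤ._* c) (split d d%p) ⟨
        + d ℤ.* c ∎)
        where open ≡-Reasoning

  loc-denominators : ∀ q → ∃ λ k → Loc (π ^ k * q)
  loc-denominators q with clear (ℚ.denominatorℕ q) (λ ())
  ... | k , s , c , s1 , eq = let open ≡-Reasoning in k , s , c ℤ.* ℚ.numerator q , s1 , (begin
    ℤ→ℚ s * (π ^ k * q) ≡⟨ solve 3 (λ s u q → s :* (u :* q) := s :* u :* q) refl (ℤ→ℚ s) (π ^ k) q ⟩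
    ℤ→ℚ s * π ^ k * q ≡⟨ cong (_* q) (trans (cong (ℤ→ℚ s *_) (sym (ℤ→ℚ-^ (+ p) k))) (sym (ℤ→ℚ-* s _))) ⟩
    ℤ→ℚ (s ℤ.* (+ p) ℤ.^ k) * q ≡⟨ cong (λ z → ℤ→ℚ z * q) eq ⟩
    ℤ→ℚ (↧ ℤ.* c) * q ≡⟨ cong (_* q) (ℤ→ℚ-* ↧ c) ⟩
    ℤ→ℚ ↧ * ℤ→ℚ c * q ≡⟨ solve 3 (λ d c q → d :* c :* q := c :* (d :* q)) refl (ℤ→ℚ ↧) (ℤ→ℚ c) q ⟩
    ℤ→ℚ c * (ℤ→ℚ ↧ * q) ≡⟨ cong (ℤ→ℚ c *_) (denominator-* q) ⟩
    ℤ→ℚ c * ℤ→ℚ (ℚ.numerator q) ≡⟨ ℤ→ℚ-* c _ ⟨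
    ℤ→ℚ (c ℤ.* ℚ.numerator q) ∎)
    where
    ↧ = ℚ.denominator q
    denominator-* : ∀ q → ℤ→ℚ (ℚ.denominator q) * q ≡ ℤ→ℚ (ℚ.numerator q)
    denominator-* q@record{} = ℚP.toℚᵘ-injective (begin
      ℚ.toℚᵘ (ℤ→ℚ d * q) ≈⟨ ℚP.toℚᵘ-homo-* (ℤ→ℚ d) q ⟩
      ℚ.toℚᵘ (ℤ→ℚ d) ℚᵘ.* ℚ.toℚᵘ q ≈⟨ ℚᵘP.*-congʳ {ℚ.toℚᵘ q} (ℚP.toℚᵘ-fromℚᵘ (ℚᵘ.mkℚᵘ d 0)) ⟩
      ℚᵘ.mkℚᵘ d 0 ℚᵘ.* ℚ.toℚᵘ q ≈⟨ ℚᵘ.*≡* (ℤS.solve 2 (λ d n → d ℤS.:* n ℤS.:* ℤS.con (+ 1) ℤS.:= n ℤS.:* (ℤS.con (+ 1) ℤS.:* d)) refl d (ℚ.numerator q)) ⟩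
      ℚᵘ.mkℚᵘ (ℚ.numerator q) 0 ≈⟨ ℚP.toℚᵘ-fromℚᵘ (ℚᵘ.mkℚᵘ (ℚ.numerator q) 0) ⟨
      ℚ.toℚᵘ (ℤ→ℚ (ℚ.numerator q)) ∎)
      where
      d = ℚ.denominator q
      open ℚᵘP.≃-Reasoning

  loc-étale : ÉtaleOrder sp rationals Loc
  loc-étale = record
    { subring      = loc-subring
    ; denominators = loc-denominators
    ; étale        = λ {q} Lq → subst Loc
        (solve 3 (λ r a q → r :* (a :^ 1 :- q) := r :* (a :- q)) refl π⁻¹ ((q ^ p) ^ p) q)
        (subst Loc (solve 4 (λ r a b q → r :* (a :- b) :+ r :* (b :- q) := r :* (a :^ 1 :- q)) refl π⁻¹ ((q ^ p) ^ p) (q ^ p) q)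
          (+-closed (fermat (^-closed Lq p)) (fermat Lq)))
    }
    where open Subring loc-subring

  digits-injective : ∀ (i j : Fin p) → Loc (π⁻¹ * (ℤ→ℚ (+ toℕ i) - ℤ→ℚ (+ toℕ j))) → i ≡ j
  digits-injective i j Lij with loc-multiple {+ toℕ i ℤ.- + toℕ j} (subst (λ z → Loc (π⁻¹ * z))
      (sym (trans (ℤ→ℚ-+ (+ toℕ i) (ℤ.- + toℕ j)) (cong (λ z → ℤ→ℚ (+ toℕ i) + z) (ℤ→ℚ-neg (+ toℕ j))))) Lij)
  ... | k , eq = small sp i j (ℕ∣.divides ℤ.∣ k ∣ (trans (cong ℤ.∣_∣ eq) (trans (ℤP.abs-* (+ p) k) (ℕP.*-comm p ℤ.∣ k ∣))))
    where
    small : ∀ {p} → SmallPrime p → ∀ (i j : Fin p) → p ℕ∣.∣ ℤ.∣ + toℕ i ℤ.- + toℕ j ∣ → i ≡ j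
    small two   = from-yes (FinP.all? {2} λ i → FinP.all? {2} λ j → (2 ℕ∣.∣? ℤ.∣ + toℕ i ℤ.- + toℕ j ∣) →-dec (i FinP.≟ j))
    small three = from-yes (FinP.all? {3} λ i → FinP.all? {3} λ j → (3 ℕ∣.∣? ℤ.∣ + toℕ i ℤ.- + toℕ j ∣) →-dec (i FinP.≟ j))

-- The unit ball at the prime 2

module _ (L : ℚAlgebra) {B : ℚAlgebra.Carrier L → Set} (O : ÉtaleOrder two L B)
         {δ : ℚAlgebra.Carrier L} (Bδ : B δ) (k : ℤ) where
  open ℚAlgebra L

  module Quartic₂ (δ² : δ * δ ≡ δ + ι (ℤ→ℚ k)) where
    open Solver
    open ÉtaleOrder O
    open Subsets L
    open Subring subring

    d : Carrier
    d = ι ½ * (δ - ι 1ℚ)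

    -- y = (1 + β)/2 with β² = 2 δ - 1.
    open Quadratic L (ι 1ℚ) d public
      renaming (algebra to T; gen to y; gen² to y²) using (incl; incl-*ˡ)
    private
      module T = ℚAlgebra T
      module S = Subsets T
      open Integrality T two

    -- The condition on `d * s` says that `(δ - 1) s` is even. On the factors of `B/2B` with δ = 1
    -- it is void: there `d` is integral and `y` generates an unramified extension. On the others δ
    -- - 1 is a unit, so `s` is even and only multiples of `2 y = 1 + β` occur, an element of norm
    -- 2^(-1/2) that belongs to `J`.
    Λ J : T.Carrier → Set
    Λ (r , s) = B r × B s × B (d * s)
    J (r , s) = B (ι ½ * r) × B (ι ½ * s)

    private
      2B : ∀ {x} → B x → B (ι (ℤ→ℚ (+ 2)) * x)
      2B = *-closed (int (+ 2))

      BδB : ∀ {x} → B x → B ((δ - ι 1ℚ) * x)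
      BδB = *-closed (minus-closed Bδ (int (+ 1)))

      Λ-subring : S.Subring Λ
      Λ-subring = record
        { +-closed = λ { {r , s} {r' , s'} (a , b , c) (a' , b' , c') → +-closed a a' , +-closed b b' ,
            subst B (solve 3 (λ d s s' → d :* s :+ d :* s' := d :* (s :+ s')) refl d s s') (+-closed c c') }
        ; *-closed = λ { {r , s} {r' , s'} (a , b , c) (a' , b' , c') →
              +-closed (*-closed a a') (subst B (solve 3 (λ d s s' → d :* s :* s' := d :* (s :* s')) refl d s s') (*-closed c b'))
            , +-closed (+-closed (*-closed a b') (*-closed b a')) (*-closed (int (+ 1)) (*-closed b b'))
            , subst B (solve 5 (λ d r s r' s' → r :* (d :* s') :+ d :* s :* r' :+ d :* s :* s' :=
                         d :* (r :* s' :+ s :* r' :+ con 1ℚ :* (s :* s'))) refl d r s r' s')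
                (+-closed (+-closed (*-closed a c') (*-closed c a')) (*-closed c b')) }
        ; int = λ n → int n , int (+ 0) , subst B (solve 1 (λ d → con 0ℚ := d :* con 0ℚ) refl d) (int (+ 0))
        }

      J-ideal : S.Ideal Λ J
      J-ideal = record
        { subring = Λ-subring
        ; +-ideal = λ { {r , s} {r' , s'} (a , b) (a' , b') →
            subst B (½-+ r r') (+-closed a a') , subst B (½-+ s s') (+-closed b b') }
        ; *-ideal = λ { {r , s} {r' , s'} (a , b , c) (a' , b') →
              subst B (solve 5 (λ d r s r' s' → r :* (con ½ :* r') :+ d :* s :* (con ½ :* s') := con ½ :* (r :* r' :+ d :* (s :* s'))) refl d r s r' s')
                (+-closed (*-closed a a') (*-closed c b'))
            , subst B (solve 4 (λ r s r' s' → r :* (con ½ :* s') :+ s :* (con ½ :* r') :+ s :* (con ½ :* s') :=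
                          con ½ :* (r :* s' :+ s :* r' :+ con 1ℚ :* (s :* s'))) refl r s r' s')
                (+-closed (+-closed (*-closed a b') (*-closed b a')) (*-closed b b')) }
        }
        where ½-+ = solve 2 (λ x y → con ½ :* x :+ con ½ :* y := con ½ :* (x :+ y)) refl

      fourth-power : ∀ {x} → B x → B (ι ½ * (x * x * x * x - x))
      fourth-power {x} Bx = subst B (solve 1 (λ x → con ½ :* ((x :^ 2) :^ 2 :- x) := con ½ :* (x :* x :* x :* x :- x)) refl x) (étale Bx)

      dδ : d * δ ≡ ι ½ * ι (ℤ→ℚ k)
      dδ = trans (solve 1 (λ x → con ½ :* (x :- con 1ℚ) :* x := con ½ :* (x :* x :- x)) refl δ)
        (trans (cong (λ z → ι ½ * (z - δ)) δ²) (solve 2 (λ x k → con ½ :* (x :+ k :- x) := con ½ :* k) refl δ (ι (ℤ→ℚ k))))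

      ι-double : ∀ j → ι (ℤ→ℚ (+ 2 ℤ.* j)) ≡ ι (ℤ→ℚ (+ 2)) * ι (ℤ→ℚ j)
      ι-double j = trans (cong ι (ℤ→ℚ-* (+ 2) j)) (ι-* _ _)

      -- With e = d s², the term e² + s² e of x⁴ is even: for odd k because s is, for even k because then
      -- e ≡ (k/2) s² modulo 2.
      even : (∃ λ j → k ≡ + 2 ℤ.* j ⊎ k ≡ + 2 ℤ.* j ℤ.+ + 1) → ∀ {s} → B s → B (d * s) →
             B (ι ½ * (d * (s * s) * (d * (s * s)) + s * s * (d * (s * s))))
      even (j , inj₂ k≡) {s} Bs Bds = subst (λ s' → B (ι ½ * (d * (s * s) * (d * (s * s)) + s * s * (d * (s * s))))) s≡2w
        (subst B (sym eq) (+-closed (2B (*-closed (*-closed Bds Bds) (*-closed Bw Bw)))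
                              (*-closed (int (+ 4)) (*-closed (*-closed Bw (*-closed Bw Bw)) Bds))))
        where
        open ≡-Reasoning
        u = d * s
        J' = ι (ℤ→ℚ j)
        -- Here `w` is `s / 2`: indeed `δ u = (δ d) s = (k/2) s = j s + s/2`.
        w = δ * u - J' * s
        Bw : B w
        Bw = minus-closed (*-closed Bδ Bds) (*-closed (int j) Bs)
        s≡2w : s ≡ ι (ℤ→ℚ (+ 2)) * w
        s≡2w = begin
          s ≡⟨ solve 2 (λ s j → s := :ℕ 2 :* (con ½ :* (:ℕ 2 :* j :+ con 1ℚ) :* s :- j :* s)) refl s J' ⟩
          ι (ℤ→ℚ (+ 2)) * (ι ½ * (ι (ℤ→ℚ (+ 2)) * J' + ι 1ℚ) * s - J' * s) ≡⟨ cong (λ z → ι (ℤ→ℚ (+ 2)) * (ι ½ * z * s - J' * s)) (sym ιk) ⟩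
          ι (ℤ→ℚ (+ 2)) * (ι ½ * ι (ℤ→ℚ k) * s - J' * s) ≡⟨ cong (λ z → ι (ℤ→ℚ (+ 2)) * (z * s - J' * s)) (sym dδ) ⟩
          ι (ℤ→ℚ (+ 2)) * (d * δ * s - J' * s) ≡⟨ solve 4 (λ d x s j → :ℕ 2 :* (d :* x :* s :- j :* s) := :ℕ 2 :* (x :* (d :* s) :- j :* s)) refl d δ s J' ⟩
          ι (ℤ→ℚ (+ 2)) * w ∎
          where
          ιk : ι (ℤ→ℚ k) ≡ ι (ℤ→ℚ (+ 2)) * J' + ι 1ℚ
          ιk = trans (cong (λ k → ι (ℤ→ℚ k)) k≡) (trans (cong ι (ℤ→ℚ-+ (+ 2 ℤ.* j) (+ 1))) (trans (ι-+ _ _) (cong (λ z → z + ι 1ℚ) (ι-double j))))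
        eq : ι ½ * (d * (s * s) * (d * (s * s)) + s * s * (d * (s * s))) ≡ ι (ℤ→ℚ (+ 2)) * (u * u * (w * w)) + ι (ℤ→ℚ (+ 4)) * (w * (w * w) * u)
        eq = begin
          ι ½ * (d * (s * s) * (d * (s * s)) + s * s * (d * (s * s))) ≡⟨ solve 2 (λ d s → con ½ :* (d :* (s :* s) :* (d :* (s :* s)) :+ s :* s :* (d :* (s :* s))) :=
                con ½ :* (d :* s :* (d :* s) :* (s :* s) :+ s :* (s :* s) :* (d :* s))) refl d s ⟩
          ι ½ * (u * u * (s * s) + s * (s * s) * u) ≡⟨ cong (λ s → ι ½ * (u * u * (s * s) + s * (s * s) * u)) s≡2w ⟩
          ι ½ * (u * u * (ι (ℤ→ℚ (+ 2)) * w * (ι (ℤ→ℚ (+ 2)) * w)) + ι (ℤ→ℚ (+ 2)) * w * (ι (ℤ→ℚ (+ 2)) * w * (ι (ℤ→ℚ (+ 2)) * w)) * u)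
            ≡⟨ solve 2 (λ u w → let t = :ℕ 2 :* w in con ½ :* (u :* u :* (t :* t) :+ t :* (t :* t) :* u) :=
                :ℕ 2 :* (u :* u :* (w :* w)) :+ :ℕ 4 :* (w :* (w :* w) :* u)) refl u w ⟩
          ι (ℤ→ℚ (+ 2)) * (u * u * (w * w)) + ι (ℤ→ℚ (+ 4)) * (w * (w * w) * u) ∎
      even (j , inj₁ k≡) {s} Bs Bds = subst B (sym eq)
        (+-closed (+-closed (*-closed Bj (*-closed (*-closed Bs Bs) (*-closed Bs Bs)))
                            (2B (minus-closed (*-closed (*-closed Bu² Bds) Bds) (*-closed (int j) (*-closed (*-closed Bs Bs) Bu²)))))
                  (neg-closed (*-closed (*-closed Bs Bs) Bu²)))
        where
        open ≡-Reasoning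
        u = d * s
        J' = ι (ℤ→ℚ j)
        Bu² = *-closed Bds Bds
        Bj : B (ι ½ * (J' * J' + J'))
        Bj with fermatℤ two j
        ... | c , j²-j≡ = subst B (begin
            J' + ι (ℤ→ℚ c) ≡⟨ solve 2 (λ j c → j :+ c := con ½ :* (:ℕ 2 :* j :+ :ℕ 2 :* c)) refl J' (ι (ℤ→ℚ c)) ⟩
            ι ½ * (ι (ℤ→ℚ (+ 2)) * J' + ι (ℤ→ℚ (+ 2)) * ι (ℤ→ℚ c)) ≡⟨ cong (λ z → ι ½ * (ι (ℤ→ℚ (+ 2)) * J' + z)) (trans (sym (ι-double c)) (cong (λ a → ι (ℤ→ℚ a)) (sym j²-j≡))) ⟩
            ι ½ * (ι (ℤ→ℚ (+ 2)) * J' + ι (ℤ→ℚ (j ℤ.^ 2 ℤ.- j))) ≡⟨ cong (λ z → ι ½ * (ι (ℤ→ℚ (+ 2)) * J' + z)) ι-j² ⟩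
            ι ½ * (ι (ℤ→ℚ (+ 2)) * J' + (J' * (J' * ι 1ℚ) - J')) ≡⟨ solve 1 (λ j → con ½ :* (:ℕ 2 :* j :+ (j :* (j :* con 1ℚ) :- j)) := con ½ :* (j :* j :+ j)) refl J' ⟩
            ι ½ * (J' * J' + J') ∎)
            (+-closed (int j) (int c))
          where
          ι-j² : ι (ℤ→ℚ (j ℤ.^ 2 ℤ.- j)) ≡ J' * (J' * ι 1ℚ) - J'
          ι-j² = trans (cong ι (trans (ℤ→ℚ-+ (j ℤ.^ 2) (ℤ.- j)) (cong₂ ℚ._+_ (trans (ℤ→ℚ-* j (j ℤ.* + 1)) (cong (ℤ→ℚ j ℚ.*_) (ℤ→ℚ-* j (+ 1)))) (ℤ→ℚ-neg j))))
                   (trans (ι-+ _ _) (cong₂ _+_ (trans (ι-* _ _) (cong (J' *_) (ι-* _ _))) (ι-neg _)))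
        dδ≡j : d * δ ≡ J'
        dδ≡j = trans dδ (trans (cong (ι ½ *_) (trans (cong (λ k → ι (ℤ→ℚ k)) k≡) (ι-double j)))
                 (solve 1 (λ j → con ½ :* (:ℕ 2 :* j) := j) refl J'))
        -- Since `δ - 1 = 2 d`, one has `d = d δ - 2 d² = j - 2 d²`.
        e≡ : d * (s * s) ≡ J' * (s * s) - ι (ℤ→ℚ (+ 2)) * (u * u)
        e≡ = begin
          d * (s * s) ≡⟨ solve 2 (λ x s → let d = con ½ :* (x :- con 1ℚ) in
                              d :* (s :* s) := d :* x :* (s :* s) :- :ℕ 2 :* (d :* s :* (d :* s))) refl δ s ⟩
          d * δ * (s * s) - ι (ℤ→ℚ (+ 2)) * (u * u) ≡⟨ cong (λ z → z * (s * s) - ι (ℤ→ℚ (+ 2)) * (u * u)) dδ≡j ⟩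
          J' * (s * s) - ι (ℤ→ℚ (+ 2)) * (u * u) ∎
        eq : ι ½ * (d * (s * s) * (d * (s * s)) + s * s * (d * (s * s))) ≡
             ι ½ * (J' * J' + J') * (s * s * (s * s)) + ι (ℤ→ℚ (+ 2)) * (u * u * u * u - J' * (s * s * (u * u))) + - (s * s * (u * u))
        eq = trans (cong (λ e → ι ½ * (e * e + s * s * e)) e≡)
          (solve 3 (λ j s u → let e = j :* (s :* s) :- :ℕ 2 :* (u :* u) in
            con ½ :* (e :* e :+ s :* s :* e) :=
            con ½ :* (j :* j :+ j) :* (s :* s :* (s :* s)) :+ :ℕ 2 :* (u :* u :* u :* u :- j :* (s :* s :* (u :* u))) :+ :- (s :* s :* (u :* u))) refl J' s u)

      parity : ∃ λ j → k ≡ + 2 ℤ.* j ⊎ k ≡ + 2 ℤ.* j ℤ.+ + 1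
      parity with k %ℕ 2 | n%ℕd<d k 2 | a≡a%ℕn+[a/ℕn]*n k 2
      ... | 0 | _ | eq = k /ℕ 2 , inj₁ (trans eq (trans (ℤP.+-identityˡ _) (ℤP.*-comm (k /ℕ 2) (+ 2))))
      ... | 1 | _ | eq = k /ℕ 2 , inj₂ (trans eq (trans (ℤP.+-comm (+ 1) (k /ℕ 2 ℤ.* + 2)) (cong (ℤ._+ + 1) (ℤP.*-comm (k /ℕ 2) (+ 2)))))
      ... | suc (suc _) | s≤s (s≤s ()) | _

      -- With `x² = X + Y y` one gets `x⁴ = X² + d Y² + (2 X Y + Y²) y`. Apart from terms with an
      -- evident factor 2, the coordinates of `x⁴ - x` consist of `r⁴ - r`, `s⁴ - s` and the
      -- expression treated by `even`.
      fixed : ∀ {x} → Λ x → J ((x T.* x) T.* (x T.* x) T.- x)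
      fixed {r , s} (Br , Bs , Bds) =
          subst B (solve 3 (λ d r s → let e = d :* (s :* s); X = r :* r :+ e; Y = r :* s :+ s :* r :+ con 1ℚ :* (s :* s) in
              con ½ :* (r :* r :* r :* r :- r) :+ :ℕ 3 :* (r :* r :* (d :* s :* s)) :+ :ℕ 2 :* (r :* s :* (d :* s :* s))
                :+ con ½ :* (e :* e :+ s :* s :* e) :=
              con ½ :* (X :* X :+ d :* (Y :* Y) :- r)) refl d r s)
            (+-closed (+-closed (+-closed (fourth-power Br) (*-closed (int (+ 3)) (*-closed (*-closed Br Br) (*-closed Bds Bs))))
                                (2B (*-closed (*-closed Br Bs) (*-closed Bds Bs))))
                      (even parity Bs Bds))
        , subst B (solve 3 (λ d r s → let X = r :* r :+ d :* (s :* s); X' = r :* r :+ d :* s :* s ; Y = r :* s :+ s :* r :+ con 1ℚ :* (s :* s) in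
              X' :* Y :+ :ℕ 2 :* (r :* s :* (r :* s) :+ r :* s :* (s :* s)) :+ con ½ :* (s :* s :* s :* s :- s) :=
              con ½ :* (X :* Y :+ Y :* X :+ con 1ℚ :* (Y :* Y) :- s)) refl d r s)
            (+-closed (+-closed
              (*-closed (+-closed (*-closed Br Br) (*-closed Bds Bs)) (+-closed (+-closed (*-closed Br Bs) (*-closed Bs Br)) (*-closed (int (+ 1)) (*-closed Bs Bs))))
              (2B (+-closed (*-closed (*-closed Br Bs) (*-closed Br Bs)) (*-closed (*-closed Br Bs) (*-closed Bs Bs)))))
              (fourth-power Bs))

    unit-ball : IsUnitBall Λ J
    unit-ball = record
      { ideal = J-ideal
      ; π-ideal = λ { {r , s} (Br , Bs , _) → subst J (sym (incl-*ˡ (ι (ℤ→ℚ (+ 2))) r s))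
          (subst B (halve r) Br , subst B (halve s) Bs) }
      ; reduced = λ {x} Λx → subst J (TS.solve 1 (λ x → (x TS.:* x) TS.:* (x TS.:* x) TS.:- x TS.:= (x TS.:^ 2) TS.:^ 2 TS.:- x) refl x) (fixed Λx)
      ; square = λ { {r , s} (Br , Bs) → subst Λ (sym (incl-*ˡ (ι ½) (r * r + d * (s * s)) (r * s + s * r + ι 1ℚ * (s * s))))
          ( subst B (solve 3 (λ x r s → let r' = con ½ :* r; s' = con ½ :* s in
                :ℕ 2 :* (r' :* r') :+ (x :- con 1ℚ) :* (s' :* s') := con ½ :* (r :* r :+ con ½ :* (x :- con 1ℚ) :* (s :* s))) refl δ r s)
              (+-closed (2B (*-closed Br Br)) (BδB (*-closed Bs Bs)))
          , subst B (solve 2 (λ r s → let r' = con ½ :* r; s' = con ½ :* s in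
                :ℕ 2 :* (:ℕ 2 :* (r' :* s') :+ s' :* s') := con ½ :* (r :* s :+ s :* r :+ con 1ℚ :* (s :* s))) refl r s)
              (2B (+-closed (2B (*-closed Br Bs)) (*-closed Bs Bs)))
          , subst B (solve 3 (λ x r s → let r' = con ½ :* r; s' = con ½ :* s in
                (x :- con 1ℚ) :* (:ℕ 2 :* (r' :* s') :+ s' :* s') := con ½ :* (x :- con 1ℚ) :* (con ½ :* (r :* s :+ s :* r :+ con 1ℚ :* (s :* s)))) refl δ r s)
              (BδB (+-closed (2B (*-closed Br Bs)) (*-closed Bs Bs)))) }
      ; ramified = λ { {r , s} (Br , Bs) Jx² → subst Λ (sym (incl-*ˡ (ι ½) r s)) (Br , Bs ,
          subst B (solve 2 (λ x s → con ½ :* ((x :- con 1ℚ) :* (con ½ :* s)) := con ½ :* (x :- con 1ℚ) :* (con ½ :* s)) refl δ s)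
            -- Write `r = 2 r'` and `s = 2 s'`. Half the first coordinate of `x² / 2` is
            -- `r'² + d s'²`, so `d s'²` is in `B`, and `δ - 1` times it is half the square of
            -- `z = (δ - 1) s'`. As `B/2B` is reduced, `z` is even.
            (ÉtaleOrder.reduced O (BδB Bs) (subst B
              (solve 3 (λ x r s → let s' = con ½ :* s; z = (x :- con 1ℚ) :* s' in
                (x :- con 1ℚ) :* (con ½ :* (con ½ :* (r :* r :+ con ½ :* (x :- con 1ℚ) :* (s :* s))) :- con ½ :* r :* (con ½ :* r)) := con ½ :* (z :* z)) refl δ r s)
              (BδB (minus-closed (proj₁ (subst J (incl-*ˡ (ι ½) (r * r + d * (s * s)) (r * s + s * r + ι 1ℚ * (s * s))) Jx²)) (*-closed Br Br)))))) }
      ; denominators = λ { (r , s) → let l , Br = denominators r ; n , Bs = denominators s in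
          -- The additional factor 2 pays for the denominator of `d`.
          suc (l ℕ.+ n) , subst Λ (sym (π^-incl (suc (l ℕ.+ n)) r s))
            ( denominators-+ (l ℕ.+ n) 1 (denominators-+ʳ l n Br)
            , denominators-+ (l ℕ.+ n) 1 (denominators-+ n l Bs)
            , subst B (solve 3 (λ x u s → (x :- con 1ℚ) :* (u :* s) := con ½ :* (x :- con 1ℚ) :* (:ℕ 2 :* u :* s)) refl δ (ι (ℤ→ℚ (+ 2)) ^ (l ℕ.+ n)) s)
                (BδB (denominators-+ n l Bs))) }
      }
      where
      module TS = T.Solver
      halve = solve 1 (λ x → x := con ½ :* (:ℕ 2 :* x)) refl
      π^-incl : ∀ k r s → π T.^ k T.* (r , s) ≡ (ι (ℤ→ℚ (+ 2)) ^ k * r , ι (ℤ→ℚ (+ 2)) ^ k * s)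
      π^-incl k r s = trans (cong (T._* (r , s)) (sym (_⟶_.^-homo (quadratic-incl L (ι 1ℚ) d) _ k))) (incl-*ˡ _ r s)

-- The unit ball at the prime 3

module _ (R : ℚAlgebra) {P I} (ideal : Subsets.Ideal R P I) where
  open ℚAlgebra R

  module NinthPowers (π-ideal : ∀ {x} → P x → I (ι (ℤ→ℚ (+ 3)) * x)) where
    open Solver
    open Subsets R
    open Ideal ideal
    open Frobenius R three ideal π-ideal public

    Fixed⁹ : Carrier → Set
    Fixed⁹ = Fixed (λ x → (x ^ 3) ^ 3)

    idempotent-fixed : ∀ {x} → P x → I (x * x - x) → Fixed⁹ x
    idempotent-fixed {x} Px x²≈x = fix Px (≈-trans (cube (^-closed Px 3) x⁶≈x³) (cube Px x²≈x))
      where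
      cube : ∀ {y} → P y → I (y * y - y) → I (y ^ 3 - y)
      cube {y} Py y²≈y = subst I (solve 1 (λ y → (y :+ con 1ℚ) :* (y :* y :- y) := y :^ 3 :- y) refl y)
        (*-ideal (+-closed Py (int (+ 1))) y²≈y)
      x⁶≈x³ : I (x ^ 3 * x ^ 3 - x ^ 3)
      x⁶≈x³ = subst I (solve 1 (λ x → x :^ 2 :* (x :^ 2 :+ x :+ con 1ℚ) :* (x :* x :- x) := x :^ 3 :* x :^ 3 :- x :^ 3) refl x)
        (*-ideal (*-closed (^-closed Px 2) (+-closed (+-closed (^-closed Px 2) Px) (int (+ 1)))) x²≈x)

    nilpotent-fixed : ∀ {x} → P x → I x → Fixed⁹ x
    nilpotent-fixed {x} Px Ix = fix Px (minus-ideal (subst I (solve 1 (λ x → x :^ 8 :* x := (x :^ 3) :^ 3) refl x) (*-ideal (^-closed Px 8) Ix)) Ix)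

-- The cubic part is generated by κ with κ³ = M ≡ 1 modulo 9, through τ = κ - 1 and η = (1 + κ + κ²)/3:
-- writing M = 1 + 9 c, we have τ² = 3 η - 3 τ - 3, τ η = 3 c and η² = η + c τ + 3 c.
module Cubic₃ (R : ℚAlgebra) {P : ℚAlgebra.Carrier R → Set} (O : ÉtaleOrder three R P) (c : ℤ) where
  open ℚAlgebra R
  open Solver
  open ÉtaleOrder O
  open Subsets R
  open Subring subring

  private
    C₋₃ C₋₁ Cc : Carrier
    C₋₃ = ι (ℤ→ℚ -[1+ 2 ])
    C₋₁ = ι (ℤ→ℚ -[1+ 0 ])
    Cc  = ι (ℤ→ℚ c)

  open Cubic R C₋₃ C₋₃ C₋₁ Cc public
    renaming (algebra to T; gen₁ to τ; gen₂ to η; gen₁² to τ²; gen₁gen₂ to τη; gen₂² to η²) using (incl; incl-*ˡ)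
  private
    module T = ℚAlgebra T
    module S = Subsets T
    open Integrality T three
    open CubicOrder R C₋₃ C₋₃ C₋₁ Cc
    open CubicÉtale three O {C₋₃} {C₋₃} {C₋₁} {Cc} (int -[1+ 2 ]) (int -[1+ 2 ]) (int -[1+ 0 ]) (int c) using (³-order-subring; ³-denominators)

  incl-hom : R ⟶ T
  incl-hom = cubic-incl R C₋₃ C₋₃ C₋₁ Cc

  -- The coordinate of τ is unrestricted in `J`, because `τ²` is divisible by 3 and so τ has norm at
  -- most 3^(-1/2). Modulo `J` the element η is idempotent, so `Λ/J` consists of two copies of
  -- `P/3P`.
  Λ J : T.Carrier → Set
  Λ = P ³
  J (x , y , z) = P (ι ⅓ * x) × P y × P (ι ⅓ * z)

  Λ-generated : {S : T.Carrier → Set} → (∀ {x y} → S x → S y → S (x T.+ y)) → (∀ {x y} → S x → S y → S (x T.* y)) →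
    (∀ {x} → P x → S (incl x)) → S τ → S η → ∀ {x} → Λ x → S x
  Λ-generated {S} = ³-generated {P} {S}

  J-ideal : S.Ideal Λ J
  J-ideal = record
    { subring = ³-order-subring
    ; +-ideal = λ { {x , y , z} {x' , y' , z'} (a , b , c) (a' , b' , c') →
        subst P (⅓-+ x x') (+-closed a a') , +-closed b b' , subst P (⅓-+ z z') (+-closed c c') }
    ; *-ideal = λ { {x , y , z} {x' , y' , z'} (a , b , c) (a' , b' , c') →
          subst P (solve 7 (λ x y z x' y' z' d →
              x :* (con ⅓ :* x') :- y :* y' :+ d :* (y :* (:ℕ 3 :* (con ⅓ :* z')) :+ z :* y') :+ :ℕ 3 :* (d :* (z :* (con ⅓ :* z'))) :=
              con ⅓ :* (x :* x' :- (con (ℤ→ℚ -[1+ 2 ]) :* con (ℤ→ℚ -[1+ 0 ]) :* (y :* y') :+ (con (ℤ→ℚ -[1+ 2 ]) :* d :* (y :* z' :+ z :* y') :+ con (ℤ→ℚ -[1+ 2 ]) :* d :* (z :* z')))))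
            refl x y z x' y' z' Cc)
            (+-closed (+-closed (minus-closed (*-closed a a') (*-closed b b')) (*-closed Pc (+-closed (*-closed b (3* c')) (*-closed c b'))))
                      (3* (*-closed Pc (*-closed c c'))))
        , +-closed (+-closed (*-closed a b') (*-closed b (triple a'))) (+-closed (*-closed (int -[1+ 2 ]) (*-closed b b')) (*-closed Pc (*-closed c (triple c'))))
        , subst P (solve 6 (λ x y z x' y' z' →
              x :* (con ⅓ :* z') :+ z :* (con ⅓ :* x') :+ y :* y' :+ z :* (con ⅓ :* z') :=
              con ⅓ :* (x :* z' :+ z :* x' :- (con (ℤ→ℚ -[1+ 2 ]) :* (y :* y') :+ con (ℤ→ℚ -[1+ 0 ]) :* (z :* z')))) refl x y z x' y' z')
            (+-closed (+-closed (+-closed (*-closed a c') (*-closed c a')) (*-closed b b')) (*-closed c c')) }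
    }
    where
    Pc = int c
    ⅓-+ = solve 2 (λ x y → con ⅓ :* x :+ con ⅓ :* y := con ⅓ :* (x :+ y)) refl
    3* : ∀ {x} → P x → P (ι (ℤ→ℚ (+ 3)) * x)
    3* = *-closed (int (+ 3))
    triple : ∀ {x} → P (ι ⅓ * x) → P x
    triple {x} p = subst P (solve 1 (λ x → :ℕ 3 :* (con ⅓ :* x) := x) refl x) (3* p)

  private
    third : ∀ {x} → P x → P (ι ⅓ * (ι (ℤ→ℚ (+ 3)) * x))
    third {x} = subst P (solve 1 (λ x → x := con ⅓ :* (:ℕ 3 :* x)) refl x)

    third-0 : P (ι ⅓ * ι 0ℚ)
    third-0 = subst P (solve 0 (con 0ℚ := con ⅓ :* con 0ℚ) refl) (int (+ 0))

  π∈J : ∀ {x} → Λ x → J (π T.* x)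
  π∈J {x , y , z} (Px , Py , Pz) = subst J (sym (incl-*ˡ (ι (ℤ→ℚ (+ 3))) x y z)) (third Px , *-closed (int (+ 3)) Py , third Pz)

  incl∈J : ∀ {x} → P (ι ⅓ * x) → J (incl x)
  incl∈J p = p , int (+ 0) , third-0

  τ∈Λ : Λ τ
  τ∈Λ = int (+ 0) , int (+ 1) , int (+ 0)

  η∈Λ : Λ η
  η∈Λ = int (+ 0) , int (+ 0) , int (+ 1)

  τ∈J : J τ
  τ∈J = third-0 , int (+ 1) , third-0

  η²-η∈J : J (η T.* η T.- η)
  η²-η∈J = subst (λ z → J (z T.- η)) (sym η²)
    ( subst P (solve 1 (λ c → c := con ⅓ :* (:- (con (ℤ→ℚ -[1+ 2 ]) :* c) :- con 0ℚ)) refl Cc) (int c)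
    , minus-closed (int c) (int (+ 0))
    , subst P (solve 0 (con 0ℚ := con ⅓ :* (:- con (ℤ→ℚ -[1+ 0 ]) :- con 1ℚ)) refl) (int (+ 0)))

  private
    3* : ∀ {x} → P x → P (ι (ℤ→ℚ (+ 3)) * x)
    3* = *-closed (int (+ 3))
    sq₁ sq₂ sq₃ : Carrier → Carrier → Carrier → Carrier
    sq₁ x y z = x * x - (C₋₃ * C₋₁ * (y * y) + (C₋₃ * Cc * (y * z + z * y) + C₋₃ * Cc * (z * z)))
    sq₂ x y z = x * y + y * x + (C₋₃ * (y * y) + Cc * (z * z))
    sq₃ x y z = x * z + z * x - (C₋₃ * (y * y) + C₋₁ * (z * z))
    :sq₁ :sq₂ : ∀ {n} → Polynomial n → Polynomial n → Polynomial n → Polynomial n → Polynomial n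
    :sq₁ x y z d = x :* x :- (con (ℤ→ℚ -[1+ 2 ]) :* con (ℤ→ℚ -[1+ 0 ]) :* (y :* y) :+ (con (ℤ→ℚ -[1+ 2 ]) :* d :* (y :* z :+ z :* y) :+ con (ℤ→ℚ -[1+ 2 ]) :* d :* (z :* z)))
    :sq₂ x y z d = x :* y :+ y :* x :+ (con (ℤ→ℚ -[1+ 2 ]) :* (y :* y) :+ d :* (z :* z))
    :sq₃ : ∀ {n} → Polynomial n → Polynomial n → Polynomial n → Polynomial n
    :sq₃ x y z = x :* z :+ z :* x :- (con (ℤ→ℚ -[1+ 2 ]) :* (y :* y) :+ con (ℤ→ℚ -[1+ 0 ]) :* (z :* z))

    module F = NinthPowers T J-ideal π∈J

    incl-fixed : ∀ {x} → P x → F.Fixed⁹ (incl x)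
    incl-fixed {x} Px = F.fix (Px , int (+ 0) , int (+ 0)) (subst J (sym (incl-F x)) (incl∈J (étale Px)))
      where
      incl-F : ∀ x → ((incl x T.^ 3) T.^ 3) T.- incl x ≡ incl ((x ^ 3) ^ 3 - x)
      incl-F x = sym (trans (+-homo _ _) (cong₂ T._+_ (trans (^-homo (x ^ 3) 3) (cong (T._^ 3) (^-homo x 3))) (neg-homo x)))
        where open _⟶_ (cubic-incl R C₋₃ C₋₃ C₋₁ Cc)

    Λ-fixed : ∀ {x} → Λ x → F.Fixed⁹ x
    Λ-fixed = ³-generated {P} {F.Fixed⁹} (F.fixed-+ F.frobenius²) (F.fixed-* F.frobenius²)
                incl-fixed (F.nilpotent-fixed τ∈Λ τ∈J) (F.idempotent-fixed η∈Λ η²-η∈J)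

    J-square : ∀ {x} → J x → Λ (π⁻¹ T.* (x T.* x))
    J-square {x , y , z} (Px , Py , Pz) = subst Λ (sym (incl-*ˡ (ι ⅓) (sq₁ x y z) (sq₂ x y z) (sq₃ x y z)))
          ( subst P (solve 4 (λ x y z d → let x' = con ⅓ :* x; z' = con ⅓ :* z; 3' = :ℕ 3 in
                3' :* (x' :* x') :- y :* y :+ :ℕ 6 :* (d :* (y :* z')) :+ :ℕ 9 :* (d :* (z' :* z')) :=
                con ⅓ :* :sq₁ x y z d) refl x y z Cc)
              (+-closed (+-closed (minus-closed (3* (*-closed Px Px)) (*-closed Py Py)) (*-closed (int (+ 6)) (*-closed (int c) (*-closed Py Pz))))
                        (*-closed (int (+ 9)) (*-closed (int c) (*-closed Pz Pz))))
          , subst P (solve 4 (λ x y z d → let x' = con ⅓ :* x; z' = con ⅓ :* z; 3' = :ℕ 3 in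
                :ℕ 2 :* (x' :* y) :- y :* y :+ 3' :* (d :* (z' :* z')) := con ⅓ :* :sq₂ x y z d) refl x y z Cc)
              (+-closed (minus-closed (*-closed (int (+ 2)) (*-closed Px Py)) (*-closed Py Py)) (3* (*-closed (int c) (*-closed Pz Pz))))
          , subst P (solve 3 (λ x y z → let x' = con ⅓ :* x; z' = con ⅓ :* z; 3' = :ℕ 3 in
                :ℕ 6 :* (x' :* z') :+ y :* y :+ 3' :* (z' :* z') := con ⅓ :* :sq₃ x y z) refl x y z)
              (+-closed (+-closed (*-closed (int (+ 6)) (*-closed Px Pz)) (*-closed Py Py)) (3* (*-closed Pz Pz))))

    J-ramified : ∀ {x} → J x → J (π⁻¹ T.* (x T.* x)) → Λ (π⁻¹ T.* x)
    J-ramified {x , y , z} (Px , Py , Pz) Jx² = subst Λ (sym (incl-*ˡ (ι ⅓) x y z)) (Px ,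
          -- The constant coordinate of `x² / 9` differs from `- y² / 3` by an element of `P`, so 3
          -- divides `y²` and therefore `y`.
          ÉtaleOrder.reduced O Py (subst P (solve 4 (λ x y z d → let x' = con ⅓ :* x; z' = con ⅓ :* z; 3' = :ℕ 3 in
                x' :* x' :+ :ℕ 2 :* (d :* (y :* z')) :+ 3' :* (d :* (z' :* z')) :- con ⅓ :* (con ⅓ :* :sq₁ x y z d) := con ⅓ :* (y :* y)) refl x y z Cc)
              (minus-closed (+-closed (+-closed (*-closed Px Px) (*-closed (int (+ 2)) (*-closed (int c) (*-closed Py Pz)))) (3* (*-closed (int c) (*-closed Pz Pz))))
                (proj₁ (subst J (incl-*ˡ (ι ⅓) (sq₁ x y z) (sq₂ x y z) (sq₃ x y z)) Jx²)))) , Pz)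

  unit-ball : IsUnitBall Λ J
  unit-ball = record
    { ideal        = J-ideal
    ; π-ideal      = π∈J
    ; reduced      = λ Λx → F.Fixed.fixed (Λ-fixed Λx)
    ; square       = J-square
    ; ramified     = J-ramified
    ; denominators = ³-denominators
    }

-- Explicit integral elements of K

α²-vector ½[1+α⁶]-vector : K
α²-vector = 0ℚ ∷ 0ℚ ∷ 1ℚ ∷ 0ℚ ∷ 0ℚ ∷ 0ℚ ∷ 0ℚ ∷ 0ℚ ∷ 0ℚ ∷ 0ℚ ∷ 0ℚ ∷ 0ℚ ∷ []
½[1+α⁶]-vector = ½ ∷ 0ℚ ∷ 0ℚ ∷ 0ℚ ∷ 0ℚ ∷ 0ℚ ∷ ½ ∷ 0ℚ ∷ 0ℚ ∷ 0ℚ ∷ 0ℚ ∷ 0ℚ ∷ []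

α³-vector : K
α³-vector = 0ℚ ∷ 0ℚ ∷ 0ℚ ∷ 1ℚ ∷ 0ℚ ∷ 0ℚ ∷ 0ℚ ∷ 0ℚ ∷ 0ℚ ∷ 0ℚ ∷ 0ℚ ∷ 0ℚ ∷ []

⅓[1+σα⁴+α⁸]-vector : ℤ → K
⅓[1+σα⁴+α⁸]-vector σ = ⅓ ∷ 0ℚ ∷ 0ℚ ∷ 0ℚ ∷ ℤ→ℚ σ ℚ.* ⅓ ∷ 0ℚ ∷ 0ℚ ∷ 0ℚ ∷ ⅓ ∷ 0ℚ ∷ 0ℚ ∷ 0ℚ ∷ []

-- The monic equations are verified by running `evalℤ` on coordinates. These stay in a small span:
-- single powers of α, then 1 and α⁶, then 1, α⁴ and α⁸.
module IntegralVectors (m : ℤ) where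
  private
    A : K → K
    A = mulα m
    M = ℤ→ℚ m

    scale-0 : ∀ {n} (x : Vec ℚ n) → Vec.map (0ℚ ℚ.*_) x ≡ replicate n 0ℚ
    scale-0 []      = refl
    scale-0 (x ∷ v) = cong₂ _∷_ (ℚP.*-zeroˡ x) (scale-0 v)

    scale-1 : ∀ {n} (x : Vec ℚ n) → Vec.map (1ℚ ℚ.*_) x ≡ x
    scale-1 []      = refl
    scale-1 (x ∷ v) = cong₂ _∷_ (ℚP.*-identityˡ x) (scale-1 v)

    add-0ˡ : ∀ {n} (x : Vec ℚ n) → Vec.zipWith ℚ._+_ (replicate n 0ℚ) x ≡ x
    add-0ˡ []      = refl
    add-0ˡ (x ∷ v) = cong₂ _∷_ (ℚP.+-identityˡ x) (add-0ˡ v)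

    add-0ʳ : ∀ {n} (x : Vec ℚ n) → Vec.zipWith ℚ._+_ x (replicate n 0ℚ) ≡ x
    add-0ʳ []      = refl
    add-0ʳ (x ∷ v) = cong₂ _∷_ (ℚP.+-identityʳ x) (add-0ʳ v)

    shift : ∀ x → last x ≡ 0ℚ → A x ≡ 0ℚ ∷ init x
    shift x eq = cong (_∷ init x) (trans (cong (M ℚ.*_) eq) (ℚP.*-zeroʳ M))

    hornerMul-0∷ : ∀ cs x → hornerMul m (0ℚ ∷ cs) x ≡ A (hornerMul m cs x)
    hornerMul-0∷ cs x = trans (cong (λ z → addK z (A (hornerMul m cs x))) (scale-0 x)) (add-0ˡ (A (hornerMul m cs x)))

    hornerMul-0s : ∀ n x → hornerMul m (toList (replicate n 0ℚ)) x ≡ 0K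
    hornerMul-0s zero    x = refl
    hornerMul-0s (suc n) x = trans (hornerMul-0∷ (toList (replicate n 0ℚ)) x)
      (trans (cong A (hornerMul-0s n x)) (shift 0K refl))

    hornerMul-last : ∀ c n x → hornerMul m (c ∷ toList (replicate n 0ℚ)) x ≡ scaleK c x
    hornerMul-last c n x = trans (cong (λ z → addK (scaleK c x) (A z)) (hornerMul-0s n x))
      (trans (cong (addK (scaleK c x)) (shift 0K refl)) (add-0ʳ (scaleK c x)))

    iterate : ℕ → K → K
    iterate zero    x = x
    iterate (suc n) x = A (iterate n x)

    hornerMul-gap : ∀ n cs x → hornerMul m (toList (replicate n 0ℚ) ++ cs) x ≡ iterate n (hornerMul m cs x)
    hornerMul-gap zero    cs x = refl
    hornerMul-gap (suc n) cs x = trans (hornerMul-0∷ (toList (replicate n 0ℚ) ++ cs) x) (cong A (hornerMul-gap n cs x))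

    monomial : ∀ i j x → hornerMul m (toList (replicate i 0ℚ) ++ 1ℚ ∷ toList (replicate j 0ℚ)) x ≡ iterate i x
    monomial i j x = trans (hornerMul-gap i (1ℚ ∷ toList (replicate j 0ℚ)) x) (cong (iterate i) (trans (hornerMul-last 1ℚ j x) (scale-1 x)))

    iterate-+ : ∀ i j x → iterate i (iterate j x) ≡ iterate (i ℕ.+ j) x
    iterate-+ zero    j x = refl
    iterate-+ (suc i) j x = cong A (iterate-+ i j x)

    iterate-0K : ∀ i → iterate i 0K ≡ 0K
    iterate-0K zero    = refl
    iterate-0K (suc i) = trans (cong A (iterate-0K i)) (shift 0K refl)

    unit : ℕ → K
    unit zero    = embed 1ℚ
    unit (suc i) = 0ℚ ∷ init (unit i)

    -- The first eleven multiplications by α only move the coordinate 1 along; the factor `m`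
    -- appears with the twelfth.
    iterate-11 : iterate 11 (embed 1ℚ) ≡ unit 11
    iterate-11 = go 10 (go 9 (go 8 (go 7 (go 6 (go 5 (go 4 (go 3 (go 2 (go 1 (go 0 refl refl) refl) refl) refl) refl) refl) refl) refl) refl) refl) refl
      where
      go : ∀ i → iterate i (embed 1ℚ) ≡ unit i → last (unit i) ≡ 0ℚ → iterate (suc i) (embed 1ℚ) ≡ unit (suc i)
      go i eq last≡0 = trans (cong A eq) (shift (unit i) last≡0)

    -- This is the case `v = α^j`, a root of `X^(n+1) - m` because `j (n + 1) = 12`.
    module Power (v : K) (j n : ℕ) (j+nj≡12 : j ℕ.+ n ℕ.* j ≡ 12) (mul-v : ∀ x → mulK m v x ≡ iterate j x) where

      tail-value : ∀ n → evalℤ m (List.replicate n (+ 0) ++ [ + 1 ]) v ≡ iterate (n ℕ.* j) (embed 1ℚ)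
      tail-value zero    = trans (cong (addK (embed 1ℚ)) (trans (mul-v 0K) (iterate-0K j))) (add-0ʳ (embed 1ℚ))
      tail-value (suc n) = trans (add-0ˡ _) (trans (mul-v _) (trans (cong (iterate j) (tail-value n)) (iterate-+ j (n ℕ.* j) (embed 1ℚ))))

      integral : InZK m v
      integral = ℤ.- m ∷ List.replicate n (+ 0) , (begin
        addK (embed (ℤ→ℚ (ℤ.- m))) (mulK m v (evalℤ m (List.replicate n (+ 0) ++ [ + 1 ]) v)) ≡⟨ cong (addK _) (trans (mul-v _) (trans (cong (iterate j) (tail-value n)) (iterate-+ j (n ℕ.* j) (embed 1ℚ)))) ⟩
        addK (embed (ℤ→ℚ (ℤ.- m))) (iterate (j ℕ.+ n ℕ.* j) (embed 1ℚ)) ≡⟨ cong (λ i → addK (embed (ℤ→ℚ (ℤ.- m))) (iterate i (embed 1ℚ))) j+nj≡12 ⟩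
        addK (embed (ℤ→ℚ (ℤ.- m))) (A (iterate 11 (embed 1ℚ))) ≡⟨ cong (λ x → addK (embed (ℤ→ℚ (ℤ.- m))) (A x)) iterate-11 ⟩
        (ℤ→ℚ (ℤ.- m) ℚ.+ M ℚ.* 1ℚ) ∷ replicate 11 0ℚ ≡⟨ cong (_∷ replicate 11 0ℚ) (trans (cong₂ ℚ._+_ (ℤ→ℚ-neg m) (ℚP.*-identityʳ M)) (ℚP.+-inverseˡ M)) ⟩
        0K ∎)
        where open ≡-Reasoning

  α²-integral : InZK m α²-vector
  α²-integral = Power.integral α²-vector 2 5 refl (monomial 2 9)

  α³-integral : InZK m α³-vector
  α³-integral = Power.integral α³-vector 3 3 refl (monomial 3 8)

  private
    E : ℚ → ℚ → K
    E a b = a ∷ 0ℚ ∷ 0ℚ ∷ 0ℚ ∷ 0ℚ ∷ 0ℚ ∷ b ∷ 0ℚ ∷ 0ℚ ∷ 0ℚ ∷ 0ℚ ∷ 0ℚ ∷ []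

    F : ℚ → ℚ → ℚ → K
    F a b c = a ∷ 0ℚ ∷ 0ℚ ∷ 0ℚ ∷ b ∷ 0ℚ ∷ 0ℚ ∷ 0ℚ ∷ c ∷ 0ℚ ∷ 0ℚ ∷ 0ℚ ∷ []

    module ℚS = ℚAlgebra.Solver rationals
    open ℚS using (_:+_; _:*_; :-_; _:=_; _:-_; con; :ℕ; solve)

    mul-E : ∀ a b → mulK m ½[1+α⁶]-vector (E a b) ≡ E (½ ℚ.* a ℚ.+ M ℚ.* (½ ℚ.* b)) (½ ℚ.* b ℚ.+ ½ ℚ.* a)
    mul-E a b = trans
      (cong (λ x → addK (scaleK ½ (E a b)) (A x)) (trans (hornerMul-gap 5 (½ ∷ toList (replicate 5 0ℚ)) (E a b)) (cong (iterate 5) (hornerMul-last ½ 5 (E a b)))))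
      (cong (½ ℚ.* a ℚ.+ M ℚ.* (½ ℚ.* b) ∷_) (z (z (z (z (z refl))))))
      where
      z : ∀ {n} {u v : Vec ℚ n} → u ≡ v → (0ℚ ℚ.+ M ℚ.* 0ℚ) ∷ u ≡ 0ℚ ∷ v
      z = cong₂ _∷_ (solve 1 (λ m → con 0ℚ :+ m :* con 0ℚ := con 0ℚ) refl M)

    add-E : ∀ c a b → addK (embed c) (E a b) ≡ E (c ℚ.+ a) b
    add-E c a b = cong (E (c ℚ.+ a)) (ℚP.+-identityˡ b)

    step-E : ∀ c cs a b a' b' → evalℤ m cs ½[1+α⁶]-vector ≡ E a b → ℤ→ℚ c ℚ.+ (½ ℚ.* a ℚ.+ M ℚ.* (½ ℚ.* b)) ≡ a' → ½ ℚ.* b ℚ.+ ½ ℚ.* a ≡ b' →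
      evalℤ m (c ∷ cs) ½[1+α⁶]-vector ≡ E a' b'
    step-E c cs a b a' b' x≡ a≡ b≡ = trans (cong (λ x → addK (embed (ℤ→ℚ c)) (mulK m ½[1+α⁶]-vector x)) x≡)
      (trans (cong (addK (embed (ℤ→ℚ c))) (mul-E a b))
      (trans (add-E (ℤ→ℚ c) (½ ℚ.* a ℚ.+ M ℚ.* (½ ℚ.* b)) (½ ℚ.* b ℚ.+ ½ ℚ.* a)) (cong₂ E a≡ b≡)))

  ½[1+α⁶]-integral : ∀ k → m ≡ + 1 ℤ.+ + 4 ℤ.* k → InZK m ½[1+α⁶]-vector
  -- The polynomial is `X² - X - k`, of discriminant `1 + 4 k = m`.
  ½[1+α⁶]-integral k m≡ = ℤ.- k ∷ -[1+ 0 ] ∷ [] ,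
      step-E (ℤ.- k) (-[1+ 0 ] ∷ + 1 ∷ []) (ℚ.- ½) ½ 0ℚ 0ℚ
        (step-E -[1+ 0 ] (+ 1 ∷ []) 1ℚ 0ℚ (ℚ.- ½) ½
          (step-E (+ 1) [] 0ℚ 0ℚ 1ℚ 0ℚ refl (solve 1 (λ m → con 1ℚ :+ (con ½ :* con 0ℚ :+ m :* (con ½ :* con 0ℚ)) := con 1ℚ) refl M) refl)
          (solve 1 (λ m → con (ℤ→ℚ -[1+ 0 ]) :+ (con ½ :* con 1ℚ :+ m :* (con ½ :* con 0ℚ)) := con (ℚ.- ½)) refl M) refl)
        (trans (cong₂ (λ k' m' → k' ℚ.+ (½ ℚ.* (ℚ.- ½) ℚ.+ m' ℚ.* (½ ℚ.* ½))) (ℤ→ℚ-neg k) M≡)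
          (solve 1 (λ k → :- k :+ (con ½ :* con (ℚ.- ½) :+ (con 1ℚ :+ :ℕ 4 :* k) :* (con ½ :* con ½)) := con 0ℚ) refl (ℤ→ℚ k)))
        refl
    where
    M≡ : M ≡ 1ℚ ℚ.+ ℤ→ℚ (+ 4) ℚ.* ℤ→ℚ k
    M≡ = trans (cong ℤ→ℚ m≡) (ι-1+n*k rationals 4 k)

  module _ (σ : ℤ) where
    private
      s = ℤ→ℚ σ ℚ.* ⅓
      v = ⅓[1+σα⁴+α⁸]-vector σ

      mul-F : ∀ a b c → mulK m v (F a b c) ≡
        F (⅓ ℚ.* a ℚ.+ M ℚ.* (s ℚ.* c ℚ.+ ⅓ ℚ.* b)) (⅓ ℚ.* b ℚ.+ (s ℚ.* a ℚ.+ M ℚ.* (⅓ ℚ.* c))) (⅓ ℚ.* c ℚ.+ (s ℚ.* b ℚ.+ ⅓ ℚ.* a))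
      mul-F a b c = trans
        (cong (λ x → addK (scaleK ⅓ (F a b c)) (A x)) (trans (hornerMul-gap 3 (s ∷ toList (replicate 3 0ℚ) ++ ⅓ ∷ toList (replicate 3 0ℚ)) (F a b c))
          (cong (λ x → iterate 3 (addK (scaleK s (F a b c)) (A x))) (trans (hornerMul-gap 3 (⅓ ∷ toList (replicate 3 0ℚ)) (F a b c))
            (cong (iterate 3) (hornerMul-last ⅓ 3 (F a b c)))))))
        (cong (⅓ ℚ.* a ℚ.+ M ℚ.* (s ℚ.* c ℚ.+ ⅓ ℚ.* b) ∷_) (z₁ (z₁ (z₁
          (cong (⅓ ℚ.* b ℚ.+ (s ℚ.* a ℚ.+ M ℚ.* (⅓ ℚ.* c)) ∷_) (z₂ (z₂ (z₂
            (cong (⅓ ℚ.* c ℚ.+ (s ℚ.* b ℚ.+ ⅓ ℚ.* a) ∷_) (z₃ (z₃ (z₃ refl))))))))))))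
        where
        z₁ : ∀ {n} {u v : Vec ℚ n} → u ≡ v → (0ℚ ℚ.+ M ℚ.* (s ℚ.* 0ℚ ℚ.+ 0ℚ)) ∷ u ≡ 0ℚ ∷ v
        z₁ = cong₂ _∷_ (solve 2 (λ m s → con 0ℚ :+ m :* (s :* con 0ℚ :+ con 0ℚ) := con 0ℚ) refl M s)
        z₂ : ∀ {n} {u v : Vec ℚ n} → u ≡ v → (0ℚ ℚ.+ (s ℚ.* 0ℚ ℚ.+ M ℚ.* 0ℚ)) ∷ u ≡ 0ℚ ∷ v
        z₂ = cong₂ _∷_ (solve 2 (λ m s → con 0ℚ :+ (s :* con 0ℚ :+ m :* con 0ℚ) := con 0ℚ) refl M s)
        z₃ : ∀ {n} {u v : Vec ℚ n} → u ≡ v → (0ℚ ℚ.+ (s ℚ.* 0ℚ ℚ.+ 0ℚ)) ∷ u ≡ 0ℚ ∷ v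
        z₃ = cong₂ _∷_ (solve 1 (λ s → con 0ℚ :+ (s :* con 0ℚ :+ con 0ℚ) := con 0ℚ) refl s)

      add-F : ∀ d a b c → addK (embed d) (F a b c) ≡ F (d ℚ.+ a) b c
      add-F d a b c = cong₂ (F (d ℚ.+ a)) (ℚP.+-identityˡ b) (ℚP.+-identityˡ c)

      F-cong : ∀ {a a' b b' c c'} → a ≡ a' → b ≡ b' → c ≡ c' → F a b c ≡ F a' b' c'
      F-cong refl refl refl = refl

      step-F : ∀ d ds a b c a' b' c' → evalℤ m ds v ≡ F a b c →
        ℤ→ℚ d ℚ.+ (⅓ ℚ.* a ℚ.+ M ℚ.* (s ℚ.* c ℚ.+ ⅓ ℚ.* b)) ≡ a' → ⅓ ℚ.* b ℚ.+ (s ℚ.* a ℚ.+ M ℚ.* (⅓ ℚ.* c)) ≡ b' →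
        ⅓ ℚ.* c ℚ.+ (s ℚ.* b ℚ.+ ⅓ ℚ.* a) ≡ c' → evalℤ m (d ∷ ds) v ≡ F a' b' c'
      step-F d ds a b c a' b' c' x≡ a≡ b≡ c≡ = trans (cong (λ x → addK (embed (ℤ→ℚ d)) (mulK m v x)) x≡)
        (trans (cong (addK (embed (ℤ→ℚ d))) (mul-F a b c))
        (trans (add-F (ℤ→ℚ d) _ _ _) (F-cong a≡ b≡ c≡)))

    ⅓[1+σα⁴+α⁸]-integral : ∀ c → σ ℤ.* σ ≡ + 1 → m ≡ σ ℤ.* (+ 1 ℤ.+ + 9 ℤ.* c) → InZK m v
    -- The polynomial is `X³ - X² - 3 c X - 3 c²`. For `κ = σ α⁴` the vector is
    -- `η = (1 + κ + κ²)/3`, and multiplying `η² = η + c τ + 3 c` by η, with `τ η = 3 c`, gives this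
    -- equation.
    ⅓[1+σα⁴+α⁸]-integral c σ² m≡ = d₀ ∷ d₁ ∷ -[1+ 0 ] ∷ [] ,
        step-F d₀ (d₁ ∷ -[1+ 0 ] ∷ + 1 ∷ []) (ℚ.- ℤ→ℚ c) (ℤ→ℚ σ ℚ.* ℤ→ℚ c) 0ℚ 0ℚ 0ℚ 0ℚ
          (step-F d₁ (-[1+ 0 ] ∷ + 1 ∷ []) a₁ s ⅓ (ℚ.- ℤ→ℚ c) (ℤ→ℚ σ ℚ.* ℤ→ℚ c) 0ℚ
            (step-F -[1+ 0 ] (+ 1 ∷ []) 1ℚ 0ℚ 0ℚ a₁ s ⅓
              (step-F (+ 1) [] 0ℚ 0ℚ 0ℚ 1ℚ 0ℚ 0ℚ refl
                (solve 2 (λ m s → con 1ℚ :+ (con ⅓ :* con 0ℚ :+ m :* (s :* con 0ℚ :+ con ⅓ :* con 0ℚ)) := con 1ℚ) refl M s)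
                (solve 2 (λ m s → con ⅓ :* con 0ℚ :+ (s :* con 0ℚ :+ m :* (con ⅓ :* con 0ℚ)) := con 0ℚ) refl M s)
                (solve 1 (λ s → con ⅓ :* con 0ℚ :+ (s :* con 0ℚ :+ con ⅓ :* con 0ℚ) := con 0ℚ) refl s))
              (solve 2 (λ m s → con (ℤ→ℚ -[1+ 0 ]) :+ (con ⅓ :* con 1ℚ :+ m :* (s :* con 0ℚ :+ con ⅓ :* con 0ℚ)) := con (ℚ.- (+ 2 ℚ./ 3))) refl M s)
              (solve 2 (λ m s → con ⅓ :* con 0ℚ :+ (s :* con 1ℚ :+ m :* (con ⅓ :* con 0ℚ)) := s) refl M s)
              (solve 1 (λ s → con ⅓ :* con 0ℚ :+ (s :* con 0ℚ :+ con ⅓ :* con 1ℚ) := con ⅓) refl s))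
            (trans (cong₂ (λ d m → d ℚ.+ (⅓ ℚ.* a₁ ℚ.+ m ℚ.* (s ℚ.* ⅓ ℚ.+ ⅓ ℚ.* s))) d₁≡ M≡)
              (modulo-σ² (solve 2 (λ s c → :- (:ℕ 3 :* c) :+ (con ⅓ :* con a₁ :+ :M s c :* (s :* con ⅓ :* con ⅓ :+ con ⅓ :* (s :* con ⅓)))
                := :- c :+ (s :* s :- con 1ℚ) :* (con (+ 2 ℚ./ 9) :* (con 1ℚ :+ :ℕ 9 :* c))) refl S C)))
            (trans (cong (λ m → ⅓ ℚ.* s ℚ.+ (s ℚ.* a₁ ℚ.+ m ℚ.* (⅓ ℚ.* ⅓))) M≡)
              (solve 2 (λ s c → con ⅓ :* (s :* con ⅓) :+ (s :* con ⅓ :* con a₁ :+ :M s c :* (con ⅓ :* con ⅓)) := s :* c) refl S C))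
            (modulo-σ² (solve 1 (λ s → con ⅓ :* con ⅓ :+ (s :* con ⅓ :* (s :* con ⅓) :+ con ⅓ :* con a₁) := con 0ℚ :+ (s :* s :- con 1ℚ) :* con (+ 1 ℚ./ 9)) refl S)))
          (trans (cong₂ (λ d m → d ℚ.+ (⅓ ℚ.* (ℚ.- C) ℚ.+ m ℚ.* (s ℚ.* 0ℚ ℚ.+ ⅓ ℚ.* (S ℚ.* C)))) d₀≡ M≡)
            (modulo-σ² (solve 2 (λ s c → :- (:ℕ 3 :* (c :* c)) :+ (con ⅓ :* (:- c) :+ :M s c :* (s :* con ⅓ :* con 0ℚ :+ con ⅓ :* (s :* c)))
              := con 0ℚ :+ (s :* s :- con 1ℚ) :* (con ⅓ :* (con 1ℚ :+ :ℕ 9 :* c) :* c)) refl S C)))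
          (solve 3 (λ s c m → con ⅓ :* (s :* c) :+ (s :* con ⅓ :* (:- c) :+ m :* (con ⅓ :* con 0ℚ)) := con 0ℚ) refl S C M)
          (modulo-σ² (solve 2 (λ s c → con ⅓ :* con 0ℚ :+ (s :* con ⅓ :* (s :* c) :+ con ⅓ :* (:- c)) := con 0ℚ :+ (s :* s :- con 1ℚ) :* (con ⅓ :* c)) refl S C))
      where
      d₀ d₁ : ℤ
      d₀ = ℤ.- (+ 3 ℤ.* (c ℤ.* c))
      d₁ = ℤ.- (+ 3 ℤ.* c)
      S C a₁ : ℚ
      S = ℤ→ℚ σ
      C = ℤ→ℚ c
      a₁ = ℚ.- (+ 2 ℚ./ 3)
      :M : ∀ {n} → ℚS.Polynomial n → ℚS.Polynomial n → ℚS.Polynomial n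
      :M s c = s :* (con 1ℚ :+ :ℕ 9 :* c)
      M≡ : M ≡ S ℚ.* (1ℚ ℚ.+ ℤ→ℚ (+ 9) ℚ.* C)
      M≡ = trans (cong ℤ→ℚ m≡) (trans (ℤ→ℚ-* σ (+ 1 ℤ.+ + 9 ℤ.* c))
        (cong (S ℚ.*_) (ι-1+n*k rationals 9 c)))
      d₁≡ : ℤ→ℚ d₁ ≡ ℚ.- (ℤ→ℚ (+ 3) ℚ.* C)
      d₁≡ = trans (ℤ→ℚ-neg (+ 3 ℤ.* c)) (cong ℚ.-_ (ℤ→ℚ-* (+ 3) c))
      d₀≡ : ℤ→ℚ d₀ ≡ ℚ.- (ℤ→ℚ (+ 3) ℚ.* (C ℚ.* C))
      d₀≡ = trans (ℤ→ℚ-neg (+ 3 ℤ.* (c ℤ.* c))) (cong ℚ.-_ (trans (ℤ→ℚ-* (+ 3) (c ℤ.* c)) (cong (ℤ→ℚ (+ 3) ℚ.*_) (ℤ→ℚ-* c c))))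
      -- The solver proves polynomial identities only, so wherever σ² = 1 enters, the cofactor of
      -- `σ² - 1` is given explicitly.
      modulo-σ² : ∀ {x y q} → x ≡ y ℚ.+ (S ℚ.* S ℚ.+ ℚ.- 1ℚ) ℚ.* q → x ≡ y
      modulo-σ² {x} {y} {q} x≡ = trans x≡ (trans (cong (λ z → y ℚ.+ (z ℚ.+ ℚ.- 1ℚ) ℚ.* q) (trans (sym (ℤ→ℚ-* σ σ)) (cong ℤ→ℚ σ²)))
        (solve 2 (λ y q → y :+ (con 1ℚ :+ :- con 1ℚ) :* q := y) refl y q))

-- The case m ≡ 1 modulo 4

module SparseValues (R : ℚAlgebra) (α : ℚAlgebra.Carrier R) where
  open ℚAlgebra R
  open Solver
  open Evaluation R

  value-α² : horner ι (toList α²-vector) α ≡ α * α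
  value-α² = solve 1 (λ a → let 0+ = λ x → con 0ℚ :+ a :* x; 0⁹ = 0+ (0+ (0+ (0+ (0+ (0+ (0+ (0+ (0+ (con 0ℚ))))))))) in
    0+ (0+ (con 1ℚ :+ a :* 0⁹)) := a :* a) refl α

  value-½[1+α⁶] : horner ι (toList ½[1+α⁶]-vector) α ≡ ι ½ * (ι 1ℚ + α ^ 6)
  value-½[1+α⁶] = solve 1 (λ a → let 0+ = λ x → con 0ℚ :+ a :* x; 0⁵ = 0+ (0+ (0+ (0+ (0+ (con 0ℚ))))) in
    con ½ :+ a :* 0+ (0+ (0+ (0+ (0+ (con ½ :+ a :* 0⁵))))) := con ½ :* (con 1ℚ :+ a :^ 6)) refl α

module _ (R : ℚAlgebra) (k : ℤ) (u : ℚ) (um : u ℚ.* ℤ→ℚ (+ 1 ℤ.+ + 4 ℤ.* k) ≡ 1ℚ) where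
  open ℚAlgebra R

  module TwelfthRoot₂ {y γ δ : Carrier} (y² : y * y ≡ ι 1ℚ * y + ι ½ * (δ - ι 1ℚ))
      (γ³ : γ * (γ * γ) ≡ ι (ℤ→ℚ (+ 2)) * δ - ι 1ℚ) (δ² : δ * δ ≡ δ + ι (ℤ→ℚ k)) where
    open Solver
    open ≡-Reasoning

    private
      m = + 1 ℤ.+ + 4 ℤ.* k
      2' = ι (ℤ→ℚ (+ 2))
      M = ι (ℤ→ℚ m)
      U = ι u

      UM : U * M ≡ ι 1ℚ
      UM = trans (sym (ι-* u (ℤ→ℚ m))) (cong ι um)

      M≡ : M ≡ ι 1ℚ + ι (ℤ→ℚ (+ 4)) * ι (ℤ→ℚ k)
      M≡ = ι-1+n*k R 4 k

    -- γ = α² and β = α³, whence α = β / γ = β γ⁵ / m.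
    β α : Carrier
    β = 2' * y - ι 1ℚ
    α = U * (β * γ ^ 5)

    γ⁶ : γ * (γ * γ) * (γ * (γ * γ)) ≡ M
    γ⁶ = begin
      γ * (γ * γ) * (γ * (γ * γ)) ≡⟨ cong (λ z → z * z) γ³ ⟩
      (2' * δ - ι 1ℚ) * (2' * δ - ι 1ℚ) ≡⟨ solve 1 (λ x → let 2' = :ℕ 2 in (2' :* x :- con 1ℚ) :* (2' :* x :- con 1ℚ) := :ℕ 4 :* (x :* x) :- :ℕ 4 :* x :+ con 1ℚ) refl δ ⟩
      ι (ℤ→ℚ (+ 4)) * (δ * δ) - ι (ℤ→ℚ (+ 4)) * δ + ι 1ℚ ≡⟨ cong (λ z → ι (ℤ→ℚ (+ 4)) * z - ι (ℤ→ℚ (+ 4)) * δ + ι 1ℚ) δ² ⟩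
      ι (ℤ→ℚ (+ 4)) * (δ + ι (ℤ→ℚ k)) - ι (ℤ→ℚ (+ 4)) * δ + ι 1ℚ ≡⟨ solve 2 (λ x k → :ℕ 4 :* (x :+ k) :- :ℕ 4 :* x :+ con 1ℚ := con 1ℚ :+ :ℕ 4 :* k) refl δ (ι (ℤ→ℚ k)) ⟩
      ι 1ℚ + ι (ℤ→ℚ (+ 4)) * ι (ℤ→ℚ k) ≡⟨ M≡ ⟨
      M ∎

    β² : β * β ≡ γ * (γ * γ)
    β² = begin
      β * β ≡⟨ solve 1 (λ y → let 2' = :ℕ 2 in (2' :* y :- con 1ℚ) :* (2' :* y :- con 1ℚ) := :ℕ 4 :* (y :* y) :- :ℕ 4 :* y :+ con 1ℚ) refl y ⟩
      ι (ℤ→ℚ (+ 4)) * (y * y) - ι (ℤ→ℚ (+ 4)) * y + ι 1ℚ ≡⟨ cong (λ z → ι (ℤ→ℚ (+ 4)) * z - ι (ℤ→ℚ (+ 4)) * y + ι 1ℚ) y² ⟩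
      ι (ℤ→ℚ (+ 4)) * (ι 1ℚ * y + ι ½ * (δ - ι 1ℚ)) - ι (ℤ→ℚ (+ 4)) * y + ι 1ℚ ≡⟨ solve 2 (λ y x → :ℕ 4 :* (con 1ℚ :* y :+ con ½ :* (x :- con 1ℚ)) :- :ℕ 4 :* y :+ con 1ℚ := :ℕ 2 :* x :- con 1ℚ) refl y δ ⟩
      2' * δ - ι 1ℚ ≡⟨ γ³ ⟨
      γ * (γ * γ) ∎

    α² : α * α ≡ γ
    α² = begin
      α * α ≡⟨ solve 3 (λ u b g → u :* (b :* g :^ 5) :* (u :* (b :* g :^ 5)) := u :* u :* (b :* b) :* g :^ 10) refl U β γ ⟩
      U * U * (β * β) * γ ^ 10 ≡⟨ cong (λ z → U * U * z * γ ^ 10) β² ⟩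
      U * U * (γ * (γ * γ)) * γ ^ 10 ≡⟨ solve 2 (λ u g → let g6 = g :* (g :* g) :* (g :* (g :* g)) in u :* u :* (g :* (g :* g)) :* g :^ 10 := u :* g6 :* (u :* g6) :* g) refl U γ ⟩
      U * (γ * (γ * γ) * (γ * (γ * γ))) * (U * (γ * (γ * γ) * (γ * (γ * γ)))) * γ ≡⟨ cong (λ z → U * z * (U * z) * γ) γ⁶ ⟩
      U * M * (U * M) * γ ≡⟨ cong (λ z → z * z * γ) UM ⟩
      ι 1ℚ * ι 1ℚ * γ ≡⟨ solve 1 (λ g → con 1ℚ :* con 1ℚ :* g := g) refl γ ⟩
      γ ∎

    α⁶ : α ^ 6 ≡ 2' * δ - ι 1ℚ
    α⁶ = begin
      α ^ 6 ≡⟨ solve 1 (λ a → a :^ 6 := a :* a :* (a :* a :* (a :* a))) refl α ⟩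
      α * α * (α * α * (α * α)) ≡⟨ cong (λ z → z * (z * z)) α² ⟩
      γ * (γ * γ) ≡⟨ γ³ ⟩
      2' * δ - ι 1ℚ ∎

    α¹² : α ^ 12 ≡ M
    α¹² = begin
      α ^ 12 ≡⟨ solve 1 (λ a → a :^ 12 := a :* a :* (a :* a :* (a :* a)) :* (a :* a :* (a :* a :* (a :* a)))) refl α ⟩
      α * α * (α * α * (α * α)) * (α * α * (α * α * (α * α))) ≡⟨ cong (λ z → z * (z * z) * (z * (z * z))) α² ⟩
      γ * (γ * γ) * (γ * (γ * γ)) ≡⟨ γ⁶ ⟩
      M ∎

    -- A generator θ of the ring of integers represents α² and `(1 + α⁶)/2` as integer polynomials
    -- in θ; under `φ` these two become γ and δ.
    not-monogenic : (∀ {θ} → Evaluation.Integral R θ → let open PolynomialValues R θ in ℤ[θ] γ → ℤ[θ] δ → ⊥) → ¬ Monogenic m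
    not-monogenic contradiction (θ , θ-integral , generates) = contradiction (φ-integral θ θ-integral)
      (φ-value θ α²-vector (trans value-α² α²) (generates α²-vector (IntegralVectors.α²-integral m)))
      (φ-value θ ½[1+α⁶]-vector φ-δ (generates ½[1+α⁶]-vector (IntegralVectors.½[1+α⁶]-integral m k refl)))
      where
      open Realisation R m α α¹²
      open SparseValues R α
      φ-δ : φ ½[1+α⁶]-vector ≡ δ
      φ-δ = trans value-½[1+α⁶] (trans (cong (λ z → ι ½ * (ι 1ℚ + z)) α⁶)
        (solve 1 (λ x → con ½ :* (con 1ℚ :+ (:ℕ 2 :* x :- con 1ℚ)) := x) refl δ))

fourth-power-relation : ∀ (R : ℚAlgebra) (let open ℚAlgebra R) x →
  (x ^ 2) ^ 2 - x ≡ x ^ 4 - Evaluation.eval R (+ 0 ∷ + 1 ∷ + 0 ∷ + 0 ∷ []) x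
fourth-power-relation R = solve 1 (λ x → (x :^ 2) :^ 2 :- x :=
  x :^ 4 :- (con 0ℚ :+ x :* (con 1ℚ :+ x :* (con 0ℚ :+ x :* (con 0ℚ :+ x :* con 0ℚ))))) refl
  where open ℚAlgebra.Solver R

module _ (L : ℚAlgebra) {B : ℚAlgebra.Carrier L → Set} (O : ÉtaleOrder two L B) where
  open ℚAlgebra L

  module NonMonogenic₂ {γ δ : Carrier} (Bδ : B δ) (k : ℤ) (δ² : δ * δ ≡ δ + ι (ℤ→ℚ k)) (γ³ : γ * (γ * γ) ≡ ι (ℤ→ℚ (+ 2)) * δ - ι 1ℚ)
      (w : (Fin 6 → Fin 2) → Carrier)
      (w-generated : ∀ {S} → Subsets.Subring L S → S γ → S δ → ∀ ε → S (w ε))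
      (w-injective : ∀ ε ε' → B (ι ½ * (w ε - w ε')) → ∀ i → ε i ≡ ε' i) where

    private
      module Q = Quartic₂ L O Bδ k δ²
      open Q using (T; incl; unit-ball)
      module T = ℚAlgebra T
      open _⟶_ (quadratic-incl L (ι 1ℚ) Q.d)
      open Evaluation T using (Integral; eval)
      open Integrality T two using (module IsUnitBall)
      open IsUnitBall unit-ball

    contradiction : ∀ {θ} → Integral θ → let open PolynomialValues T θ in ℤ[θ] (incl γ) → ℤ[θ] (incl δ) → ⊥
    contradiction {θ} θ-integral γ∈ δ∈ = Pigeonhole.no-independent-values T two ideal π-ideal Λθ
      -- The relation is `θ⁴ ≡ θ`; its degree 4 is set against the 6 digits of `w`.
      (+ 0 ∷ + 1 ∷ + 0 ∷ + 0 ∷ []) (subst Q.J (fourth-power-relation T θ) (reduced Λθ))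
      {6} (s≤s (s≤s (s≤s (s≤s (s≤s z≤n))))) (λ ε → incl (w ε))
      (w-generated (Pullback.pullback (quadratic-incl L (ι 1ℚ) Q.d) {ℤ[θ]} values-subring) γ∈ δ∈)
      (λ ε ε' (p , _) → w-injective ε ε' p)
      where
      open PolynomialValues T θ
      Λθ : Q.Λ θ
      Λθ = integral⇒Λ θ-integral

    module _ (u : ℚ) (um : u ℚ.* ℤ→ℚ (+ 1 ℤ.+ + 4 ℤ.* k) ≡ 1ℚ) where
      private
        m = + 1 ℤ.+ + 4 ℤ.* k

        y² : Q.y T.* Q.y ≡ T.ι 1ℚ T.* Q.y T.+ T.ι ½ T.* (incl δ T.- T.ι 1ℚ)
        y² = trans Q.y² (cong (T.ι 1ℚ T.* Q.y T.+_) (trans (*-homo (ι ½) (δ - ι 1ℚ)) (cong (T.ι ½ T.*_)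
               (trans (+-homo δ (- ι 1ℚ)) (cong (incl δ T.+_) (neg-homo (ι 1ℚ)))))))

        T-γ³ : incl γ T.* (incl γ T.* incl γ) ≡ T.ι (ℤ→ℚ (+ 2)) T.* incl δ T.- T.ι 1ℚ
        T-γ³ = trans (sym (trans (*-homo γ (γ * γ)) (cong (incl γ T.*_) (*-homo γ γ)))) (trans (cong incl γ³)
          (trans (+-homo (ι (ℤ→ℚ (+ 2)) * δ) (- ι 1ℚ)) (cong₂ T._+_ (*-homo (ι (ℤ→ℚ (+ 2))) δ) (neg-homo (ι 1ℚ)))))

        T-δ² : incl δ T.* incl δ ≡ incl δ T.+ T.ι (ℤ→ℚ k)
        T-δ² = trans (sym (*-homo δ δ)) (trans (cong incl δ²) (+-homo δ (ι (ℤ→ℚ k))))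

      not-monogenic : ¬ Monogenic m
      not-monogenic = TwelfthRoot₂.not-monogenic T k u um {Q.y} {incl γ} {incl δ} y² T-γ³ T-δ² contradiction

module FourthPowers (R : ℚAlgebra) {P : ℚAlgebra.Carrier R → Set} (P-subring : Subsets.Subring R P) where
  open ℚAlgebra R
  open Solver
  open Subsets.Subring P-subring
  open PrimeIdeal two R P-subring

  -- Squaring `x² = x + c` and substituting once more gives `x⁴ - x = (c² + c) + 2 c x`.
  quadratic-étale : ∀ {x c} → P x → P c → x * x ≡ ι 1ℚ * x + c → P (ι ½ * (c * c + c)) → Étale x
  quadratic-étale {x} {c} Px Pc eq Pc² = fix Px (subst P (sym lemma) (+-closed Pc² (*-closed Pc Px)))
    where
    lemma : ι ½ * ((x ^ 2) ^ 2 - x) ≡ ι ½ * (c * c + c) + c * x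
    lemma = trans (solve 1 (λ x → con ½ :* ((x :^ 2) :^ 2 :- x) := con ½ :* (x :* x :* (x :* x) :- x)) refl x)
      (trans (cong (λ z → ι ½ * (z * z - x)) eq)
      (trans (solve 2 (λ x c → let y = con 1ℚ :* x :+ c in con ½ :* (y :* y :- x) := con ½ :* (x :* x :- x) :+ con ½ :* (c :* c) :+ c :* x) refl x c)
      (trans (cong (λ z → ι ½ * (z - x) + ι ½ * (c * c) + c * x) eq)
             (solve 2 (λ x c → con ½ :* (con 1ℚ :* x :+ c :- x) :+ con ½ :* (c :* c) :+ c :* x := con ½ :* (c :* c :+ c) :+ c :* x) refl x c))))

  -- As `x³ = c` is 1 modulo 2, both `x⁴ = c x` and `y⁴ = c² y` reduce to the element itself.
  cubic-étale : ∀ {x y c h} → P x → P y → P c → P h → x * x ≡ y → x * y ≡ c → c ≡ ι 1ℚ + ι (ℤ→ℚ (+ 2)) * h → Étale x × Étale y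
  cubic-étale {x} {_} {_} {h} Px Py Pc Ph refl xxx refl =
      fix Px (subst P (sym (trans (solve 1 (λ x → con ½ :* ((x :^ 2) :^ 2 :- x) := con ½ :* (x :* (x :* x) :- con 1ℚ) :* x) refl x)
        (trans (cong (λ c → ι ½ * (c - ι 1ℚ) * x) xxx) (solve 2 (λ x h → con ½ :* (con 1ℚ :+ :ℕ 2 :* h :- con 1ℚ) :* x := h :* x) refl x h))))
        (*-closed Ph Px))
    , fix Py (subst P (sym (trans (solve 1 (λ x → con ½ :* (((x :* x) :^ 2) :^ 2 :- x :* x) := con ½ :* (x :* (x :* x) :* (x :* (x :* x)) :- con 1ℚ) :* (x :* x)) refl x)
        (trans (cong (λ c → ι ½ * (c * c - ι 1ℚ) * (x * x)) xxx)
          (solve 2 (λ y h → let c = con 1ℚ :+ :ℕ 2 :* h in con ½ :* (c :* c :- con 1ℚ) :* y := h :* (c :+ con 1ℚ) :* y) refl (x * x) h))))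
        (*-closed (*-closed Ph (+-closed Pc (int (+ 1)))) Py))

-- The tower L = D[γ]/(γ³ - (2 δ - 1)) over D = ℚ[δ]/(δ² - δ - k).
module _ (D : ℚAlgebra) {Z : ℚAlgebra.Carrier D → Set} (D-order : ÉtaleOrder two D Z) where
  open ℚAlgebra D

  module CubicStage₂ {δ : Carrier} (Zδ : Z δ) (k : ℤ) (δ² : δ * δ ≡ δ + ι (ℤ→ℚ k))
      (w₀ : Fin 2 → Fin 2 → Carrier)
      (w₀-generated : ∀ {S} → Subsets.Subring D S → S δ → ∀ i j → S (w₀ i j))
      (w₀-injective : ∀ i j i' j' → Z (ι ½ * (w₀ i j - w₀ i' j')) → i ≡ i' × j ≡ j') where

    private
      open Solver
      open Subsets.Subring (ÉtaleOrder.subring D-order)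

      A h a b : Carrier
      A = ι (ℤ→ℚ (+ 2)) * δ - ι 1ℚ
      h = δ - ι 1ℚ
      -- The form `(-1, 0, 0, A)` has `ω² = θ` and `ω θ = A`, so its cubic ring is the pure cubic
      -- extension with ω = γ and θ = γ².
      a = ι (ℤ→ℚ -[1+ 0 ])
      b = ι 0ℚ

      ZA : Z A
      ZA = minus-closed (*-closed (int (+ 2)) Zδ) (int (+ 1))

      L = Cubic.algebra D a b b A
      module L where
        open ℚAlgebra L public
        open Cubic D a b b A public using (gen₁; gen₂; gen₁²; gen₁gen₂; incl)
      module LL = CubicOrder D a b b A
      open _⟶_ (cubic-incl D a b b A)

      γ²≡ : L.gen₁ L.* L.gen₁ ≡ L.gen₂
      γ²≡ = trans L.gen₁² (cong₂ _,_ (solve 0 (:- (con (ℤ→ℚ -[1+ 0 ]) :* con 0ℚ) := con 0ℚ) refl)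
                            (cong (b ,_) (solve 0 (:- con (ℤ→ℚ -[1+ 0 ]) := con 1ℚ) refl)))

      γγ²≡ : L.gen₁ L.* L.gen₂ ≡ L.incl A
      γγ²≡ = trans L.gen₁gen₂ (cong L.incl (solve 1 (λ a → :- (con (ℤ→ℚ -[1+ 0 ]) :* a) := a) refl A))

      A≡ : L.incl A ≡ L.ι 1ℚ L.+ L.ι (ℤ→ℚ (+ 2)) L.* L.incl h
      A≡ = trans (cong L.incl (solve 1 (λ x → :ℕ 2 :* x :- con 1ℚ := con 1ℚ :+ :ℕ 2 :* (x :- con 1ℚ)) refl δ))
             (trans (+-homo (ι 1ℚ) (ι (ℤ→ℚ (+ 2)) * h)) (cong (L.ι 1ℚ L.+_) (*-homo (ι (ℤ→ℚ (+ 2))) h)))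

      B : L.Carrier → Set
      B = LL._³ Z

      L-order : ÉtaleOrder two L B
      L-order = CubicÉtale.order two D-order {a} {b} {b} {A} (int -[1+ 0 ]) (int (+ 0)) (int (+ 0)) ZA (proj₁ étale-gens) (proj₂ étale-gens)
        where
        étale-gens = FourthPowers.cubic-étale L (LL.³-subring (ÉtaleOrder.subring D-order) (int -[1+ 0 ]) (int (+ 0)) (int (+ 0)) ZA)
          {L.gen₁} {L.gen₂} {L.incl A} {L.incl h}
          (int (+ 0) , int (+ 1) , int (+ 0)) (int (+ 0) , int (+ 0) , int (+ 1)) (ZA , int (+ 0) , int (+ 0))
          (minus-closed Zδ (int (+ 1)) , int (+ 0) , int (+ 0)) γ²≡ γγ²≡ A≡

      L-δ² : L.incl δ L.* L.incl δ ≡ L.incl δ L.+ L.ι (ℤ→ℚ k)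
      L-δ² = trans (sym (*-homo δ δ)) (trans (cong L.incl δ²) (+-homo δ (ι (ℤ→ℚ k))))

      L-γ³ : L.gen₁ L.* (L.gen₁ L.* L.gen₁) ≡ L.ι (ℤ→ℚ (+ 2)) L.* L.incl δ L.- L.ι 1ℚ
      L-γ³ = trans (cong (L.gen₁ L.*_) γ²≡) (trans γγ²≡ (trans (+-homo (ι (ℤ→ℚ (+ 2)) * δ) (- ι 1ℚ))
        (cong₂ L._+_ (*-homo (ι (ℤ→ℚ (+ 2))) δ) (neg-homo (ι 1ℚ)))))

      -- The elements Σ ε γⁱ δʲ with i < 3 and j < 2.
      w : (Fin 6 → Fin 2) → L.Carrier
      w ε = w₀ (ε (# 0)) (ε (# 1)) , w₀ (ε (# 2)) (ε (# 3)) , w₀ (ε (# 4)) (ε (# 5))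

      w-generated : ∀ {S} → Subsets.Subring L S → S L.gen₁ → S (L.incl δ) → ∀ ε → S (w ε)
      w-generated {S} S-sub Sγ Sδ ε = LL.³-generated {λ x → S (L.incl x)} {S} (Subsets.Subring.+-closed S-sub) (Subsets.Subring.*-closed S-sub)
          id Sγ (subst S γ²≡ (Subsets.Subring.*-closed S-sub Sγ Sγ))
          (pair (# 0) (# 1) , pair (# 2) (# 3) , pair (# 4) (# 5))
        where
        pair : ∀ i j → S (L.incl (w₀ (ε i) (ε j)))
        pair i j = w₀-generated (Pullback.pullback (cubic-incl D a b b A) {S} S-sub) Sδ (ε i) (ε j)

      w-injective : ∀ ε ε' → B (L.ι ½ L.* (w ε L.- w ε')) → ∀ i → ε i ≡ ε' i
      w-injective ε ε' Bw =
        let pair = λ i j → w₀ (ε i) (ε j) - w₀ (ε' i) (ε' j)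
            p , q , r = LL.³-scale {Z} ½ {pair (# 0) (# 1)} {pair (# 2) (# 3)} {pair (# 4) (# 5)} Bw
            p₀ , p₁ = w₀-injective _ _ _ _ p
            q₀ , q₁ = w₀-injective _ _ _ _ q
            r₀ , r₁ = w₀-injective _ _ _ _ r
        in λ
        { zero                               → p₀
        ; (suc zero)                         → p₁
        ; (suc (suc zero))                   → q₀
        ; (suc (suc (suc zero)))             → q₁
        ; (suc (suc (suc (suc zero))))       → r₀
        ; (suc (suc (suc (suc (suc zero))))) → r₁
        }

    not-monogenic : ∀ (u : ℚ) → u ℚ.* ℤ→ℚ (+ 1 ℤ.+ + 4 ℤ.* k) ≡ 1ℚ → ¬ Monogenic (+ 1 ℤ.+ + 4 ℤ.* k)
    not-monogenic = NonMonogenic₂.not-monogenic L L-order {L.gen₁} {L.incl δ}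
      (Zδ , int (+ 0) , int (+ 0)) k L-δ² L-γ³ w w-generated w-injective

module _ {Q : ℚAlgebra} {Z : ℚAlgebra.Carrier Q → Set} (Z-order : ÉtaleOrder two Q Z) where
  open ℚAlgebra Q

  module QuadraticStage₂ (k : ℤ) (k²+k : Z (ι ½ * (ι (ℤ→ℚ k) * ι (ℤ→ℚ k) + ι (ℤ→ℚ k))))
      (digit : Fin 2 → Carrier) (digit-int : ∀ i → ∃ λ n → digit i ≡ ι (ℤ→ℚ n))
      (digit-injective : ∀ i j → Z (ι ½ * (digit i - digit j)) → i ≡ j) where

    private
      open Subsets.Subring (ÉtaleOrder.subring Z-order)

      q₁ qₖ : Carrier
      q₁ = ι 1ℚ
      qₖ = ι (ℤ→ℚ k)

      D = Quadratic.algebra Q q₁ qₖ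
      module D where
        open ℚAlgebra D public
        open Quadratic Q q₁ qₖ public using (gen; gen²; incl; incl-*ˡ)
      module LD = QuadraticOrder Q q₁ qₖ
      open _⟶_ (quadratic-incl Q q₁ qₖ)

      D-order : ÉtaleOrder two D (LD._² Z)
      D-order = QuadraticÉtale.order two Z-order {q₁} {qₖ} (int (+ 1)) (int k)
        (FourthPowers.quadratic-étale D (LD.²-subring (ÉtaleOrder.subring Z-order) (int (+ 1)) (int k))
          {D.gen} {D.incl qₖ} (int (+ 0) , int (+ 1)) (int k , int (+ 0)) D.gen²
          (subst (LD._² Z) hom (k²+k , int (+ 0))))
        where
        hom : D.incl (ι ½ * (qₖ * qₖ + qₖ)) ≡ D.ι ½ D.* (D.incl qₖ D.* D.incl qₖ D.+ D.incl qₖ)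
        hom = trans (*-homo _ _) (cong (D.ι ½ D.*_) (trans (+-homo _ _) (cong (D._+ D.incl qₖ) (*-homo _ _))))

      δ² : D.gen D.* D.gen ≡ D.gen D.+ D.ι (ℤ→ℚ k)
      δ² = trans D.gen² (cong (D._+ D.ι (ℤ→ℚ k)) (solve 1 (λ x → con 1ℚ :* x := x) refl D.gen))
        where open ℚAlgebra.Solver D

      w : Fin 2 → Fin 2 → D.Carrier
      w i j = digit i , digit j

      w-generated : ∀ {S} → Subsets.Subring D S → S D.gen → ∀ i j → S (w i j)
      w-generated {S} S-sub Sδ i j = LD.²-generated {λ q → ∃ λ n → q ≡ ι (ℤ→ℚ n)} {S}
        (Subsets.Subring.+-closed S-sub) (Subsets.Subring.*-closed S-sub)
        (λ { (n , refl) → Subsets.Subring.int S-sub n }) Sδ (digit-int i , digit-int j)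

      w-injective : ∀ i j i' j' → (LD._² Z) (D.ι ½ D.* (w i j D.- w i' j')) → i ≡ i' × j ≡ j'
      w-injective i j i' j' p =
        let p₀ , p₁ = LD.²-scale {Z} ½ {digit i - digit i'} {digit j - digit j'} p
        in digit-injective i i' p₀ , digit-injective j j' p₁

    not-monogenic : ∀ (u : ℚ) → u ℚ.* ℤ→ℚ (+ 1 ℤ.+ + 4 ℤ.* k) ≡ 1ℚ → ¬ Monogenic (+ 1 ℤ.+ + 4 ℤ.* k)
    not-monogenic = CubicStage₂.not-monogenic D D-order {D.gen} (int (+ 0) , int (+ 1)) k δ² w w-generated w-injective

reciprocal : ∀ {q} → q ≢ 0ℚ → ∃ λ u → u ℚ.* q ≡ 1ℚ
reciprocal {q} q≢0 = (ℚ.1/ q) {{ℚ.≢-nonZero q≢0}} , ℚP.*-inverseˡ q {{ℚ.≢-nonZero q≢0}}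

-- If the sum vanished, `n` would divide 1. This makes `m` invertible in ℚ, as the quotient that
-- defines α in the tower demands.
1+n*k≢0 : ∀ n k → n ≢ 1 → + 1 ℤ.+ + n ℤ.* k ≢ + 0
1+n*k≢0 n k n≢1 eq = n≢1 (ℕP.m*n≡1⇒m≡1 n ℤ.∣ k ∣ (trans (sym (ℤP.abs-* (+ n) k)) (cong ℤ.∣_∣ n*k≡-1)))
  where
  n*k≡-1 : + n ℤ.* k ≡ -[1+ 0 ]
  n*k≡-1 = trans (solve 1 (λ x → x := con (+ 1) :+ x :- con (+ 1)) refl (+ n ℤ.* k)) (cong (ℤ._- + 1) eq)
    where open ℤSolver.+-*-Solver

not-monogenic₄ : ∀ k → ¬ Monogenic (+ 1 ℤ.+ + 4 ℤ.* k)
not-monogenic₄ k = QuadraticStage₂.not-monogenic loc-étale k k²+k (λ i → ℤ→ℚ (+ toℕ i)) (λ i → + toℕ i , refl) digits-injective u um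
  where
  open Localisation two
  open Subsets.Subring loc-subring
  k²+k : Loc (½ ℚ.* (ℤ→ℚ k ℚ.* ℤ→ℚ k ℚ.+ ℤ→ℚ k))
  k²+k = subst Loc (S.solve 1 (λ k → S.con ½ S.:* (k S.:^ 2 S.:- k) S.:+ k S.:= S.con ½ S.:* (k S.:* k S.:+ k)) refl (ℤ→ℚ k))
    (+-closed (fermat (loc-int k)) (loc-int k))
    where module S = ℚAlgebra.Solver rationals
  m≢0 : ℤ→ℚ (+ 1 ℤ.+ + 4 ℤ.* k) ≢ 0ℚ
  m≢0 m≡0 = 1+n*k≢0 4 k (λ ()) (ℤ→ℚ-injective m≡0)
  u = proj₁ (reciprocal m≢0)
  um = proj₂ (reciprocal m≢0)

-- The case m ≡ ±1 modulo 9

FermatClosed : (ℚ → Set) → Set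
FermatClosed G = ∀ {q} → G q → G (⅓ ℚ.* (q ℚ.* (q ℚ.* (q ℚ.* 1ℚ)) ℚ.+ ℚ.- q))

module _ (A : ℚAlgebra) {P J : ℚAlgebra.Carrier A → Set} (ideal : Subsets.Ideal A P J) where
  open ℚAlgebra A

  module Cubes (π-ideal : ∀ {x} → P x → J (ι (ℤ→ℚ (+ 3)) * x)) where
    open Solver
    open Subsets A
    open Ideal ideal

    private
      3' = ι (ℤ→ℚ (+ 3))

      ι-cube : ∀ q → ι q ^ 3 - ι q ≡ 3' * ι (⅓ ℚ.* (q ℚ.* (q ℚ.* (q ℚ.* 1ℚ)) ℚ.+ ℚ.- q))
      ι-cube q = begin
        ι q ^ 3 - ι q ≡⟨ solve 1 (λ q → q :^ 3 :- q := :ℕ 3 :* (con ⅓ :* (q :* (q :* (q :* con 1ℚ)) :- q))) refl (ι q) ⟩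
        3' * (ι ⅓ * (ι q * (ι q * (ι q * ι 1ℚ)) - ι q)) ≡⟨ cong (λ z → 3' * (ι ⅓ * z)) (sym expand) ⟩
        3' * (ι ⅓ * ι (q ℚ.* (q ℚ.* (q ℚ.* 1ℚ)) ℚ.+ ℚ.- q)) ≡⟨ cong (3' *_) (sym (ι-* _ _)) ⟩
        3' * ι (⅓ ℚ.* (q ℚ.* (q ℚ.* (q ℚ.* 1ℚ)) ℚ.+ ℚ.- q)) ∎
        where
        open ≡-Reasoning
        expand : ι (q ℚ.* (q ℚ.* (q ℚ.* 1ℚ)) ℚ.+ ℚ.- q) ≡ ι q * (ι q * (ι q * ι 1ℚ)) - ι q
        expand = trans (ι-+ _ _) (cong₂ _+_ (trans (ι-* _ _) (cong (ι q *_) (trans (ι-* _ _) (cong (ι q *_) (ι-* _ _))))) (ι-neg q))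

    -- This is the ideal quotient `(J : e)`. Working modulo it amounts to projecting `Λ/J` to the
    -- factors on which `e` is nonzero, without naming these factors.
    record Killed (e x : Carrier) : Set where
      constructor kill
      field
        killed : J (e * x)

    open Killed public

    MonicRelation : Carrier → ∀ {d} → Vec ℤ (suc d) → Carrier → Set
    MonicRelation e {d} rel x = Killed e (x ^ suc d - Evaluation.eval A (toList rel) x)

    module _ {e : Carrier} (Pe : P e) where
      annihilator : Ideal P (Killed e)
      annihilator = record
        { subring = subring
        ; +-ideal = λ {x} {y} (kill p) (kill q) → kill (subst J (solve 3 (λ e x y → e :* x :+ e :* y := e :* (x :+ y)) refl e x y) (+-ideal p q))
        ; *-ideal = λ {x} {y} p (kill q) → kill (subst J (solve 3 (λ e x y → x :* (e :* y) := e :* (x :* y)) refl e x y) (*-ideal p q))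
        }

      annihilator-π : ∀ {x} → P x → Killed e (3' * x)
      annihilator-π Px = kill (*-ideal Pe (π-ideal Px))

      open Frobenius A three annihilator annihilator-π public

      Fixed³ : Carrier → Set
      Fixed³ = Fixed (_^ 3)

      cubic-relation : ∀ {x} → Fixed³ x → MonicRelation e (+ 0 ∷ + 1 ∷ + 0 ∷ []) x
      cubic-relation {x} (fix _ x³≈x) = subst (λ z → Killed e (x ^ 3 - z))
        (solve 1 (λ x → x := con 0ℚ :+ x :* (con 1ℚ :+ x :* (con 0ℚ :+ x :* con 0ℚ))) refl x) x³≈x

      ι-fixed : ∀ q → P (ι q) → P (ι (⅓ ℚ.* (q ℚ.* (q ℚ.* (q ℚ.* 1ℚ)) ℚ.+ ℚ.- q))) → Fixed³ (ι q)
      ι-fixed q Pq Pq³ = fix Pq (subst (Killed e) (sym (ι-cube q)) (annihilator-π Pq³))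

      fixed-subring : Subring Fixed³
      fixed-subring = record
        { +-closed = fixed-+ frobenius
        ; *-closed = fixed-* frobenius
        ; int      = λ n → ι-fixed (ℤ→ℚ n) (int n) (cubed n)
        }
        where
        cubed : ∀ n → P (ι (⅓ ℚ.* (ℤ→ℚ n ℚ.* (ℤ→ℚ n ℚ.* (ℤ→ℚ n ℚ.* 1ℚ)) ℚ.+ ℚ.- ℤ→ℚ n)))
        cubed n = let k , n³-n≡ = fermatℤ three n in subst P (cong ι (begin
            ℤ→ℚ k ≡⟨ ℚS.solve 1 (λ k → k ℚS.:= ℚS.con ⅓ ℚS.:* (ℚS.:ℕ 3 ℚS.:* k)) refl (ℤ→ℚ k) ⟩
            ⅓ ℚ.* (ℤ→ℚ (+ 3) ℚ.* ℤ→ℚ k) ≡⟨ cong (⅓ ℚ.*_) (sym (ℤ→ℚ-* (+ 3) k)) ⟩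
            ⅓ ℚ.* ℤ→ℚ (+ 3 ℤ.* k) ≡⟨ cong (λ z → ⅓ ℚ.* ℤ→ℚ z) (sym n³-n≡) ⟩
            ⅓ ℚ.* ℤ→ℚ (n ℤ.^ 3 ℤ.- n) ≡⟨ cong (⅓ ℚ.*_) (trans (ℤ→ℚ-+ (n ℤ.^ 3) (ℤ.- n)) (cong₂ ℚ._+_ (trans (ℤ→ℚ-* n (n ℤ.^ 2)) (cong (ℤ→ℚ n ℚ.*_) (trans (ℤ→ℚ-* n (n ℤ.^ 1)) (cong (ℤ→ℚ n ℚ.*_) (ℤ→ℚ-* n (+ 1)))))) (ℤ→ℚ-neg n))) ⟩
            ⅓ ℚ.* (ℤ→ℚ n ℚ.* (ℤ→ℚ n ℚ.* (ℤ→ℚ n ℚ.* 1ℚ)) ℚ.+ ℚ.- ℤ→ℚ n) ∎)) (int k)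
          where
          open ≡-Reasoning
          module ℚS = ℚAlgebra.Solver rationals

      nilpotent-fixed³ : ∀ {x} → P x → J x → Fixed³ x
      nilpotent-fixed³ {x} Px Jx = fix Px (kill (subst J (solve 2 (λ e x → e :* (x :^ 2 :- con 1ℚ) :* x := e :* (x :^ 3 :- x)) refl e x)
        (*-ideal (*-closed Pe (minus-closed (^-closed Px 2) (int (+ 1)))) Jx)))

      idempotent-fixed³ : ∀ {x} → P x → J (x * x - x) → Fixed³ x
      idempotent-fixed³ {x} Px Jx = fix Px (kill (subst J (solve 2 (λ e x → e :* (x :+ con 1ℚ) :* (x :* x :- x) := e :* (x :^ 3 :- x)) refl e x)
        (*-ideal (*-closed Pe (+-closed Px (int (+ 1)))) Jx)))

    module _ (c : ℤ) {i} (Pi : P i) where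
      private
        C = ι (ℤ→ℚ c)
        Pc = int c

      module _ (i² : i * i ≡ ι 1ℚ + ι (ℤ→ℚ (+ 9)) * C) where
        private
          E = ι 1ℚ + i
          PE = +-closed (int (+ 1)) Pi

          i²-1 : ∀ {x} → P x → J ((i * i - ι 1ℚ) * x)
          i²-1 {x} Px = subst J (trans (solve 2 (λ c x → :ℕ 3 :* (:ℕ 3 :* c :* x) := (con 1ℚ :+ :ℕ 9 :* c :- con 1ℚ) :* x) refl C x)
              (cong (λ z → (z - ι 1ℚ) * x) (sym i²)))
            (π-ideal (*-closed (*-closed (int (+ 3)) Pc) Px))

        -- Multiplication by 1 + i kills the factors of Λ/J in which i is - 1.
        i-fixed : Fixed³ PE i
        i-fixed = fix Pi (kill (subst J (solve 1 (λ i → (i :* i :- con 1ℚ) :* ((con 1ℚ :+ i) :* i) := (con 1ℚ :+ i) :* (i :^ 3 :- i)) refl i) (i²-1 (*-closed PE Pi))))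

        -- One has `ν³ - ν = (i - 1) ν`, and `(1 + i)(i - 1) = 9 c` is divisible by 3.
        √i-fixed : ∀ {ν} → P ν → ν * ν ≡ i → Fixed³ PE ν
        √i-fixed {ν} Pν ν² = fix Pν (kill (subst J (trans (solve 2 (λ i ν → (i :* i :- con 1ℚ) :* ν := (con 1ℚ :+ i) :* (ν :* i :- ν)) refl i ν)
          (trans (cong (λ z → E * (ν * z - ν)) (sym ν²)) (solve 2 (λ e ν → e :* (ν :* (ν :* ν) :- ν) := e :* (ν :^ 3 :- ν)) refl E ν))) (i²-1 Pν)))

      module _ {θ} (Pθ : P θ) (θ⁹ : J ((θ ^ 3) ^ 3 - θ)) (i² : i * i ≡ - (ι 1ℚ + ι (ℤ→ℚ (+ 9)) * C))
               (i∈ : PolynomialValues.ℤ[θ] A θ i) where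
        private
          w = θ ^ 3 - θ
          Pw : P w
          Pw = minus-closed (^-closed Pθ 3) Pθ
          e = ι 1ℚ - w ^ 8
          Pe : P e
          Pe = minus-closed (int (+ 1)) (^-closed Pw 8)

          module N = NinthPowers A ideal π-ideal

          w⁹ : J ((w ^ 3) ^ 3 - w)
          w⁹ = N.Fixed.fixed (subst N.Fixed⁹ (solve 1 (λ t → t :* (t :* t) :+ con (ℤ→ℚ -[1+ 0 ]) :* t := t :^ 3 :- t) refl θ)
              (N.fixed-+ N.frobenius² (N.fixed-* N.frobenius² Fθ (N.fixed-* N.frobenius² Fθ Fθ)) (N.fixed-* N.frobenius² F-1 Fθ)))
            where
            Fθ : N.Fixed⁹ θ
            Fθ = N.fix Pθ θ⁹
            F-1 : N.Fixed⁹ (ι (ℤ→ℚ -[1+ 0 ]))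
            F-1 = N.fix (int -[1+ 0 ]) (subst J (solve 0 (:ℕ 3 :* con 0ℚ := (con (ℤ→ℚ -[1+ 0 ]) :^ 3) :^ 3 :- con (ℤ→ℚ -[1+ 0 ])) refl) (π-ideal (int (+ 0))))

          ew : J (e * w)
          ew = subst J (solve 1 (λ w → :- ((w :^ 3) :^ 3 :- w) := (con 1ℚ :- w :^ 8) :* w) refl w) (neg-ideal w⁹)

          -- Since `e w` is in `J` and `w = θ³ - θ`, cubing fixes θ modulo `(J : e)`, hence fixes
          -- all values of integer polynomials at θ.
          value-fixed : ∀ cs → Fixed³ Pe (Evaluation.eval A cs θ)
          value-fixed []       = Subring.int (fixed-subring Pe) (+ 0)
          value-fixed (c ∷ cs) = Subring.+-closed (fixed-subring Pe) (Subring.int (fixed-subring Pe) c)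
            (Subring.*-closed (fixed-subring Pe) (fix Pθ (kill ew)) (value-fixed cs))

          ei³ : J (e * (i ^ 3 - i))
          ei³ = let cs , eq = i∈ in killed (Fixed.fixed (subst (Fixed³ Pe) eq (value-fixed cs)))

          ei : J (e * i)
          ei = subst J (begin
              -- By `i² = -(1 + 9 c)` the first term equals `-(2 + 9 c) e i`; adding the multiple
              -- `3 (1 + 3 c)` of `e i` leaves exactly `e i`.
              e * (i ^ 3 - i) + 3' * ((ι 1ℚ + 3' * C) * (e * i)) ≡⟨ solve 3 (λ e i c → e :* (i :^ 3 :- i) :+ :ℕ 3 :* ((con 1ℚ :+ :ℕ 3 :* c) :* (e :* i)) :=
                                                                     e :* i :* (i :* i :+ :ℕ 2 :+ :ℕ 9 :* c)) refl e i C ⟩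
              e * i * (i * i + ι (ℤ→ℚ (+ 2)) + ι (ℤ→ℚ (+ 9)) * C) ≡⟨ cong (λ z → e * i * (z + ι (ℤ→ℚ (+ 2)) + ι (ℤ→ℚ (+ 9)) * C)) i² ⟩
              e * i * (- (ι 1ℚ + ι (ℤ→ℚ (+ 9)) * C) + ι (ℤ→ℚ (+ 2)) + ι (ℤ→ℚ (+ 9)) * C) ≡⟨ solve 2 (λ x c → x :* (:- (con 1ℚ :+ :ℕ 9 :* c) :+ :ℕ 2 :+ :ℕ 9 :* c) := x) refl (e * i) C ⟩
              e * i ∎)
            (+-ideal ei³ (π-ideal (*-closed (+-closed (int (+ 1)) (*-closed (int (+ 3)) Pc)) (*-closed Pe Pi))))
            where open ≡-Reasoning

          Je : J e
          Je = subst J (begin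
              - (e * i * i + 3' * (3' * C * e)) ≡⟨ solve 3 (λ e i c → :- (e :* i :* i :+ :ℕ 3 :* (:ℕ 3 :* c :* e)) := :- (e :* (i :* i :+ :ℕ 9 :* c))) refl e i C ⟩
              - (e * (i * i + ι (ℤ→ℚ (+ 9)) * C)) ≡⟨ cong (λ z → - (e * (z + ι (ℤ→ℚ (+ 9)) * C))) i² ⟩
              - (e * (- (ι 1ℚ + ι (ℤ→ℚ (+ 9)) * C) + ι (ℤ→ℚ (+ 9)) * C)) ≡⟨ solve 2 (λ e c → :- (e :* (:- (con 1ℚ :+ :ℕ 9 :* c) :+ :ℕ 9 :* c)) := e) refl e C ⟩
              e ∎)
            (neg-ideal (+-ideal (*-idealʳ ei Pi) (π-ideal (*-closed (*-closed (int (+ 3)) Pc) Pe))))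
            where open ≡-Reasoning

        -- w = θ³ - θ is a unit modulo J: its idempotent complement e = 1 - w⁸ satisfies e x³ = e x for
        -- x ∈ ℤ[θ], in particular for x = i, whereas i³ = - i. So (θ⁹ - θ)/w vanishes modulo J.
        sextic-relation : ∀ {z} → P z → MonicRelation z (-[1+ 0 ] ∷ + 0 ∷ -[1+ 0 ] ∷ + 0 ∷ -[1+ 0 ] ∷ + 0 ∷ []) θ
        sextic-relation Pz = kill (*-ideal Pz (subst J (solve 1 (λ t →
            let w = t :^ 3 :- t
                g = t :^ 6 :+ t :^ 4 :+ t :^ 2 :+ con 1ℚ in
            (con 1ℚ :- w :^ 8) :* g :+ w :^ 7 :* ((t :^ 3) :^ 3 :- t) :=
            t :^ 6 :- (con (ℤ→ℚ -[1+ 0 ]) :+ t :* (con 0ℚ :+ t :* (con (ℤ→ℚ -[1+ 0 ]) :+ t :* (con 0ℚ :+ t :* (con (ℤ→ℚ -[1+ 0 ]) :+ t :* (con 0ℚ :+ t :* con 0ℚ)))))))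
            refl θ)
          (+-ideal (*-idealʳ Je (+-closed (+-closed (+-closed (^-closed Pθ 6) (^-closed Pθ 4)) (^-closed Pθ 2)) (int (+ 1))))
                   (*-ideal (^-closed Pw 7) θ⁹))))

module SparseValues₃ (R : ℚAlgebra) (α : ℚAlgebra.Carrier R) where
  open ℚAlgebra R
  open Solver
  open Evaluation R

  value-α³ : horner ι (toList α³-vector) α ≡ α * (α * α)
  value-α³ = solve 1 (λ a → let 0+ = λ x → con 0ℚ :+ a :* x; 0⁸ = 0+ (0+ (0+ (0+ (0+ (0+ (0+ (0+ (con 0ℚ)))))))) in
    0+ (0+ (0+ (con 1ℚ :+ a :* 0⁸))) := a :* (a :* a)) refl α

  value-⅓[1+σα⁴+α⁸] : ∀ σ → horner ι (toList (⅓[1+σα⁴+α⁸]-vector σ)) α ≡ ι ⅓ * (ι 1ℚ + ι (ℤ→ℚ σ) * α ^ 4 + α ^ 4 * α ^ 4)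
  value-⅓[1+σα⁴+α⁸] σ = trans (cong (λ z → ι ⅓ + α * (ι 0ℚ + α * (ι 0ℚ + α * (ι 0ℚ + α * (z + tail))))) (ι-* (ℤ→ℚ σ) ⅓))
    (solve 2 (λ a s → let 0+ = λ x → con 0ℚ :+ a :* x in
      con ⅓ :+ a :* 0+ (0+ (0+ (s :* con ⅓ :+ a :* 0+ (0+ (0+ (con ⅓ :+ a :* 0+ (0+ (0+ (con 0ℚ)))))))))
        := con ⅓ :* (con 1ℚ :+ s :* a :^ 4 :+ a :^ 4 :* a :^ 4)) refl α (ι (ℤ→ℚ σ)))
    where
    tail = α * (ι 0ℚ + α * (ι 0ℚ + α * (ι 0ℚ + α * (ι ⅓ + α * (ι 0ℚ + α * (ι 0ℚ + α * (ι 0ℚ + α * ι 0ℚ)))))))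

module _ (R : ℚAlgebra) (σ c : ℤ) (σ² : σ ℤ.* σ ≡ + 1) where
  open ℚAlgebra R

  private
    m : ℤ
    m = σ ℤ.* (+ 1 ℤ.+ + 9 ℤ.* c)

  -- The sign σ puts both residues modulo 9 on the same footing: `κ = σ α⁴` satisfies
  -- `κ³ = σ m = 1 + 9 c` in either case.
  module TwelfthRoot₃ (u : ℚ) (um : u ℚ.* ℤ→ℚ m ≡ 1ℚ)
      {ν τ η : Carrier} (ν⁴ : ν * ν * (ν * ν) ≡ ι (ℤ→ℚ m))
      (τ² : τ * τ ≡ ι (ℤ→ℚ (+ 3)) * (η - τ - ι 1ℚ)) (τη : τ * η ≡ ι (ℤ→ℚ (+ 3)) * ι (ℤ→ℚ c)) where
    open Solver
    open ≡-Reasoning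

    private
      M S U C : Carrier
      M = ι (ℤ→ℚ m)
      S = ι (ℤ→ℚ σ)
      U = ι u
      C = ι (ℤ→ℚ c)

      UM : U * M ≡ ι 1ℚ
      UM = trans (sym (ι-* u (ℤ→ℚ m))) (cong ι um)

      SS : S * S ≡ ι 1ℚ
      SS = trans (sym (ι-* _ _)) (cong ι (trans (sym (ℤ→ℚ-* σ σ)) (cong ℤ→ℚ σ²)))

      M≡ : M ≡ S * (ι 1ℚ + ι (ℤ→ℚ (+ 9)) * C)
      M≡ = trans (cong ι (ℤ→ℚ-* σ (+ 1 ℤ.+ + 9 ℤ.* c))) (trans (ι-* _ _) (cong (S *_) (ι-1+n*k R 9 c)))

      κ : Carrier
      κ = ι 1ℚ + τ

      κ² : κ * κ ≡ ι (ℤ→ℚ (+ 3)) * η - τ - ι (ℤ→ℚ (+ 2))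
      κ² = trans (solve 1 (λ t → (con 1ℚ :+ t) :* (con 1ℚ :+ t) := con 1ℚ :+ :ℕ 2 :* t :+ t :* t) refl τ)
        (trans (cong (λ z → ι 1ℚ + ι (ℤ→ℚ (+ 2)) * τ + z) τ²)
          (solve 2 (λ t h → con 1ℚ :+ :ℕ 2 :* t :+ :ℕ 3 :* (h :- t :- con 1ℚ) := :ℕ 3 :* h :- t :- :ℕ 2) refl τ η))

      κ³ : κ * (κ * κ) ≡ S * M
      κ³ = begin
        κ * (κ * κ) ≡⟨ cong (κ *_) κ² ⟩
        κ * (ι (ℤ→ℚ (+ 3)) * η - τ - ι (ℤ→ℚ (+ 2))) ≡⟨ solve 2 (λ t h → (con 1ℚ :+ t) :* (:ℕ 3 :* h :- t :- :ℕ 2) := :ℕ 3 :* (h :+ t :* h :- t) :- t :* t :- :ℕ 2) refl τ η ⟩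
        ι (ℤ→ℚ (+ 3)) * (η + τ * η - τ) - τ * τ - ι (ℤ→ℚ (+ 2)) ≡⟨ cong₂ (λ x y → ι (ℤ→ℚ (+ 3)) * (η + x - τ) - y - ι (ℤ→ℚ (+ 2))) τη τ² ⟩
        ι (ℤ→ℚ (+ 3)) * (η + ι (ℤ→ℚ (+ 3)) * C - τ) - ι (ℤ→ℚ (+ 3)) * (η - τ - ι 1ℚ) - ι (ℤ→ℚ (+ 2)) ≡⟨ solve 3 (λ t h c → :ℕ 3 :* (h :+ :ℕ 3 :* c :- t) :- :ℕ 3 :* (h :- t :- con 1ℚ) :- :ℕ 2 := con 1ℚ :* (con 1ℚ :+ :ℕ 9 :* c)) refl τ η C ⟩
        ι 1ℚ * (ι 1ℚ + ι (ℤ→ℚ (+ 9)) * C) ≡⟨ cong (_* (ι 1ℚ + ι (ℤ→ℚ (+ 9)) * C)) (sym SS) ⟩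
        S * S * (ι 1ℚ + ι (ℤ→ℚ (+ 9)) * C) ≡⟨ solve 2 (λ s x → s :* s :* x := s :* (s :* x)) refl S (ι 1ℚ + ι (ℤ→ℚ (+ 9)) * C) ⟩
        S * (S * (ι 1ℚ + ι (ℤ→ℚ (+ 9)) * C)) ≡⟨ cong (S *_) M≡ ⟨
        S * M ∎

    -- ν = α³ and κ = 1 + τ = σ α⁴, whence α = σ κ / ν = σ κ ν³ / m.
    α : Carrier
    α = S * U * (ν * ν * ν) * κ

    private
      α³ : α * (α * α) ≡ ν
      α³ = begin
        α * (α * α) ≡⟨ solve 4 (λ s u n k → let a = s :* u :* (n :* n :* n) :* k in a :* (a :* a) := s :* s :* s :* (u :* u :* u) :* (n :* n :* (n :* n) :* (n :* n :* (n :* n)) :* n) :* (k :* (k :* k))) refl S U ν κ ⟩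
        S * S * S * (U * U * U) * (ν * ν * (ν * ν) * (ν * ν * (ν * ν)) * ν) * (κ * (κ * κ)) ≡⟨ cong₂ (λ x y → S * S * S * (U * U * U) * (x * x * ν) * y) ν⁴ κ³ ⟩
        S * S * S * (U * U * U) * (M * M * ν) * (S * M) ≡⟨ solve 4 (λ s u m n → s :* s :* s :* (u :* u :* u) :* (m :* m :* n) :* (s :* m) := s :* s :* (s :* s) :* (u :* m :* (u :* m) :* (u :* m)) :* n) refl S U M ν ⟩
        S * S * (S * S) * (U * M * (U * M) * (U * M)) * ν ≡⟨ cong₂ (λ x y → x * x * (y * y * y) * ν) SS UM ⟩
        ι 1ℚ * ι 1ℚ * (ι 1ℚ * ι 1ℚ * ι 1ℚ) * ν ≡⟨ solve 1 (λ n → con 1ℚ :* con 1ℚ :* (con 1ℚ :* con 1ℚ :* con 1ℚ) :* n := n) refl ν ⟩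
        ν ∎

      α⁴ : α ^ 4 ≡ S * κ
      α⁴ = begin
        α ^ 4 ≡⟨ solve 1 (λ a → a :^ 4 := a :* (a :* a) :* a) refl α ⟩
        α * (α * α) * α ≡⟨ cong (_* α) α³ ⟩
        ν * α ≡⟨ solve 4 (λ s u n k → n :* (s :* u :* (n :* n :* n) :* k) := s :* u :* (n :* n :* (n :* n)) :* k) refl S U ν κ ⟩
        S * U * (ν * ν * (ν * ν)) * κ ≡⟨ cong (λ z → S * U * z * κ) ν⁴ ⟩
        S * U * M * κ ≡⟨ solve 4 (λ s u m k → s :* u :* m :* k := s :* (u :* m) :* k) refl S U M κ ⟩
        S * (U * M) * κ ≡⟨ cong (λ z → S * z * κ) UM ⟩
        S * ι 1ℚ * κ ≡⟨ solve 2 (λ s k → s :* con 1ℚ :* k := s :* k) refl S κ ⟩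
        S * κ ∎

    α¹² : α ^ 12 ≡ M
    α¹² = begin
      α ^ 12 ≡⟨ solve 1 (λ a → a :^ 12 := a :* (a :* a) :* (a :* (a :* a)) :* (a :* (a :* a) :* (a :* (a :* a)))) refl α ⟩
      α * (α * α) * (α * (α * α)) * (α * (α * α) * (α * (α * α))) ≡⟨ cong (λ z → z * z * (z * z)) α³ ⟩
      ν * ν * (ν * ν) ≡⟨ ν⁴ ⟩
      M ∎

    not-monogenic : (∀ {θ} → Evaluation.Integral R θ → let open PolynomialValues R θ in ℤ[θ] ν → ℤ[θ] η → ⊥) → ¬ Monogenic m
    not-monogenic contradiction (θ , θ-integral , generates) = contradiction (φ-integral θ θ-integral)
      (φ-value θ α³-vector (trans value-α³ α³) (generates α³-vector (IntegralVectors.α³-integral m)))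
      (φ-value θ (⅓[1+σα⁴+α⁸]-vector σ) φ-η (generates (⅓[1+σα⁴+α⁸]-vector σ) (IntegralVectors.⅓[1+σα⁴+α⁸]-integral m σ c σ² refl)))
      where
      open Realisation R m α α¹²
      open SparseValues₃ R α
      φ-η : φ (⅓[1+σα⁴+α⁸]-vector σ) ≡ η
      φ-η = begin
        φ (⅓[1+σα⁴+α⁸]-vector σ) ≡⟨ value-⅓[1+σα⁴+α⁸] σ ⟩
        ι ⅓ * (ι 1ℚ + S * α ^ 4 + α ^ 4 * α ^ 4) ≡⟨ cong (λ z → ι ⅓ * (ι 1ℚ + S * z + z * z)) α⁴ ⟩
        ι ⅓ * (ι 1ℚ + S * (S * κ) + S * κ * (S * κ)) ≡⟨ solve 2 (λ s k → con ⅓ :* (con 1ℚ :+ s :* (s :* k) :+ s :* k :* (s :* k)) := con ⅓ :* (con 1ℚ :+ s :* s :* k :+ s :* s :* (k :* k))) refl S κ ⟩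
        ι ⅓ * (ι 1ℚ + S * S * κ + S * S * (κ * κ)) ≡⟨ cong₂ (λ x y → ι ⅓ * (ι 1ℚ + x * κ + x * y)) SS κ² ⟩
        ι ⅓ * (ι 1ℚ + ι 1ℚ * κ + ι 1ℚ * (ι (ℤ→ℚ (+ 3)) * η - τ - ι (ℤ→ℚ (+ 2)))) ≡⟨ solve 2 (λ t h → con ⅓ :* (con 1ℚ :+ con 1ℚ :* (con 1ℚ :+ t) :+ con 1ℚ :* (:ℕ 3 :* h :- t :- :ℕ 2)) := h) refl τ η ⟩
        η ∎

halves-≡ : ∀ {n} {A : Set} {ε ε' : Fin (n ℕ.+ n) → A} → (∀ i → ε (i ↑ˡ n) ≡ ε' (i ↑ˡ n)) → (∀ i → ε (n ↑ʳ i) ≡ ε' (n ↑ʳ i)) → ∀ i → ε i ≡ ε' i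
halves-≡ {n} {ε = ε} {ε'} left right i = subst (λ j → ε j ≡ ε' j) (FinP.join-splitAt n n i) (go (splitAt n i))
  where
  go : ∀ s → ε (join n n s) ≡ ε' (join n n s)
  go (inj₁ j) = left j
  go (inj₂ j) = right j

module _ (T : ℚAlgebra) {Λ J : ℚAlgebra.Carrier T → Set} (unit-ball : Integrality.IsUnitBall T three Λ J)
         (σ c : ℤ) (σ² : σ ℤ.* σ ≡ + 1) where
  open ℚAlgebra T

  private
    m : ℤ
    m = σ ℤ.* (+ 1 ℤ.+ + 9 ℤ.* c)

  module UnitBall₃ {i ν τ η e : Carrier} (Λi : Λ i) (Λν : Λ ν) (Λτ : Λ τ) (Λη : Λ η) (Λe : Λ e) (ν² : ν * ν ≡ i) (i² : i * i ≡ ι (ℤ→ℚ m))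
      (τ² : τ * τ ≡ ι (ℤ→ℚ (+ 3)) * (η - τ - ι 1ℚ)) (τη : τ * η ≡ ι (ℤ→ℚ (+ 3)) * ι (ℤ→ℚ c))
      (Jτ : J τ) (η²-η : J (η * η - η))
      {n : ℕ} (w : (Fin n → Fin 3) → Carrier)
      (w-generated : ∀ {S} → Subsets.Subring T S → S i → S ν → S η → ∀ ε → S (w ε))
      (w-injective : ∀ ε ε' → J (e * (w ε - w ε')) → ∀ j → ε j ≡ ε' j) where

    private
      open Integrality T three using (module IsUnitBall)
      open IsUnitBall unit-ball
      open Subsets.Ideal ideal using (subring)
      open Subsets.Subring subring
      module Cb = Cubes T ideal π-ideal

      not-monogenic : ∀ {d} (rel : Vec ℤ (suc d)) → suc d ℕ.< n →
        (∀ {θ} → Λ θ → PolynomialValues.ℤ[θ] T θ i → Cb.MonicRelation e rel θ) →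
        ∀ u → u ℚ.* ℤ→ℚ m ≡ 1ℚ → ¬ Monogenic m
      not-monogenic {d} rel d<n relation u um = TwelfthRoot₃.not-monogenic T σ c σ² u um {ν} {τ} {η}
          (trans (cong (λ z → z * z) ν²) i²) τ² τη no-generator
        where
        no-generator : ∀ {θ} → Evaluation.Integral T θ → PolynomialValues.ℤ[θ] T θ ν → PolynomialValues.ℤ[θ] T θ η → ⊥
        no-generator {θ} θ-integral ν∈ η∈ = Pigeonhole.no-independent-values T three
            (Cb.annihilator {e} Λe) (Cb.annihilator-π {e} Λe) Λθ rel (relation Λθ i∈) d<n w
            (w-generated {ℤ[θ]} values-subring i∈ ν∈ η∈) (λ ε ε' p → w-injective ε ε' (Cb.killed p))
          where
          open PolynomialValues T θ
          Λθ : Λ θ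
          Λθ = integral⇒Λ θ-integral
          i∈ : ℤ[θ] i
          i∈ = subst ℤ[θ] ν² (Subsets.Subring.*-closed values-subring ν∈ ν∈)

      1+9c : ι (ℤ→ℚ (+ 1 ℤ.+ + 9 ℤ.* c)) ≡ ι 1ℚ + ι (ℤ→ℚ (+ 9)) * ι (ℤ→ℚ c)
      1+9c = ι-1+n*k T 9 c

    not-monogenic⁻ : σ ≡ -[1+ 0 ] → 6 ℕ.< n → ∀ u → u ℚ.* ℤ→ℚ m ≡ 1ℚ → ¬ Monogenic m
    not-monogenic⁻ σ≡-1 6<n = not-monogenic (-[1+ 0 ] ∷ + 0 ∷ -[1+ 0 ] ∷ + 0 ∷ -[1+ 0 ] ∷ + 0 ∷ []) 6<n
      (λ Λθ i∈ → Cb.sextic-relation c Λi Λθ (reduced Λθ) i²≡ i∈ Λe)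
      where
      i²≡ : i * i ≡ - (ι 1ℚ + ι (ℤ→ℚ (+ 9)) * ι (ℤ→ℚ c))
      i²≡ = trans i² (trans (cong ι (trans (cong (λ s → ℤ→ℚ (s ℤ.* (+ 1 ℤ.+ + 9 ℤ.* c))) σ≡-1)
          (trans (cong ℤ→ℚ (ℤP.-1*i≡-i (+ 1 ℤ.+ + 9 ℤ.* c))) (ℤ→ℚ-neg (+ 1 ℤ.+ + 9 ℤ.* c)))))
        (trans (ι-neg _) (cong -_ 1+9c)))

    -- Cubing fixes every element of `Λ` modulo `(J : 1 + i)`, in particular θ. This is checked on
    -- ring generators of `Λ`, and `G` supplies the rational scalars among them; for these the
    -- congruence is Fermat's.
    not-monogenic⁺ : σ ≡ + 1 → e ≡ ι 1ℚ + i → 3 ℕ.< n → (G : ℚ → Set) →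
      (∀ {q} → G q → Λ (ι q)) → FermatClosed G →
      (∀ {S} → Subsets.Subring T S → (∀ {q} → G q → S (ι q)) → S i → S ν → S τ → S η → ∀ {x} → Λ x → S x) →
      ∀ u → u ℚ.* ℤ→ℚ m ≡ 1ℚ → ¬ Monogenic m
    not-monogenic⁺ σ≡1 e≡ 3<n G G-Λ G-cube generated = not-monogenic (+ 0 ∷ + 1 ∷ + 0 ∷ []) 3<n
      (λ {θ} Λθ _ → subst (λ z → Cb.MonicRelation z (+ 0 ∷ + 1 ∷ + 0 ∷ []) θ) (sym e≡) (Cb.cubic-relation Λ1+i (all-fixed Λθ)))
      where
      i²≡ : i * i ≡ ι 1ℚ + ι (ℤ→ℚ (+ 9)) * ι (ℤ→ℚ c)
      i²≡ = trans i² (trans (cong (λ s → ι (ℤ→ℚ (s ℤ.* (+ 1 ℤ.+ + 9 ℤ.* c)))) σ≡1)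
              (trans (cong (λ z → ι (ℤ→ℚ z)) (ℤP.*-identityˡ (+ 1 ℤ.+ + 9 ℤ.* c))) 1+9c))

      Λ1+i : Λ (ι 1ℚ + i)
      Λ1+i = +-closed (int (+ 1)) Λi

      all-fixed : ∀ {x} → Λ x → Cb.Fixed³ Λ1+i x
      all-fixed = generated (Cb.fixed-subring Λ1+i)
        (λ {q} Gq → Cb.ι-fixed Λ1+i q (G-Λ Gq) (G-Λ (G-cube Gq)))
        (Cb.i-fixed c Λi i²≡) (Cb.√i-fixed c Λi i²≡ Λν ν²)
        (Cb.nilpotent-fixed³ Λ1+i Λτ Jτ) (Cb.idempotent-fixed³ Λ1+i Λη η²-η)

difference : ∀ (A : ℚAlgebra) (let open ℚAlgebra A) x z x' z' h →
  (x + z * h) - (x' + z' * h) ≡ (x - x') + (z - z') * h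
difference A = solve 5 (λ x z x' z' h → (x :+ z :* h) :- (x' :+ z' :* h) := (x :- x') :+ (z :- z') :* h) refl
  where open ℚAlgebra.Solver A

module _ (R : ℚAlgebra) {P : ℚAlgebra.Carrier R → Set} (O : ÉtaleOrder three R P)
         (σ c : ℤ) (σ² : σ ℤ.* σ ≡ + 1) where
  open ℚAlgebra R

  private
    m : ℤ
    m = σ ℤ.* (+ 1 ℤ.+ + 9 ℤ.* c)

  module NonMonogenic₃ {i ν e : Carrier} (Pi : P i) (Pν : P ν) (Pe : P e) (ν² : ν * ν ≡ i) (i² : i * i ≡ ι (ℤ→ℚ m))
      {n : ℕ} (w₀ : (Fin n → Fin 3) → Carrier)
      (w₀-generated : ∀ {S} → Subsets.Subring R S → S i → S ν → ∀ ε → S (w₀ ε))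
      (w₀-injective : ∀ ε ε' → P (ι ⅓ * (e * (w₀ ε - w₀ ε'))) → ∀ j → ε j ≡ ε' j) where

    private
      module Q = Cubic₃ R O c
      open Q using (T; incl; incl-hom; τ; η; unit-ball; J)
      module T = ℚAlgebra T
      open _⟶_ incl-hom
      open Subsets.Subring (ÉtaleOrder.subring O)

      Λe : Q.Λ (incl e)
      Λe = Pe , int (+ 0) , int (+ 0)

      -- The classes 1 and η form a basis of `Λ/J` over `P/3P`, so the number of independent digits
      -- doubles.
      w : (Fin (n ℕ.+ n) → Fin 3) → T.Carrier
      w ε = incl (w₀ (ε ∘ (_↑ˡ n))) T.+ incl (w₀ (ε ∘ (n ↑ʳ_))) T.* η

      J-coordinates : ∀ {x z} → J (incl e T.* (incl x T.+ incl z T.* η)) → P (ι ⅓ * (e * x)) × P (ι ⅓ * (e * z))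
      J-coordinates {x} {z} p = let p₁ , _ , p₃ = subst J eq p in p₁ , p₃
        where
        eq : incl e T.* (incl x T.+ incl z T.* η) ≡ (e * x , e * ι 0ℚ , e * z)
        eq = trans (cong (incl e T.*_) (trans (cong (incl x T.+_) (Q.incl-*ˡ z (ι 0ℚ) (ι 0ℚ) (ι 1ℚ)))
               (cong₂ _,_ (solve 2 (λ x z → x :+ z :* con 0ℚ := x) refl x z)
                 (cong₂ _,_ (solve 1 (λ z → con 0ℚ :+ z :* con 0ℚ := con 0ℚ) refl z) (solve 1 (λ z → con 0ℚ :+ z :* con 1ℚ := z) refl z)))))
             (Q.incl-*ˡ e x (ι 0ℚ) z)
          where open Solver

      incl-minus : ∀ x y → incl x T.- incl y ≡ incl (x - y)
      incl-minus x y = sym (trans (+-homo x (- y)) (cong (incl x T.+_) (neg-homo y)))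

      w-injective : ∀ ε ε' → J (incl e T.* (w ε T.- w ε')) → ∀ j → ε j ≡ ε' j
      w-injective ε ε' p = halves-≡ {ε = ε} {ε'} (w₀-injective _ _ (proj₁ halves)) (w₀-injective _ _ (proj₂ halves))
        where
        x = w₀ (ε ∘ (_↑ˡ n))
        x' = w₀ (ε' ∘ (_↑ˡ n))
        z = w₀ (ε ∘ (n ↑ʳ_))
        z' = w₀ (ε' ∘ (n ↑ʳ_))
        eq : w ε T.- w ε' ≡ incl (x - x') T.+ incl (z - z') T.* η
        eq = trans (difference T (incl x) (incl z) (incl x') (incl z') η)
               (cong₂ (λ a b → a T.+ b T.* η) (incl-minus x x') (incl-minus z z'))
        halves : P (ι ⅓ * (e * (x - x'))) × P (ι ⅓ * (e * (z - z')))
        halves = J-coordinates {x - x'} {z - z'} (subst (λ v → J (incl e T.* v)) eq p)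

      w-generated : ∀ {S} → Subsets.Subring T S → S (incl i) → S (incl ν) → S η → ∀ ε → S (w ε)
      w-generated {S} S-sub Si Sν Sη ε = Subsets.Subring.+-closed S-sub {incl x} {incl z T.* η} (values (ε ∘ (_↑ˡ n)))
          (Subsets.Subring.*-closed S-sub {incl z} {η} (values (ε ∘ (n ↑ʳ_))) Sη)
        where
        x = w₀ (ε ∘ (_↑ˡ n))
        z = w₀ (ε ∘ (n ↑ʳ_))
        values : ∀ ε → S (incl (w₀ ε))
        values = w₀-generated (Pullback.pullback incl-hom {S} S-sub) Si Sν

      T-τ² : τ T.* τ ≡ T.ι (ℤ→ℚ (+ 3)) T.* (η T.- τ T.- T.ι 1ℚ)
      T-τ² = trans Q.τ² (sym (trans (Q.incl-*ˡ (ι (ℤ→ℚ (+ 3))) (ι 0ℚ - ι 0ℚ - ι 1ℚ) (ι 0ℚ - ι 1ℚ - ι 0ℚ) (ι 1ℚ - ι 0ℚ - ι 0ℚ))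
          (cong₂ _,_ (solve 0 (:ℕ 3 :* (con 0ℚ :- con 0ℚ :- con 1ℚ) := :- (con (ℤ→ℚ -[1+ 2 ]) :* con (ℤ→ℚ -[1+ 0 ]))) refl)
            (cong₂ _,_ (solve 0 (:ℕ 3 :* (con 0ℚ :- con 1ℚ :- con 0ℚ) := con (ℤ→ℚ -[1+ 2 ])) refl)
                       (solve 0 (:ℕ 3 :* (con 1ℚ :- con 0ℚ :- con 0ℚ) := :- con (ℤ→ℚ -[1+ 2 ])) refl)))))
        where open Solver

      T-τη : τ T.* η ≡ T.ι (ℤ→ℚ (+ 3)) T.* T.ι (ℤ→ℚ c)
      T-τη = trans Q.τη (trans (cong incl (solve 1 (λ c → :- (con (ℤ→ℚ -[1+ 2 ]) :* c) := :ℕ 3 :* c) refl (ι (ℤ→ℚ c))))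
               (*-homo (ι (ℤ→ℚ (+ 3))) (ι (ℤ→ℚ c))))
        where open Solver

      T-ν² : incl ν T.* incl ν ≡ incl i
      T-ν² = trans (sym (*-homo ν ν)) (cong incl ν²)

      T-i² : incl i T.* incl i ≡ T.ι (ℤ→ℚ m)
      T-i² = trans (sym (*-homo i i)) (cong incl i²)

      Λi : Q.Λ (incl i)
      Λi = Pi , int (+ 0) , int (+ 0)

      Λν : Q.Λ (incl ν)
      Λν = Pν , int (+ 0) , int (+ 0)

      module U = UnitBall₃ T {Q.Λ} {J} unit-ball σ c σ² {incl i} {incl ν} {τ} {η} {incl e} Λi Λν Q.τ∈Λ Q.η∈Λ Λe
                   T-ν² T-i² T-τ² T-τη Q.τ∈J Q.η²-η∈J w w-generated w-injective

    not-monogenic⁻ : σ ≡ -[1+ 0 ] → 6 ℕ.< n ℕ.+ n → ∀ u → u ℚ.* ℤ→ℚ m ≡ 1ℚ → ¬ Monogenic m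
    not-monogenic⁻ = U.not-monogenic⁻

    not-monogenic⁺ : σ ≡ + 1 → e ≡ ι 1ℚ + i → 3 ℕ.< n ℕ.+ n → (G : ℚ → Set) →
      (∀ {q} → G q → P (ι q)) → FermatClosed G →
      (∀ {S} → Subsets.Subring R S → (∀ {q} → G q → S (ι q)) → S i → S ν → ∀ {x} → P x → S x) →
      ∀ u → u ℚ.* ℤ→ℚ m ≡ 1ℚ → ¬ Monogenic m
    not-monogenic⁺ σ≡1 e≡ 3<n G G-P G-cube P-generated = U.not-monogenic⁺ σ≡1 (trans (cong incl e≡) (+-homo (ι 1ℚ) i)) 3<n G
      (λ Gq → G-P Gq , int (+ 0) , int (+ 0)) G-cube
      (λ {S} S-sub SG Si Sν Sτ Sη → Q.Λ-generated {S} (Subsets.Subring.+-closed S-sub) (Subsets.Subring.*-closed S-sub)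
        (P-generated (Pullback.pullback incl-hom {S} S-sub) SG Si Sν) Sτ Sη)

module SquareRoots₃ (R : ℚAlgebra) {P : ℚAlgebra.Carrier R → Set} (P-subring : Subsets.Subring R P) where
  open ℚAlgebra R
  open Solver
  open Subsets.Subring P-subring
  open PrimeIdeal three R P-subring

  -- Here `x⁹ = b⁴ x`, and `b⁴` is 1 modulo 3.
  square-root-étale : ∀ {x b h} → P x → P h → x * x ≡ b → b * b * (b * b) ≡ ι 1ℚ + ι (ℤ→ℚ (+ 3)) * h → Étale x
  square-root-étale {x} {_} {h} Px Ph refl b⁴ = fix Px (subst P (sym lemma) (*-closed Ph Px))
    where
    lemma : ι ⅓ * ((x ^ 3) ^ 3 - x) ≡ h * x
    lemma = trans (solve 1 (λ x → let b = x :* x in con ⅓ :* ((x :^ 3) :^ 3 :- x) := con ⅓ :* (b :* b :* (b :* b) :- con 1ℚ) :* x) refl x)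
      (trans (cong (λ z → ι ⅓ * (z - ι 1ℚ) * x) b⁴)
        (solve 2 (λ h x → con ⅓ :* (con 1ℚ :+ :ℕ 3 :* h :- con 1ℚ) :* x := h :* x) refl h x))

drop-zero : ∀ (R : ℚAlgebra) (let open ℚAlgebra R) x y → ι 0ℚ * x + y ≡ y
drop-zero R x y = solve 2 (λ x y → con 0ℚ :* x :+ y := y) refl x y
  where open ℚAlgebra.Solver R

module SignedCube (σ c : ℤ) (σ² : σ ℤ.* σ ≡ + 1) where
  m h : ℤ
  m = σ ℤ.* (+ 1 ℤ.+ + 9 ℤ.* c)
  h = + 6 ℤ.* c ℤ.+ + 27 ℤ.* (c ℤ.* c)

  -- The sign disappears in `m² = (1 + 9 c)²`. This yields `ν⁹ ≡ ν` through `ν⁸ = m²` and, squared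
  -- again, `i⁹ ≡ i` through `i⁸ = m⁴`.
  m² : m ℤ.* m ≡ + 1 ℤ.+ + 3 ℤ.* h
  m² = trans (solve 2 (λ s c → let m = s :* (con (+ 1) :+ con (+ 9) :* c) in m :* m := s :* s :* ((con (+ 1) :+ con (+ 9) :* c) :* (con (+ 1) :+ con (+ 9) :* c))) refl σ c)
    (trans (cong (ℤ._* ((+ 1 ℤ.+ + 9 ℤ.* c) ℤ.* (+ 1 ℤ.+ + 9 ℤ.* c))) σ²)
      (solve 1 (λ c → con (+ 1) :* ((con (+ 1) :+ con (+ 9) :* c) :* (con (+ 1) :+ con (+ 9) :* c)) := con (+ 1) :+ con (+ 3) :* (con (+ 6) :* c :+ con (+ 27) :* (c :* c))) refl c))
    where open ℤSolver.+-*-Solver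

  module _ (R : ℚAlgebra) where
    open ℚAlgebra R
    open Solver

    ι-m² : ι (ℤ→ℚ m) * ι (ℤ→ℚ m) ≡ ι 1ℚ + ι (ℤ→ℚ (+ 3)) * ι (ℤ→ℚ h)
    ι-m² = trans (sym (trans (cong ι (ℤ→ℚ-* m m)) (ι-* _ _))) (trans (cong (λ z → ι (ℤ→ℚ z)) m²) (ι-1+n*k R 3 h))

    h₄ : Carrier
    h₄ = ι (ℤ→ℚ (+ 2)) * ι (ℤ→ℚ h) + ι (ℤ→ℚ (+ 3)) * (ι (ℤ→ℚ h) * ι (ℤ→ℚ h))

    ι-m⁴ : ι (ℤ→ℚ m) * ι (ℤ→ℚ m) * (ι (ℤ→ℚ m) * ι (ℤ→ℚ m)) ≡ ι 1ℚ + ι (ℤ→ℚ (+ 3)) * h₄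
    ι-m⁴ = trans (cong (λ z → z * z) ι-m²) (solve 1 (λ h → let x = con 1ℚ :+ :ℕ 3 :* h in
      x :* x := con 1ℚ :+ :ℕ 3 :* (:ℕ 2 :* h :+ :ℕ 3 :* (h :* h))) refl (ι (ℤ→ℚ h)))

-- R = Q₁[ν]/(ν² - i) over Q₁ = ℚ[i]/(i² - m).
module _ (Q₁ : ℚAlgebra) {P : ℚAlgebra.Carrier Q₁ → Set} (P-order : ÉtaleOrder three Q₁ P)
         (σ c : ℤ) (σ² : σ ℤ.* σ ≡ + 1) where
  open ℚAlgebra Q₁

  private
    m : ℤ
    m = σ ℤ.* (+ 1 ℤ.+ + 9 ℤ.* c)

  module RootStage₃ {i e : Carrier} (Pi : P i) (Pe : P e) (i² : i * i ≡ ι (ℤ→ℚ m))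
      {n : ℕ} (w₁ : (Fin n → Fin 3) → Carrier)
      (w₁-generated : ∀ {S} → Subsets.Subring Q₁ S → S i → ∀ ε → S (w₁ ε))
      (w₁-injective : ∀ ε ε' → P (ι ⅓ * (e * (w₁ ε - w₁ ε'))) → ∀ j → ε j ≡ ε' j) where

    private
      open Subsets.Subring (ÉtaleOrder.subring P-order)

      0# : Carrier
      0# = ι 0ℚ

      R = Quadratic.algebra Q₁ 0# i
      module R where
        open ℚAlgebra R public
        open Quadratic Q₁ 0# i public using (gen; gen²; incl; incl-*ˡ)
      module QR = QuadraticOrder Q₁ 0# i
      incl-hom : Q₁ ⟶ R
      incl-hom = quadratic-incl Q₁ 0# i
      open _⟶_ incl-hom
      open SignedCube σ c σ² using (h; ι-m²)

      ν² : R.gen R.* R.gen ≡ R.incl i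
      ν² = trans R.gen² (drop-zero R R.gen (R.incl i))

      R-i² : R.incl i R.* R.incl i ≡ R.ι (ℤ→ℚ m)
      R-i² = trans (sym (*-homo i i)) (cong R.incl i²)

      R-order : ÉtaleOrder three R (QR._² P)
      R-order = QuadraticÉtale.order three P-order {0#} {i} (int (+ 0)) Pi
        (SquareRoots₃.square-root-étale R (QR.²-subring (ÉtaleOrder.subring P-order) (int (+ 0)) Pi)
          {R.gen} {R.incl i} {R.ι (ℤ→ℚ h)} (int (+ 0) , int (+ 1)) (int h , int (+ 0)) ν²
          (trans (cong (λ z → z R.* z) R-i²) (ι-m² R)))

      w : (Fin (n ℕ.+ n) → Fin 3) → R.Carrier
      w ε = w₁ (ε ∘ (_↑ˡ n)) , w₁ (ε ∘ (n ↑ʳ_))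

      w-generated : ∀ {S} → Subsets.Subring R S → S (R.incl i) → S R.gen → ∀ ε → S (w ε)
      w-generated {S} S-sub Si Sν ε = QR.²-generated {λ x → S (R.incl x)} {S} (Subsets.Subring.+-closed S-sub) (Subsets.Subring.*-closed S-sub)
        id Sν (values (ε ∘ (_↑ˡ n)) , values (ε ∘ (n ↑ʳ_)))
        where
        values : ∀ ε → S (R.incl (w₁ ε))
        values = w₁-generated (Pullback.pullback incl-hom {S} S-sub) Si

      w-injective : ∀ ε ε' → (QR._² P) (R.ι ⅓ R.* (R.incl e R.* (w ε R.- w ε'))) → ∀ j → ε j ≡ ε' j
      w-injective ε ε' p = halves-≡ {ε = ε} {ε'} (w₁-injective _ _ (proj₁ halves)) (w₁-injective _ _ (proj₂ halves))
        where
        x = w₁ (ε ∘ (_↑ˡ n)) - w₁ (ε' ∘ (_↑ˡ n))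
        z = w₁ (ε ∘ (n ↑ʳ_)) - w₁ (ε' ∘ (n ↑ʳ_))
        eq : R.incl e R.* (w ε R.- w ε') ≡ (e * x , e * z)
        eq = R.incl-*ˡ e x z
        halves : P (ι ⅓ * (e * x)) × P (ι ⅓ * (e * z))
        halves = QR.²-scale {P} ⅓ {e * x} {e * z} (subst (λ v → (QR._² P) (R.ι ⅓ R.* v)) eq p)

      module N = NonMonogenic₃ R R-order σ c σ² {R.incl i} {R.gen} {R.incl e}
                   (Pi , int (+ 0)) (int (+ 0) , int (+ 1)) (Pe , int (+ 0)) ν² R-i² w w-generated w-injective

    not-monogenic⁻ : σ ≡ -[1+ 0 ] → 6 ℕ.< n ℕ.+ n ℕ.+ (n ℕ.+ n) → ∀ u → u ℚ.* ℤ→ℚ m ≡ 1ℚ → ¬ Monogenic m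
    not-monogenic⁻ = N.not-monogenic⁻

    not-monogenic⁺ : σ ≡ + 1 → e ≡ ι 1ℚ + i → 3 ℕ.< n ℕ.+ n ℕ.+ (n ℕ.+ n) → (G : ℚ → Set) →
      (∀ {q} → G q → P (ι q)) → FermatClosed G →
      (∀ {S} → Subsets.Subring Q₁ S → (∀ {q} → G q → S (ι q)) → S i → ∀ {x} → P x → S x) →
      ∀ u → u ℚ.* ℤ→ℚ m ≡ 1ℚ → ¬ Monogenic m
    not-monogenic⁺ σ≡1 e≡ 3<n G G-P G-cube P-generated = N.not-monogenic⁺ σ≡1 (trans (cong R.incl e≡) (+-homo (ι 1ℚ) i)) 3<n G
      (λ Gq → G-P Gq , int (+ 0)) G-cube
      (λ {S} S-sub SG Si Sν → QR.²-generated {P} {S} (Subsets.Subring.+-closed S-sub) (Subsets.Subring.*-closed S-sub)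
        (P-generated (Pullback.pullback incl-hom {S} S-sub) SG Si) Sν)

module _ {Q : ℚAlgebra} {Z : ℚAlgebra.Carrier Q → Set} (Z-order : ÉtaleOrder three Q Z)
         (σ c : ℤ) (σ² : σ ℤ.* σ ≡ + 1) where
  open ℚAlgebra Q

  private
    m : ℤ
    m = σ ℤ.* (+ 1 ℤ.+ + 9 ℤ.* c)

  module BaseStage₃ (digit : Fin 3 → Carrier) (digit-int : ∀ i → ∃ λ n → digit i ≡ ι (ℤ→ℚ n))
      (digit-injective : ∀ i j → Z (ι ⅓ * (digit i - digit j)) → i ≡ j) where

    private
      open Subsets.Subring (ÉtaleOrder.subring Z-order)

      0# M : Carrier
      0# = ι 0ℚ
      M = ι (ℤ→ℚ m)

      Q₁ = Quadratic.algebra Q 0# M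
      module Q₁ where
        open ℚAlgebra Q₁ public
        open Quadratic Q 0# M public using (gen; gen²; incl; incl-*ˡ)
      module QQ = QuadraticOrder Q 0# M
      incl-hom : Q ⟶ Q₁
      incl-hom = quadratic-incl Q 0# M
      open SignedCube σ c σ² using (h; h₄; ι-m⁴)

      i² : Q₁.gen Q₁.* Q₁.gen ≡ Q₁.ι (ℤ→ℚ m)
      i² = trans Q₁.gen² (drop-zero Q₁ Q₁.gen (Q₁.incl M))

      Q₁-subring : Subsets.Subring Q₁ (QQ._² Z)
      Q₁-subring = QQ.²-subring (ÉtaleOrder.subring Z-order) (int (+ 0)) (int m)

      Q₁-order : ÉtaleOrder three Q₁ (QQ._² Z)
      Q₁-order = QuadraticÉtale.order three Z-order {0#} {M} (int (+ 0)) (int m)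
        (SquareRoots₃.square-root-étale Q₁ Q₁-subring {Q₁.gen} {Q₁.ι (ℤ→ℚ m)} {h₄ Q₁} (int (+ 0) , int (+ 1))
          (SQ.+-closed {Q₁.ι (ℤ→ℚ (+ 2)) Q₁.* H} {Q₁.ι (ℤ→ℚ (+ 3)) Q₁.* (H Q₁.* H)}
            (SQ.*-closed {Q₁.ι (ℤ→ℚ (+ 2))} {H} (SQ.int (+ 2)) (SQ.int h))
            (SQ.*-closed {Q₁.ι (ℤ→ℚ (+ 3))} {H Q₁.* H} (SQ.int (+ 3)) (SQ.*-closed {H} {H} (SQ.int h) (SQ.int h))))
          i² (ι-m⁴ Q₁))
        where
        module SQ = Subsets.Subring Q₁-subring
        H = Q₁.ι (ℤ→ℚ h)

      digit-generated : ∀ {S} → Subsets.Subring Q₁ S → ∀ j → S (Q₁.incl (digit j))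
      digit-generated {S} S-sub j = subst (λ q → S (Q₁.incl q)) (sym (proj₂ (digit-int j))) (Subsets.Subring.int S-sub (proj₁ (digit-int j)))

      -- For σ = -1 the multiplier `e` is 1 and no factor is discarded. The two digits of `a + b i`
      -- are doubled by ν and again by η, giving the dimension 8.
      w⁻ : (Fin 2 → Fin 3) → Q₁.Carrier
      w⁻ ε = digit (ε (# 0)) , digit (ε (# 1))

      w⁻-generated : ∀ {S} → Subsets.Subring Q₁ S → S Q₁.gen → ∀ ε → S (w⁻ ε)
      w⁻-generated {S} S-sub Si ε = QQ.²-generated {λ q → S (Q₁.incl q)} {S} (Subsets.Subring.+-closed S-sub) (Subsets.Subring.*-closed S-sub)
        id Si (digit-generated {S} S-sub (ε (# 0)) , digit-generated {S} S-sub (ε (# 1)))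

      w⁻-injective : ∀ ε ε' → (QQ._² Z) (Q₁.ι ⅓ Q₁.* (Q₁.ι 1ℚ Q₁.* (w⁻ ε Q₁.- w⁻ ε'))) → ∀ j → ε j ≡ ε' j
      w⁻-injective ε ε' p = λ { zero → digit-injective _ _ (proj₁ both) ; (suc zero) → digit-injective _ _ (proj₂ both) }
        where
        open Solver
        x = digit (ε (# 0)) - digit (ε' (# 0))
        y = digit (ε (# 1)) - digit (ε' (# 1))
        eq : Q₁.ι 1ℚ Q₁.* (w⁻ ε Q₁.- w⁻ ε') ≡ (x , y)
        eq = trans (Q₁.incl-*ˡ (ι 1ℚ) x y) (cong₂ _,_ (solve 1 (λ x → con 1ℚ :* x := x) refl x) (solve 1 (λ x → con 1ℚ :* x := x) refl y))
        both : Z (ι ⅓ * x) × Z (ι ⅓ * y)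
        both = QQ.²-scale {Z} ⅓ {x} {y} (subst (λ v → (QQ._² Z) (Q₁.ι ⅓ Q₁.* v)) eq p)

      -- For σ = 1 multiplication by `1 + i` identifies `i` with 1 modulo 3, so a single constant
      -- digit remains at this stage. Doubling by ν and by η gives 4 digits, against a relation of
      -- degree 3.
      w⁺ : (Fin 1 → Fin 3) → Q₁.Carrier
      w⁺ ε = Q₁.incl (digit (ε zero))

      1+i : Q₁.Carrier
      1+i = ι 1ℚ , ι 1ℚ

      w⁺-injective : ∀ ε ε' → (QQ._² Z) (Q₁.ι ⅓ Q₁.* (1+i Q₁.* (w⁺ ε Q₁.- w⁺ ε'))) → ∀ j → ε j ≡ ε' j
      w⁺-injective ε ε' p = λ { zero → digit-injective _ _ (proj₁ both) }
        where
        open Solver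
        x = digit (ε zero) - digit (ε' zero)
        eq : 1+i Q₁.* (w⁺ ε Q₁.- w⁺ ε') ≡ (x , x)
        eq = cong₂ _,_ (solve 2 (λ x m → con 1ℚ :* x :+ m :* (con 1ℚ :* (con 0ℚ :- con 0ℚ)) := x) refl x M)
               (solve 1 (λ x → con 1ℚ :* (con 0ℚ :- con 0ℚ) :+ con 1ℚ :* x :+ con 0ℚ :* (con 1ℚ :* (con 0ℚ :- con 0ℚ)) := x) refl x)
        both : Z (ι ⅓ * x) × Z (ι ⅓ * x)
        both = QQ.²-scale {Z} ⅓ {x} {x} (subst (λ v → (QQ._² Z) (Q₁.ι ⅓ Q₁.* v)) eq p)

      i∈ : (QQ._² Z) Q₁.gen
      i∈ = int (+ 0) , int (+ 1)

      module N⁻ = RootStage₃ Q₁ Q₁-order σ c σ² {Q₁.gen} {Q₁.ι 1ℚ} i∈ (int (+ 1) , int (+ 0)) i² w⁻ w⁻-generated w⁻-injective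
      module N⁺ = RootStage₃ Q₁ Q₁-order σ c σ² {Q₁.gen} {1+i} i∈ (int (+ 1) , int (+ 1)) i² w⁺ (λ {S} S-sub _ ε → digit-generated {S} S-sub (ε zero)) w⁺-injective

    not-monogenic⁻ : σ ≡ -[1+ 0 ] → ∀ u → u ℚ.* ℤ→ℚ m ≡ 1ℚ → ¬ Monogenic m
    not-monogenic⁻ σ≡-1 = N⁻.not-monogenic⁻ σ≡-1 (s≤s (s≤s (s≤s (s≤s (s≤s (s≤s (s≤s z≤n)))))))

    not-monogenic⁺ : σ ≡ + 1 → (G : ℚ → Set) →
      (∀ {q} → G q → Z (ι q)) → FermatClosed G →
      (∀ {S} → Subsets.Subring Q S → (∀ {q} → G q → S (ι q)) → ∀ {x} → Z x → S x) →
      ∀ u → u ℚ.* ℤ→ℚ m ≡ 1ℚ → ¬ Monogenic m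
    not-monogenic⁺ σ≡1 G G-Z G-cube Z-generated = N⁺.not-monogenic⁺ σ≡1
      (cong₂ _,_ (solve 0 (con 1ℚ := con 1ℚ :+ con 0ℚ) refl) (solve 0 (con 1ℚ := con 0ℚ :+ con 1ℚ) refl))
      (s≤s (s≤s (s≤s (s≤s z≤n)))) G (λ Gq → G-Z Gq , int (+ 0)) G-cube
      (λ {S} S-sub SG Si → QQ.²-generated {Z} {S} (Subsets.Subring.+-closed S-sub) (Subsets.Subring.*-closed S-sub)
        (Z-generated (Pullback.pullback incl-hom {S} S-sub) SG) Si)
      where open Solver

module _ (c : ℤ) where
  private
    open Localisation three

    module Stage (σ : ℤ) (σ² : σ ℤ.* σ ≡ + 1) = BaseStage₃ loc-étale σ c σ² (λ i → ℤ→ℚ (+ toℕ i)) (λ i → + toℕ i , refl) digits-injective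

  not-monogenic₉⁺ : ¬ Monogenic (+ 1 ℤ.* (+ 1 ℤ.+ + 9 ℤ.* c))
  not-monogenic₉⁺ = Stage.not-monogenic⁺ (+ 1) refl refl Loc id fermat (λ _ SG → SG) (proj₁ (reciprocal m≢0)) (proj₂ (reciprocal m≢0))
    where
    m≢0 : ℤ→ℚ (+ 1 ℤ.* (+ 1 ℤ.+ + 9 ℤ.* c)) ≢ 0ℚ
    m≢0 m≡0 = 1+n*k≢0 9 c (λ ()) (trans (sym (ℤP.*-identityˡ _)) (ℤ→ℚ-injective m≡0))

  not-monogenic₉⁻ : ¬ Monogenic (-[1+ 0 ] ℤ.* (+ 1 ℤ.+ + 9 ℤ.* c))
  not-monogenic₉⁻ = Stage.not-monogenic⁻ -[1+ 0 ] refl refl (proj₁ (reciprocal m≢0)) (proj₂ (reciprocal m≢0))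
    where
    m≢0 : ℤ→ℚ (-[1+ 0 ] ℤ.* (+ 1 ℤ.+ + 9 ℤ.* c)) ≢ 0ℚ
    m≢0 m≡0 = 1+n*k≢0 9 c (λ ()) (ℤP.neg-injective (trans (sym (ℤP.-1*i≡-i _)) (ℤ→ℚ-injective m≡0)))

-- The congruences on m in parametrised form, and the conclusion

open import Data.Integer using (_-_; _+_)
open import Data.Integer.Divisibility using (_∣_)

private
  shift-by-one : ∀ m n k → m - + 1 ≡ k ℤ.* n → m ≡ + 1 + n ℤ.* k
  shift-by-one m n k eq = trans (solve 1 (λ m → m := con (+ 1) :+ (m :- con (+ 1))) refl m)
    (cong (ℤ._+_ (+ 1)) (trans eq (ℤP.*-comm k n)))
    where open ℤSolver.+-*-Solver

  shift-by-minus-one : ∀ m n k → m + + 1 ≡ k ℤ.* n → m ≡ -[1+ 0 ] ℤ.* (+ 1 + n ℤ.* (ℤ.- k))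
  shift-by-minus-one m n k eq = trans (solve 1 (λ m → m := m :+ con (+ 1) :- con (+ 1)) refl m)
    (trans (cong (_- + 1) eq)
      (solve 2 (λ k n → k :* n :- con (+ 1) := con -[1+ 0 ] :* (con (+ 1) :+ n :* (:- k))) refl k n))
    where open ℤSolver.+-*-Solver

theorem2p2 : (m : ℤ) → SquareFree m → m ≢ + 1 → m ≢ -[1+ 0 ]
    → ((+ 4) ∣ (m - + 1) ⊎ ((+ 9) ∣ (m - + 1) ⊎ (+ 9) ∣ (m + + 1)))
    → ¬ Monogenic m
theorem2p2 m _ _ _ (inj₁ 4∣m-1) = subst (λ m → ¬ Monogenic m) (sym (shift-by-one m (+ 4) k eq)) (not-monogenic₄ k)
  where open ℤ∣._∣_ (ℤ∣.∣ᵤ⇒∣ {+ 4} {m - + 1} 4∣m-1) renaming (quotient to k; equality to eq)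
theorem2p2 m _ _ _ (inj₂ (inj₁ 9∣m-1)) = subst (λ m → ¬ Monogenic m)
    (trans (ℤP.*-identityˡ (+ 1 + + 9 ℤ.* k)) (sym (shift-by-one m (+ 9) k eq))) (not-monogenic₉⁺ k)
  where open ℤ∣._∣_ (ℤ∣.∣ᵤ⇒∣ {+ 9} {m - + 1} 9∣m-1) renaming (quotient to k; equality to eq)
theorem2p2 m _ _ _ (inj₂ (inj₂ 9∣m+1)) = subst (λ m → ¬ Monogenic m) (sym (shift-by-minus-one m (+ 9) k eq)) (not-monogenic₉⁻ (ℤ.- k))
  where open ℤ∣._∣_ (ℤ∣.∣ᵤ⇒∣ {+ 9} {m + + 1} 9∣m+1) renaming (quotient to k; equality to eq)
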